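{- Let $d\in\{ -163,-67,-43,-19,-11,-7,-3,-2,-1\}$ and $z\in\mathcal O_{\mathbb{Q}(\sqrt{d})}\setminus\{0\}$, with $I_n^*$ computed in $\mathcal O_{\mathbb{Q}(\sqrt{d})}$. For every integer $n\ge 4$, $I_n^*(z)<2$. Furthermore, if $I_3^*(z)$ is rational, then $I_3^*(z)<2$.
   Context: $\mathcal O_{\mathbb{Q}(\sqrt{d})}$ is $\mathbb{Z}[\frac{1+\sqrt d}{2}]$ if $d\equiv 1 \pmod 4$ and $\mathbb{Z}[\sqrt d]$ if $d\equiv 2,3\pmod 4$; for the listed $d$ it is a unique factorization domain. Viewing elements as complex numbers, $|z|=\sqrt{z\bar z}$ and $\arg(z)\in[0,2\pi)$. Define $A(d)$ to be the set of nonzero $z\in\mathcal O_{\mathbb{Q}(\sqrt{d})}$ with $0\le\arg(z)<\pi/2$ if $d=-1$, with $0\le \arg(z)<\pi/3$ if $d=-3$, and with $0\le\arg(z)<\pi$ otherwise. Two elements are relatively prime if they have no nonunit common divisor. For nonzero $x,z$, write $x\Diamond z$ iff $x\in A(d)$, $x\mid z$, and $x$ is relatively prime to $z/x$. For $m\in\mathbb{Z}$ define $\delta_m^*(z)=\sum_{x\Diamond z}|x|^m$ and $I_m^*(z)=\delta_m^*(z)/|z|^m$ for nonzero $z$. -}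

module Defs where

open import Algebra.Bundles using (CommutativeRing; CommutativeSemiring)
import Algebra.Definitions.RawMagma as RawMagma
import Algebra.Definitions.RawSemiring
open import Data.Bool using (if_then_else_)
open import Data.Integer as ℤ using (ℤ; +_; -[1+_]; +[1+_]; 0ℤ; 1ℤ; _%ℕ_; _/ℕ_)
import Data.Integer.Properties as ℤ
import Data.Integer.Tactic.RingSolver as ℤR
open import Data.List using (List; []; _∷_; _++_; map; foldr; filter; upTo; cartesianProductWith)
open import Data.List.Membership.Propositional using (_∈_; find; lose)
open import Data.List.Membership.Propositional.Properties using (∈-map⁺; ∈-++⁺ˡ; ∈-++⁺ʳ; ∈-upTo⁺; ∈-cartesianProductWith⁺; ∈-filter⁺; ∈-map⁻)
open import Data.List.Relation.Unary.All as All using (All; []; _∷_)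
open import Data.List.Relation.Unary.All.Properties using (all-filter)
open import Data.List.Relation.Unary.Any using (any?)
open import Data.List.Relation.Unary.Unique.Propositional using (Unique)
import Data.List.Relation.Unary.Unique.Propositional.Properties as Unique
open import Data.Nat as ℕ using (ℕ; zero; suc)
import Data.Nat.Properties as ℕ
import Data.Nat.Tactic.RingSolver as ℕR
open import Data.Product using (∃; _×_; _,_; proj₁; proj₂)
open import Data.Sum using (_⊎_; inj₁; inj₂)
open import Level using (0ℓ)
open import Relation.Binary.PropositionalEquality hiding (J)
open import Relation.Nullary using (¬_; Dec; yes; no; contradiction; ¬?; ⌊_⌋; _×-dec_; _⊎-dec_; _→-dec_)
open import Relation.Nullary.Decidable using (map′; from-yes)

module Reals where

  open import Data.Rational
  open import Data.Rational.Properties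
  open import Data.Rational.Solver using (module +-*-Solver)
  open +-*-Solver
  import Data.Rational.Unnormalised as ℚᵘ
  import Data.Rational.Unnormalised.Properties as ℚᵘ

  half-sum : ∀ p → ½ * p + ½ * p ≡ p
  half-sum p = trans (sym (*-distribʳ-+ p ½ ½)) (*-identityˡ p)

  *-pos : ∀ {p q} → 0ℚ < p → 0ℚ < q → 0ℚ < p * q
  *-pos {p} {q} 0<p 0<q =
    positive⁻¹ _ ⦃ pos*pos⇒pos p ⦃ positive 0<p ⦄ q ⦃ positive 0<q ⦄ ⦄

  recip : ∀ p → 0ℚ < p → ℚ
  recip p 0<p = (1/ p) ⦃ pos⇒nonZero p ⦃ positive 0<p ⦄ ⦄

  recip-pos : ∀ p (0<p : 0ℚ < p) → 0ℚ < recip p 0<p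
  recip-pos p 0<p = positive⁻¹ _ ⦃ 1/pos⇒pos p ⦃ positive 0<p ⦄ ⦄

  recip-inverse : ∀ p (0<p : 0ℚ < p) → p * recip p 0<p ≡ 1ℚ
  recip-inverse p 0<p = *-inverseʳ p ⦃ pos⇒nonZero p ⦃ positive 0<p ⦄ ⦄

  *-mono-≤-nonNeg : ∀ {p q r s} → 0ℚ ≤ q → 0ℚ ≤ r → p ≤ q → r ≤ s → p * r ≤ q * s
  *-mono-≤-nonNeg {p} {q} {r} {s} 0≤q 0≤r p≤q r≤s =
    ≤-trans (*-monoʳ-≤-nonNeg r ⦃ nonNegative 0≤r ⦄ p≤q)
            (*-monoˡ-≤-nonNeg q ⦃ nonNegative 0≤q ⦄ r≤s)

  scale-< : ∀ {b ε} x t → ∣ x ∣ ≤ b → 0ℚ < b → 0ℚ ≤ t → t < ε → ∣ x ∣ * t < b * ε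
  scale-< {b} x t x≤b 0<b 0≤t t<ε =
    ≤-<-trans (*-monoʳ-≤-nonNeg t ⦃ nonNegative 0≤t ⦄ x≤b)
              (*-monoʳ-<-pos b ⦃ positive 0<b ⦄ t<ε)

  ∣-∣-< : ∀ {p q r} → p < q + r → q < p + r → ∣ p - q ∣ < r
  ∣-∣-< {p} {q} {r} p<q+r q<p+r with ∣p∣≡p∨∣p∣≡-p (p - q)
  ... | inj₁ e = subst (_< r) (sym e)
        (subst (p - q <_) (solve 2 (λ q r → q :+ r :- q := r) refl q r) (+-monoˡ-< (- q) p<q+r))
  ... | inj₂ e = subst (_< r) (trans (solve 2 (λ p q → q :- p := :- (p :- q)) refl p q) (sym e))
        (subst (q - p <_) (solve 2 (λ p r → p :+ r :- p := r) refl p r) (+-monoˡ-< (- p) q<p+r))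

  ∣-∣-sym : ∀ p q → ∣ p - q ∣ ≡ ∣ q - p ∣
  ∣-∣-sym p q = trans (cong ∣_∣ (solve 2 (λ p q → p :- q := :- (q :- p)) refl p q)) (∣-p∣≡∣p∣ (q - p))

  /-mono-< : ∀ i j m n → i ℤ.* + suc n ℤ.< j ℤ.* + suc m → i / suc m < j / suc n
  /-mono-< i j m n lt = toℚᵘ-cancel-<
    (ℚᵘ.<-respˡ-≃ (ℚᵘ.≃-sym (toℚᵘ-fromℚᵘ (ℚᵘ.mkℚᵘ i m)))
      (ℚᵘ.<-respʳ-≃ (ℚᵘ.≃-sym (toℚᵘ-fromℚᵘ (ℚᵘ.mkℚᵘ j n))) (ℚᵘ.*<* lt)))

  /-mono-≤ : ∀ i j m n → i ℤ.* + suc n ℤ.≤ j ℤ.* + suc m → i / suc m ≤ j / suc n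
  /-mono-≤ i j m n le = toℚᵘ-cancel-≤
    (ℚᵘ.≤-respˡ-≃ (ℚᵘ.≃-sym (toℚᵘ-fromℚᵘ (ℚᵘ.mkℚᵘ i m)))
      (ℚᵘ.≤-respʳ-≃ (ℚᵘ.≃-sym (toℚᵘ-fromℚᵘ (ℚᵘ.mkℚᵘ j n))) (ℚᵘ.*≤* le)))

  /-+ : ∀ i j n → i / suc n + j / suc n ≡ (i ℤ.+ j) / suc n
  /-+ i j n = toℚᵘ-injective (ℚᵘ.≃-trans (toℚᵘ-homo-+ (i / suc n) (j / suc n))
    (ℚᵘ.≃-trans (ℚᵘ.+-cong (toℚᵘ-fromℚᵘ (ℚᵘ.mkℚᵘ i n)) (toℚᵘ-fromℚᵘ (ℚᵘ.mkℚᵘ j n)))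
    (ℚᵘ.≃-trans (ℚᵘ.*≡* eq) (ℚᵘ.≃-sym (toℚᵘ-fromℚᵘ (ℚᵘ.mkℚᵘ (i ℤ.+ j) n))))))
    where
    N = + suc n
    eq : (i ℤ.* N ℤ.+ j ℤ.* N) ℤ.* N ≡ (i ℤ.+ j) ℤ.* (N ℤ.* N)
    eq = trans (cong (ℤ._* N) (sym (ℤ.*-distribʳ-+ N i j))) (ℤ.*-assoc (i ℤ.+ j) N N)

  archimedean : ∀ {ε} → 0ℚ < ε → ∃ λ N → + 1 / suc N < ε
  archimedean {mkℚ +[1+ a ] b c} _ = suc b , subst (+ 1 / suc (suc b) <_) (↥p/↧p≡p (mkℚ +[1+ a ] b c)) (/-mono-< (+ 1) (+ suc a) (suc b) b (ℤ.+<+ (begin-strict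
      1 ℕ.* suc b ≡⟨ ℕ.*-identityˡ _ ⟩
      suc b <⟨ ℕ.n<1+n _ ⟩
      suc (suc b) ≤⟨ ℕ.m≤m+n _ (a ℕ.* suc (suc b)) ⟩
      suc a ℕ.* suc (suc b) ∎)))
      where open ℕ.≤-Reasoning
  archimedean {mkℚ (+ 0) _ _} (*<* (ℤ.+<+ ()))
  archimedean {mkℚ -[1+ _ ] _ _} (*<* ())

  record ℝ : Set where
    field
      seq    : ℕ → ℚ
      cauchy : ∀ {ε} → 0ℚ < ε →
               ∃ λ N → ∀ {m n} → N ℕ.≤ m → N ℕ.≤ n → ∣ seq m - seq n ∣ < ε
  open ℝ public

  infix 4 _≈ᴿ_ _<ᴿ_
  _≈ᴿ_ : ℝ → ℝ → Set
  x ≈ᴿ y = ∀ {ε} → 0ℚ < ε → ∃ λ N → ∀ {n} → N ℕ.≤ n → ∣ seq x n - seq y n ∣ < ε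

  _<ᴿ_ : ℝ → ℝ → Set
  x <ᴿ y = ∃ λ ε → 0ℚ < ε × ∃ λ N → ∀ {n} → N ℕ.≤ n → seq x n + ε ≤ seq y n

  fromℚ : ℚ → ℝ
  fromℚ q = record
    { seq    = λ _ → q
    ; cauchy = λ {ε} 0<ε → 0 , λ _ _ → subst (λ p → ∣ p ∣ < ε) (sym (+-inverseʳ q)) 0<ε
    }

  infixl 6 _+ᴿ_
  _+ᴿ_ : ℝ → ℝ → ℝ
  x +ᴿ y = record
    { seq    = λ n → seq x n + seq y n
    ; cauchy = λ {ε} 0<ε →
        let 0<½ε   = *-pos {½} {ε} (positive⁻¹ ½) 0<ε
            (M , p) = cauchy x 0<½ε
            (N , q) = cauchy y 0<½ε
        in M ℕ.⊔ N , λ {m} {n} hm hn → begin-strict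
          ∣ (seq x m + seq y m) - (seq x n + seq y n) ∣
            ≡⟨ cong ∣_∣ (solve 4 (λ a b c d → (a :+ b) :- (c :+ d) := (a :- c) :+ (b :- d))
                 refl (seq x m) (seq y m) (seq x n) (seq y n)) ⟩
          ∣ (seq x m - seq x n) + (seq y m - seq y n) ∣
            ≤⟨ ∣p+q∣≤∣p∣+∣q∣ (seq x m - seq x n) (seq y m - seq y n) ⟩
          ∣ seq x m - seq x n ∣ + ∣ seq y m - seq y n ∣
            <⟨ +-mono-< (p (ℕ.m⊔n≤o⇒m≤o M N hm) (ℕ.m⊔n≤o⇒m≤o M N hn))
                        (q (ℕ.m⊔n≤o⇒n≤o M N hm) (ℕ.m⊔n≤o⇒n≤o M N hn)) ⟩
          ½ * ε + ½ * ε
            ≡⟨ half-sum ε ⟩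
          ε ∎
    }
    where open ≤-Reasoning

  bounded : ∀ x → ∃ λ B → 0ℚ < B × ∃ λ N → ∀ {n} → N ℕ.≤ n → ∣ seq x n ∣ ≤ B
  bounded x with cauchy x (positive⁻¹ 1ℚ)
  ... | N , p = ∣ seq x N ∣ + 1ℚ
      , <-≤-trans (positive⁻¹ 1ℚ) (subst (_≤ ∣ seq x N ∣ + 1ℚ) (+-identityˡ 1ℚ) (+-monoˡ-≤ 1ℚ (0≤∣p∣ (seq x N))))
      , N , λ {n} hn → begin
        ∣ seq x n ∣
          ≡⟨ cong ∣_∣ (solve 2 (λ a b → a := b :+ (a :- b)) refl (seq x n) (seq x N)) ⟩
        ∣ seq x N + (seq x n - seq x N) ∣
          ≤⟨ ∣p+q∣≤∣p∣+∣q∣ (seq x N) (seq x n - seq x N) ⟩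
        ∣ seq x N ∣ + ∣ seq x n - seq x N ∣
          ≤⟨ +-monoʳ-≤ ∣ seq x N ∣ (<⇒≤ (p hn ℕ.≤-refl)) ⟩
        ∣ seq x N ∣ + 1ℚ ∎
    where open ≤-Reasoning

  infixl 7 _*ᴿ_
  _*ᴿ_ : ℝ → ℝ → ℝ
  x *ᴿ y = record
    { seq    = λ n → seq x n * seq y n
    ; cauchy = λ {ε} 0<ε →
        let (A , 0<A , K , a) = bounded x
            (B , 0<B , L , b) = bounded y
            0<A+B = +-mono-< 0<A 0<B
            δ     = ε * recip (A + B) 0<A+B
            0<δ   = *-pos {ε} 0<ε (recip-pos (A + B) 0<A+B)
            (M , p) = cauchy x 0<δ
            (N , q) = cauchy y 0<δ
        in (K ℕ.⊔ L) ℕ.⊔ (M ℕ.⊔ N) , λ {m} {n} hm hn →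
          let hm₁ = ℕ.m⊔n≤o⇒m≤o (K ℕ.⊔ L) (M ℕ.⊔ N) hm
              hm₂ = ℕ.m⊔n≤o⇒n≤o (K ℕ.⊔ L) (M ℕ.⊔ N) hm
              hn₁ = ℕ.m⊔n≤o⇒m≤o (K ℕ.⊔ L) (M ℕ.⊔ N) hn
              hn₂ = ℕ.m⊔n≤o⇒n≤o (K ℕ.⊔ L) (M ℕ.⊔ N) hn
              Δx  = seq x m - seq x n
              Δy  = seq y m - seq y n
          in begin-strict
          ∣ seq x m * seq y m - seq x n * seq y n ∣
            ≡⟨ cong ∣_∣ (solve 4 (λ a b c d → a :* b :- c :* d := a :* (b :- d) :+ d :* (a :- c))
                 refl (seq x m) (seq y m) (seq x n) (seq y n)) ⟩
          ∣ seq x m * Δy + seq y n * Δx ∣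
            ≤⟨ ∣p+q∣≤∣p∣+∣q∣ (seq x m * Δy) (seq y n * Δx) ⟩
          ∣ seq x m * Δy ∣ + ∣ seq y n * Δx ∣
            ≡⟨ cong₂ _+_ (∣p*q∣≡∣p∣*∣q∣ (seq x m) Δy) (∣p*q∣≡∣p∣*∣q∣ (seq y n) Δx) ⟩
          ∣ seq x m ∣ * ∣ Δy ∣ + ∣ seq y n ∣ * ∣ Δx ∣
            <⟨ +-mono-<
                 (scale-< (seq x m) ∣ Δy ∣ (a (ℕ.m⊔n≤o⇒m≤o K L hm₁)) 0<A (0≤∣p∣ Δy)
                   (q (ℕ.m⊔n≤o⇒n≤o M N hm₂) (ℕ.m⊔n≤o⇒n≤o M N hn₂)))
                 (scale-< (seq y n) ∣ Δx ∣ (b (ℕ.m⊔n≤o⇒n≤o K L hn₁)) 0<B (0≤∣p∣ Δx)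
                   (p (ℕ.m⊔n≤o⇒m≤o M N hm₂) (ℕ.m⊔n≤o⇒m≤o M N hn₂))) ⟩
          A * δ + B * δ
            ≡⟨ solve 4 (λ A B e r → A :* (e :* r) :+ B :* (e :* r) := e :* ((A :+ B) :* r))
                 refl A B ε (recip (A + B) 0<A+B) ⟩
          ε * ((A + B) * recip (A + B) 0<A+B)
            ≡⟨ cong (ε *_) (recip-inverse (A + B) 0<A+B) ⟩
          ε * 1ℚ
            ≡⟨ *-identityʳ ε ⟩
          ε ∎
    }
    where open ≤-Reasoning

  0ᴿ 1ᴿ : ℝ
  0ᴿ = fromℚ 0ℚ
  1ᴿ = fromℚ 1ℚ

  ⊔-pos : ∀ {δ} → 0ℚ < δ → ∀ q → 0ℚ < δ ⊔ q
  ⊔-pos {δ} 0<δ q = <-≤-trans 0<δ (p≤p⊔q δ q)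

  recip-anti : ∀ {p q} → p ≤ q → ∀ 0<p 0<q → recip q 0<q ≤ recip p 0<p
  recip-anti {p} {q} p≤q 0<p 0<q = begin
    r                ≡⟨ *-identityʳ r ⟨
    r * 1ℚ           ≡⟨ cong (r *_) (recip-inverse p 0<p) ⟨
    r * (p * s)      ≡⟨ solve 3 (λ p r s → r :* (p :* s) := (p :* r) :* s) refl p r s ⟩
    (p * r) * s      ≤⟨ *-monoʳ-≤-nonNeg s ⦃ nonNegative (<⇒≤ (recip-pos p 0<p)) ⦄
                         (*-monoʳ-≤-nonNeg r ⦃ nonNegative (<⇒≤ (recip-pos q 0<q)) ⦄ p≤q) ⟩
    (q * r) * s      ≡⟨ cong (_* s) (recip-inverse q 0<q) ⟩
    1ℚ * s           ≡⟨ *-identityˡ s ⟩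
    s ∎
    where
    open ≤-Reasoning
    r = recip q 0<q
    s = recip p 0<p

  recip-lip : ∀ {p q} 0<p 0<q → recip p 0<p - recip q 0<q ≡ (recip p 0<p * recip q 0<q) * (q - p)
  recip-lip {p} {q} 0<p 0<q = begin
    r - s                          ≡⟨ cong₂ _-_ (*-identityʳ r) (*-identityʳ s) ⟨
    r * 1ℚ - s * 1ℚ                ≡⟨ cong₂ (λ u v → r * u - s * v) (recip-inverse q 0<q) (recip-inverse p 0<p) ⟨
    r * (q * s) - s * (p * r)      ≡⟨ solve 4 (λ p q r s → r :* (q :* s) :- s :* (p :* r) := (r :* s) :* (q :- p)) refl p q r s ⟩
    (r * s) * (q - p)              ∎
    where
    open ≡-Reasoning
    r = recip p 0<p
    s = recip q 0<q

  -- Truncating below by a positive lower bound leaves the limit unchanged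
  -- and makes every term invertible.
  inv : (x : ℝ) → 0ᴿ <ᴿ x → ℝ
  inv x (δ , 0<δ , K , k) = record
    { seq    = λ n → recip (δ ⊔ seq x n) (⊔-pos 0<δ (seq x n))
    ; cauchy = λ {ε} 0<ε →
        let (N , p) = cauchy x (*-pos {ε} 0<ε (*-pos 0<δ 0<δ))
        in K ℕ.⊔ N , λ {m} {n} hm hn →
          let u = seq x m ; v = seq x n
              r = recip (δ ⊔ u) (⊔-pos 0<δ u) ; s = recip (δ ⊔ v) (⊔-pos 0<δ v)
              0<r = recip-pos (δ ⊔ u) (⊔-pos 0<δ u) ; 0<s = recip-pos (δ ⊔ v) (⊔-pos 0<δ v)
              t = recip δ 0<δ
              0<t = recip-pos δ 0<δ
          in begin-strict
          ∣ r - s ∣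
            ≡⟨ cong ∣_∣ (recip-lip (⊔-pos 0<δ u) (⊔-pos 0<δ v)) ⟩
          ∣ r * s * (δ ⊔ v - (δ ⊔ u)) ∣
            ≡⟨ ∣p*q∣≡∣p∣*∣q∣ (r * s) (δ ⊔ v - (δ ⊔ u)) ⟩
          ∣ r * s ∣ * ∣ δ ⊔ v - (δ ⊔ u) ∣
            ≡⟨ cong₂ (λ a b → ∣ r * s ∣ * ∣ a - b ∣) (stable (ℕ.m⊔n≤o⇒m≤o K N hn)) (stable (ℕ.m⊔n≤o⇒m≤o K N hm)) ⟩
          ∣ r * s ∣ * ∣ v - u ∣
            <⟨ scale-< (r * s) ∣ v - u ∣
                 (subst (_≤ t * t) (sym (0≤p⇒∣p∣≡p (<⇒≤ (*-pos 0<r 0<s))))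
                   (*-mono-≤-nonNeg (<⇒≤ 0<t) (<⇒≤ 0<s)
                     (recip-anti (p≤p⊔q δ u) 0<δ (⊔-pos 0<δ u))
                     (recip-anti (p≤p⊔q δ v) 0<δ (⊔-pos 0<δ v))))
                 (*-pos 0<t 0<t) (0≤∣p∣ (v - u))
                 (p (ℕ.m⊔n≤o⇒n≤o K N hn) (ℕ.m⊔n≤o⇒n≤o K N hm)) ⟩
          t * t * (ε * (δ * δ))
            ≡⟨ solve 3 (λ d e t → t :* t :* (e :* (d :* d)) := e :* ((d :* t) :* (d :* t))) refl δ ε t ⟩
          ε * ((δ * t) * (δ * t))
            ≡⟨ cong (λ a → ε * (a * a)) (recip-inverse δ 0<δ) ⟩
          ε * (1ℚ * 1ℚ)
            ≡⟨ *-identityʳ ε ⟩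
          ε ∎
    }
    where
    open ≤-Reasoning
    stable : ∀ {n} → K ℕ.≤ n → δ ⊔ seq x n ≡ seq x n
    stable {n} hn = p≤q⇒p⊔q≡q (subst (_≤ seq x n) (+-identityˡ δ) (k hn))

  inv-inverse : ∀ x 0<x → x *ᴿ inv x 0<x ≈ᴿ 1ᴿ
  inv-inverse x (δ , 0<δ , K , k) {ε} 0<ε = K , λ {n} hn →
    subst (λ p → ∣ p ∣ < ε)
      (sym (trans (cong (_- 1ℚ) (trans (cong (_* recip (δ ⊔ seq x n) (⊔-pos 0<δ (seq x n)))
        (sym (p≤q⇒p⊔q≡q (subst (_≤ seq x n) (+-identityˡ δ) (k hn)))))
        (recip-inverse (δ ⊔ seq x n) (⊔-pos 0<δ (seq x n))))) (+-inverseʳ 1ℚ)))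
      0<ε

  p≤∣p∣ : ∀ p → p ≤ ∣ p ∣
  p≤∣p∣ p with ≤-total 0ℚ p
  ... | inj₁ 0≤p = ≤-reflexive (sym (0≤p⇒∣p∣≡p 0≤p))
  ... | inj₂ p≤0 = ≤-trans p≤0 (0≤∣p∣ p)

  inv-pos : ∀ x 0<x → 0ᴿ <ᴿ inv x 0<x
  inv-pos x (δ , 0<δ , K , k) =
    let (B , 0<B , N , b) = bounded x
        0<δ+B = +-mono-< 0<δ 0<B
    in recip (δ + B) 0<δ+B , recip-pos (δ + B) 0<δ+B , N , λ {n} hn →
      subst (_≤ recip (δ ⊔ seq x n) (⊔-pos 0<δ (seq x n))) (sym (+-identityˡ (recip (δ + B) 0<δ+B)))
        (recip-anti (⊔-lub (subst (_≤ δ + B) (+-identityʳ δ) (+-monoʳ-≤ δ (<⇒≤ 0<B)))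
          (≤-trans (≤-trans (p≤∣p∣ (seq x n)) (b hn)) (subst (_≤ δ + B) (+-identityˡ B) (+-monoˡ-≤ B (<⇒≤ 0<δ)))))
          (⊔-pos 0<δ (seq x n)) 0<δ+B)

  *ᴿ-pos : ∀ x y → 0ᴿ <ᴿ x → 0ᴿ <ᴿ y → 0ᴿ <ᴿ x *ᴿ y
  *ᴿ-pos x y (δ , 0<δ , M , p) (ε , 0<ε , N , q) =
    δ * ε , *-pos 0<δ 0<ε , M ℕ.⊔ N , λ {n} hn →
      subst (_≤ seq x n * seq y n) (sym (+-identityˡ (δ * ε)))
        (*-mono-≤-nonNeg
          (≤-trans (<⇒≤ 0<δ) (lower δ (p (ℕ.m⊔n≤o⇒m≤o M N hn)))) (<⇒≤ 0<ε)
          (lower δ (p (ℕ.m⊔n≤o⇒m≤o M N hn))) (lower ε (q (ℕ.m⊔n≤o⇒n≤o M N hn))))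
    where
    lower : ∀ p {q} → 0ℚ + p ≤ q → p ≤ q
    lower p {q} = subst (_≤ q) (+-identityˡ p)

  infixr 8 _^ᴿ_
  _^ᴿ_ : ℝ → ℕ → ℝ
  x ^ᴿ zero  = 1ᴿ
  x ^ᴿ suc n = x *ᴿ x ^ᴿ n

  ^ᴿ-pos : ∀ x → 0ᴿ <ᴿ x → ∀ n → 0ᴿ <ᴿ x ^ᴿ n
  ^ᴿ-pos x 0<x zero    = 1ℚ , positive⁻¹ 1ℚ , 0 , λ _ → ≤-refl
  ^ᴿ-pos x 0<x (suc n) = *ᴿ-pos x (x ^ᴿ n) 0<x (^ᴿ-pos x 0<x n)

  zpow : (x : ℝ) → 0ᴿ <ᴿ x → ℤ → ℝ
  zpow x 0<x (+ n)    = x ^ᴿ n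
  zpow x 0<x -[1+ n ] = inv (x ^ᴿ suc n) (^ᴿ-pos x 0<x (suc n))

  zpow-pos : ∀ x 0<x m → 0ᴿ <ᴿ zpow x 0<x m
  zpow-pos x 0<x (+ n)    = ^ᴿ-pos x 0<x n
  zpow-pos x 0<x -[1+ n ] = inv-pos (x ^ᴿ suc n) (^ᴿ-pos x 0<x (suc n))

  ⌊√_⌋ : ℕ → ℕ
  ⌊√ zero ⌋ = 0
  ⌊√ suc n ⌋ with suc ⌊√ n ⌋ ℕ.* suc ⌊√ n ⌋ ℕ.≤? suc n
  ... | yes _ = suc ⌊√ n ⌋
  ... | no  _ = ⌊√ n ⌋

  ⌊√⌋-lower : ∀ n → ⌊√ n ⌋ ℕ.* ⌊√ n ⌋ ℕ.≤ n
  ⌊√⌋-lower zero = ℕ.z≤n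
  ⌊√⌋-lower (suc n) with suc ⌊√ n ⌋ ℕ.* suc ⌊√ n ⌋ ℕ.≤? suc n
  ... | yes le = le
  ... | no  _  = ℕ.m≤n⇒m≤1+n (⌊√⌋-lower n)

  ⌊√⌋-upper : ∀ n → n ℕ.< suc ⌊√ n ⌋ ℕ.* suc ⌊√ n ⌋
  ⌊√⌋-upper zero = ℕ.s≤s ℕ.z≤n
  ⌊√⌋-upper (suc n) with suc ⌊√ n ⌋ ℕ.* suc ⌊√ n ⌋ ℕ.≤? suc n
  ... | yes _ = ℕ.≤-<-trans (⌊√⌋-upper n) (ℕ.*-mono-< (ℕ.n<1+n (suc ⌊√ n ⌋)) (ℕ.n<1+n (suc ⌊√ n ⌋)))
  ... | no gt = ℕ.≰⇒> gt

  -- ⌊K√n⌋ / K with K = k + 1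
  √-approx : ℕ → ℕ → ℚ
  √-approx n k = + ⌊√ n ℕ.* (suc k ℕ.* suc k) ⌋ / suc k

  sq-cancel : ∀ {m n} → m ℕ.* m ℕ.< n ℕ.* n → m ℕ.< n
  sq-cancel {m} {n} lt with m ℕ.<? n
  ... | yes m<n = m<n
  ... | no  m≮n = contradiction lt (ℕ.≤⇒≯ (ℕ.*-mono-≤ (ℕ.≮⇒≥ m≮n) (ℕ.≮⇒≥ m≮n)))

  √-step : ∀ n j k → √-approx n j < √-approx n k + + 1 / suc k
  √-step n j k = subst (√-approx n j <_) (sym (/-+ (+ b) (+ 1) k))
    (/-mono-< (+ a) (+ b ℤ.+ + 1) j k
      (subst₂ ℤ._<_ (ℤ.pos-* a K) (trans (ℤ.pos-* (suc b) J) (cong (λ c → + c ℤ.* + J) (ℕ.+-comm 1 b))) (ℤ.+<+ (sq-cancel (begin-strict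
        a ℕ.* K ℕ.* (a ℕ.* K)           ≡⟨ swap a K ⟩
        a ℕ.* a ℕ.* (K ℕ.* K)           ≤⟨ ℕ.*-monoˡ-≤ (K ℕ.* K) (⌊√⌋-lower (n ℕ.* (J ℕ.* J))) ⟩
        n ℕ.* (J ℕ.* J) ℕ.* (K ℕ.* K)   ≡⟨ swap′ n (J ℕ.* J) (K ℕ.* K) ⟩
        n ℕ.* (K ℕ.* K) ℕ.* (J ℕ.* J)   <⟨ ℕ.*-monoˡ-< (J ℕ.* J) (⌊√⌋-upper (n ℕ.* (K ℕ.* K))) ⟩
        suc b ℕ.* suc b ℕ.* (J ℕ.* J)   ≡⟨ swap (suc b) J ⟨
        suc b ℕ.* J ℕ.* (suc b ℕ.* J)   ∎)))))
    where
    open ℕ.≤-Reasoning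
    J = suc j
    K = suc k
    a = ⌊√ n ℕ.* (J ℕ.* J) ⌋
    b = ⌊√ n ℕ.* (K ℕ.* K) ⌋
    swap : ∀ x y → x ℕ.* y ℕ.* (x ℕ.* y) ≡ x ℕ.* x ℕ.* (y ℕ.* y)
    swap = ℕR.solve-∀
    swap′ : ∀ x y z → x ℕ.* y ℕ.* z ≡ x ℕ.* z ℕ.* y
    swap′ = ℕR.solve-∀

  1/-anti : ∀ {N k} → N ℕ.≤ k → + 1 / suc k ≤ + 1 / suc N
  1/-anti {N} {k} N≤k = /-mono-≤ (+ 1) (+ 1) k N (ℤ.+≤+ (ℕ.*-monoʳ-≤ 1 (ℕ.s≤s N≤k)))

  √_ : ℕ → ℝ
  √ n = record
    { seq    = √-approx n
    ; cauchy = λ {ε} 0<ε →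
        let (N , p) = archimedean 0<ε
            near : ∀ {j k} → N ℕ.≤ k → √-approx n j < √-approx n k + ε
            near {j} {k} N≤k = <-trans (√-step n j k)
              (+-monoʳ-< (√-approx n k) (≤-<-trans (1/-anti N≤k) p))
        in N , λ {j} {k} N≤j N≤k → ∣-∣-< (near {j} {k} N≤k) (near {k} {j} N≤j)
    }

  √-pos : ∀ n → 0 ℕ.< n → 0ᴿ <ᴿ √ n
  √-pos n 0<n = 1ℚ , positive⁻¹ 1ℚ , 0 , λ {k} _ →
    subst (_≤ √-approx n k) (sym (+-identityˡ 1ℚ)) (one≤ k)
    where
    one≤ : ∀ k → 1ℚ ≤ √-approx n k
    one≤ k = /-mono-≤ (+ 1) (+ a) 0 k
      (subst₂ ℤ._≤_ (sym (ℤ.*-identityˡ (+ K))) (sym (ℤ.*-identityʳ (+ a)))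
        (ℤ.+≤+ (ℕ.s≤s⁻¹ (sq-cancel (ℕ.≤-<-trans
          (ℕ.m≤n*m (K ℕ.* K) n ⦃ ℕ.>-nonZero 0<n ⦄) (⌊√⌋-upper (n ℕ.* (K ℕ.* K))))))))
      where
      K = suc k
      a = ⌊√ n ℕ.* (K ℕ.* K) ⌋

  /-* : ∀ i m → (i / suc m) * (i / suc m) ≡ (i ℤ.* i) / (suc m ℕ.* suc m)
  /-* i m = toℚᵘ-injective (ℚᵘ.≃-trans (toℚᵘ-homo-* (i / suc m) (i / suc m))
    (ℚᵘ.≃-trans (ℚᵘ.*-cong fromᵘ fromᵘ)
      (ℚᵘ.≃-sym (toℚᵘ-fromℚᵘ (ℚᵘ.mkℚᵘ (i ℤ.* i) (m ℕ.+ m ℕ.* suc m))))))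
    where
    fromᵘ = toℚᵘ-fromℚᵘ (ℚᵘ.mkℚᵘ i m)

  √-square : ∀ n → √ n *ᴿ √ n ≈ᴿ fromℚ (+ n / 1)
  √-square n {ε} 0<ε =
    let (B , 0<B , M , b) = bounded (√ n)
        C     = B + B + 1ℚ
        0<C   = +-mono-< (+-mono-< 0<B 0<B) (positive⁻¹ 1ℚ)
        (N , p) = archimedean (*-pos {ε} 0<ε (recip-pos C 0<C))
    in M ℕ.⊔ N , λ {k} hk →
      let u   = √-approx n k
          h   = + 1 / suc k
          0≤h = <⇒≤ (/-mono-< (+ 0) (+ 1) 0 k (ℤ.+<+ (ℕ.s≤s ℕ.z≤n)))
          h≤1 = /-mono-≤ (+ 1) (+ 1) k 0 (ℤ.+≤+ (ℕ.s≤s ℕ.z≤n))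
          u≤B = ≤-trans (p≤∣p∣ u) (b (ℕ.m⊔n≤o⇒m≤o M N hk))
          h<  = ≤-<-trans (1/-anti (ℕ.m⊔n≤o⇒n≤o M N hk)) p
      in ∣-∣-< {u * u} {+ n / 1} {ε}
        (≤-<-trans (lower k)
          (subst (_< + n / 1 + ε) (+-identityʳ (+ n / 1)) (+-monoʳ-< (+ n / 1) 0<ε)))
        (begin-strict
          + n / 1                   <⟨ upper k ⟩
          (u + h) * (u + h)         ≡⟨ solve 2 (λ u h → (u :+ h) :* (u :+ h) := u :* u :+ h :* (u :+ u :+ h)) refl u h ⟩
          u * u + h * (u + u + h)   ≤⟨ +-monoʳ-≤ (u * u) (*-monoˡ-≤-nonNeg h ⦃ nonNegative 0≤h ⦄
                                         (+-mono-≤ (+-mono-≤ u≤B u≤B) h≤1)) ⟩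
          u * u + h * C             <⟨ +-monoʳ-< (u * u) (*-monoˡ-<-pos C ⦃ positive 0<C ⦄ h<) ⟩
          u * u + ε * recip C 0<C * C
            ≡⟨ cong (_+_ (u * u)) (trans (solve 3 (λ e r C → e :* r :* C := e :* (C :* r)) refl ε (recip C 0<C) C)
                 (trans (cong (ε *_) (recip-inverse C 0<C)) (*-identityʳ ε))) ⟩
          u * u + ε                 ∎)
    where
    open ≤-Reasoning
    lower : ∀ k → √-approx n k * √-approx n k ≤ + n / 1
    lower k = subst (_≤ + n / 1) (sym (/-* (+ a) k))
      (/-mono-≤ (+ a ℤ.* + a) (+ n) (k ℕ.+ k ℕ.* K) 0
        (subst₂ ℤ._≤_ (trans (ℤ.pos-* a a) (sym (ℤ.*-identityʳ (+ a ℤ.* + a)))) (ℤ.pos-* n (K ℕ.* K))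
          (ℤ.+≤+ (⌊√⌋-lower (n ℕ.* (K ℕ.* K))))))
      where
      K = suc k
      a = ⌊√ n ℕ.* (K ℕ.* K) ⌋
    upper : ∀ k → + n / 1 < (√-approx n k + + 1 / suc k) * (√-approx n k + + 1 / suc k)
    upper k = subst (+ n / 1 <_) (sym (trans (cong₂ _*_ sum-eq sum-eq) (/-* (+ suc a) k)))
      (/-mono-< (+ n) (+ suc a ℤ.* + suc a) 0 (k ℕ.+ k ℕ.* K)
        (subst₂ ℤ._<_ (ℤ.pos-* n (K ℕ.* K)) (trans (ℤ.pos-* (suc a) (suc a)) (sym (ℤ.*-identityʳ (+ suc a ℤ.* + suc a))))
          (ℤ.+<+ (⌊√⌋-upper (n ℕ.* (K ℕ.* K))))))
      where
      K = suc k
      a = ⌊√ n ℕ.* (K ℕ.* K) ⌋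
      sum-eq : √-approx n k + + 1 / suc k ≡ + suc a / suc k
      sum-eq = trans (/-+ (+ a) (+ 1) k) (cong (λ m → + m / suc k) (ℕ.+-comm a 1))

  2ᴿ : ℝ
  2ᴿ = fromℚ (+ 2 / 1)

  IsRational : ℝ → Set
  IsRational x = ∃ λ q → x ≈ᴿ fromℚ q

open Reals public

heegner : List ℤ
heegner = -[1+ 162 ] ∷ -[1+ 66 ] ∷ -[1+ 42 ] ∷ -[1+ 18 ] ∷ -[1+ 10 ] ∷ -[1+ 6 ]
        ∷ -[1+ 2 ] ∷ -[1+ 1 ] ∷ -[1+ 0 ] ∷ []

-- Trace and norm of ω, where ω = (1 + √d)/2 if d ≡ 1 (mod 4) and ω = √d
-- otherwise.
tr nm : ℤ → ℤ
tr d = if ⌊ d %ℕ 4 ℕ.≟ 1 ⌋ then 1ℤ else 0ℤ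
nm d = if ⌊ d %ℕ 4 ℕ.≟ 1 ⌋ then (1ℤ ℤ.- d) /ℕ 4 else ℤ.- d

-- ⟨ a , b ⟩ stands for a + bω.
record 𝒪 (d : ℤ) : Set where
  no-eta-equality
  pattern
  constructor ⟨_,_⟩
  field
    coeff₁ coeffω : ℤ
open 𝒪

module _ {d : ℤ} where
  infixl 6 _+_
  infixl 7 _*_
  infix 8 -_

  _+_ _*_ : 𝒪 d → 𝒪 d → 𝒪 d
  ⟨ a , b ⟩ + ⟨ c , e ⟩ = ⟨ a ℤ.+ c , b ℤ.+ e ⟩
  -- ω² = tr d · ω − nm d
  ⟨ a , b ⟩ * ⟨ c , e ⟩ =
    ⟨ a ℤ.* c ℤ.- nm d ℤ.* (b ℤ.* e)
    , a ℤ.* e ℤ.+ b ℤ.* c ℤ.+ tr d ℤ.* (b ℤ.* e) ⟩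

  -_ : 𝒪 d → 𝒪 d
  - ⟨ a , b ⟩ = ⟨ ℤ.- a , ℤ.- b ⟩

  0𝒪 1𝒪 : 𝒪 d
  0𝒪 = ⟨ 0ℤ , 0ℤ ⟩
  1𝒪 = ⟨ 1ℤ , 0ℤ ⟩

  -- ω̄ = tr d − ω
  conj : 𝒪 d → 𝒪 d
  conj ⟨ a , b ⟩ = ⟨ a ℤ.+ tr d ℤ.* b , ℤ.- b ⟩

  infix 4 _≟𝒪_
  _≟𝒪_ : (x y : 𝒪 d) → Dec (x ≡ y)
  ⟨ a , b ⟩ ≟𝒪 ⟨ c , e ⟩ =
    map′ (λ (p , q) → cong₂ ⟨_,_⟩ p q) (λ p → cong coeff₁ p , cong coeffω p)
         (a ℤ.≟ c ×-dec b ℤ.≟ e)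

private
  assoc₁ : ∀ t n a b c e f g →
    (a ℤ.* c ℤ.- n ℤ.* (b ℤ.* e)) ℤ.* f ℤ.- n ℤ.* ((a ℤ.* e ℤ.+ b ℤ.* c ℤ.+ t ℤ.* (b ℤ.* e)) ℤ.* g)
    ≡ a ℤ.* (c ℤ.* f ℤ.- n ℤ.* (e ℤ.* g)) ℤ.- n ℤ.* (b ℤ.* (c ℤ.* g ℤ.+ e ℤ.* f ℤ.+ t ℤ.* (e ℤ.* g)))
  assoc₁ = ℤR.solve-∀
  assoc₂ : ∀ t n a b c e f g →
    (a ℤ.* c ℤ.- n ℤ.* (b ℤ.* e)) ℤ.* g ℤ.+ (a ℤ.* e ℤ.+ b ℤ.* c ℤ.+ t ℤ.* (b ℤ.* e)) ℤ.* f
      ℤ.+ t ℤ.* ((a ℤ.* e ℤ.+ b ℤ.* c ℤ.+ t ℤ.* (b ℤ.* e)) ℤ.* g)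
    ≡ a ℤ.* (c ℤ.* g ℤ.+ e ℤ.* f ℤ.+ t ℤ.* (e ℤ.* g)) ℤ.+ b ℤ.* (c ℤ.* f ℤ.- n ℤ.* (e ℤ.* g))
      ℤ.+ t ℤ.* (b ℤ.* (c ℤ.* g ℤ.+ e ℤ.* f ℤ.+ t ℤ.* (e ℤ.* g)))
  assoc₂ = ℤR.solve-∀
  comm₁ : ∀ n a b c e → a ℤ.* c ℤ.- n ℤ.* (b ℤ.* e) ≡ c ℤ.* a ℤ.- n ℤ.* (e ℤ.* b)
  comm₁ = ℤR.solve-∀
  comm₂ : ∀ t a b c e → a ℤ.* e ℤ.+ b ℤ.* c ℤ.+ t ℤ.* (b ℤ.* e) ≡ c ℤ.* b ℤ.+ e ℤ.* a ℤ.+ t ℤ.* (e ℤ.* b)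
  comm₂ = ℤR.solve-∀
  distrib₁ : ∀ n a b c e f g →
    (c ℤ.+ f) ℤ.* a ℤ.- n ℤ.* ((e ℤ.+ g) ℤ.* b) ≡ c ℤ.* a ℤ.- n ℤ.* (e ℤ.* b) ℤ.+ (f ℤ.* a ℤ.- n ℤ.* (g ℤ.* b))
  distrib₁ = ℤR.solve-∀
  distrib₂ : ∀ t a b c e f g →
    (c ℤ.+ f) ℤ.* b ℤ.+ (e ℤ.+ g) ℤ.* a ℤ.+ t ℤ.* ((e ℤ.+ g) ℤ.* b)
    ≡ c ℤ.* b ℤ.+ e ℤ.* a ℤ.+ t ℤ.* (e ℤ.* b) ℤ.+ (f ℤ.* b ℤ.+ g ℤ.* a ℤ.+ t ℤ.* (g ℤ.* b))
  distrib₂ = ℤR.solve-∀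
  one₁ : ∀ n a b → 1ℤ ℤ.* a ℤ.- n ℤ.* (0ℤ ℤ.* b) ≡ a
  one₁ = ℤR.solve-∀
  one₂ : ∀ t a b → 1ℤ ℤ.* b ℤ.+ 0ℤ ℤ.* a ℤ.+ t ℤ.* (0ℤ ℤ.* b) ≡ b
  one₂ = ℤR.solve-∀

module _ {d : ℤ} where
  private
    *-comm : (x y : 𝒪 d) → x * y ≡ y * x
    *-comm ⟨ a , b ⟩ ⟨ c , e ⟩ = cong₂ ⟨_,_⟩ (comm₁ (nm d) a b c e) (comm₂ (tr d) a b c e)

    *-identityˡ : (x : 𝒪 d) → 1𝒪 * x ≡ x
    *-identityˡ ⟨ a , b ⟩ = cong₂ ⟨_,_⟩ (one₁ (nm d) a b) (one₂ (tr d) a b)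

    *-distribʳ-+ : (x y z : 𝒪 d) → (y + z) * x ≡ y * x + z * x
    *-distribʳ-+ ⟨ a , b ⟩ ⟨ c , e ⟩ ⟨ f , g ⟩ =
      cong₂ ⟨_,_⟩ (distrib₁ (nm d) a b c e f g) (distrib₂ (tr d) a b c e f g)

  𝒪-commutativeRing : CommutativeRing 0ℓ 0ℓ
  𝒪-commutativeRing = record
    { Carrier = 𝒪 d
    ; _≈_ = _≡_
    ; _+_ = _+_
    ; _*_ = _*_
    ; -_ = -_
    ; 0# = 0𝒪
    ; 1# = 1𝒪
    ; isCommutativeRing = record
      { isRing = record
        { +-isAbelianGroup = record
          { isGroup = record
            { isMonoid = record
              { isSemigroup = record
                { isMagma = record { isEquivalence = isEquivalence ; ∙-cong = cong₂ _+_ }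
                ; assoc = λ { ⟨ a , b ⟩ ⟨ c , e ⟩ ⟨ f , g ⟩ → cong₂ ⟨_,_⟩ (ℤ.+-assoc a c f) (ℤ.+-assoc b e g) }
                }
              ; identity = (λ { ⟨ a , b ⟩ → cong₂ ⟨_,_⟩ (ℤ.+-identityˡ a) (ℤ.+-identityˡ b) })
                         , (λ { ⟨ a , b ⟩ → cong₂ ⟨_,_⟩ (ℤ.+-identityʳ a) (ℤ.+-identityʳ b) })
              }
            ; inverse = (λ { ⟨ a , b ⟩ → cong₂ ⟨_,_⟩ (ℤ.+-inverseˡ a) (ℤ.+-inverseˡ b) })
                      , (λ { ⟨ a , b ⟩ → cong₂ ⟨_,_⟩ (ℤ.+-inverseʳ a) (ℤ.+-inverseʳ b) })
            ; ⁻¹-cong = cong -_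
            }
          ; comm = λ { ⟨ a , b ⟩ ⟨ c , e ⟩ → cong₂ ⟨_,_⟩ (ℤ.+-comm a c) (ℤ.+-comm b e) }
          }
        ; *-cong = cong₂ _*_
        ; *-assoc = λ { ⟨ a , b ⟩ ⟨ c , e ⟩ ⟨ f , g ⟩ →
            cong₂ ⟨_,_⟩ (assoc₁ (tr d) (nm d) a b c e f g) (assoc₂ (tr d) (nm d) a b c e f g) }
        ; *-identity = *-identityˡ , λ x → trans (*-comm x 1𝒪) (*-identityˡ x)
        ; distrib = (λ x y z → trans (*-comm x (y + z))
                      (trans (*-distribʳ-+ x y z) (cong₂ _+_ (*-comm y x) (*-comm z x))))
                  , *-distribʳ-+
        }
      ; *-comm = *-comm
      }
    }

  open CommutativeRing 𝒪-commutativeRing using (commutativeSemiring)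
  open Algebra.Definitions.RawSemiring (CommutativeSemiring.rawSemiring commutativeSemiring) public
    using (_∣_; Coprime)

  normℤ : 𝒪 d → ℤ
  normℤ z = coeff₁ (z * conj z)

  -- z z̄ as a natural number; z*conj-z below shows that nothing is lost here.
  norm : 𝒪 d → ℕ
  norm z = ℤ.∣ normℤ z ∣

  ∣_∣ : 𝒪 d → ℝ
  ∣ z ∣ = √ norm z

  -- z = (X + Y√d) / 2 with X = 2re z and Y = 2im z; √d lies on the positive
  -- imaginary axis, so 2im z is 2 · Im z / √|d|.
  2re 2im : 𝒪 d → ℤ
  2re ⟨ a , b ⟩ = + 2 ℤ.* a ℤ.+ tr d ℤ.* b
  2im ⟨ a , b ⟩ = (+ 2 ℤ.- tr d) ℤ.* b

-- 0 ≤ arg z < θ with θ = π/2 for d = −1, θ = π/3 for d = −3 and θ = π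
-- otherwise. For d = −3 the upper bound is Im z < √3 · Re z, and the factor
-- √3 = √|d| cancels.
Sector : ∀ d → 𝒪 d → Set
Sector -[1+ 0 ] z = 0ℤ ℤ.≤ 2im z × 0ℤ ℤ.< 2re z
Sector -[1+ 2 ] z = 0ℤ ℤ.≤ 2im z × 2im z ℤ.< 2re z
Sector d        z = 0ℤ ℤ.< 2im z ⊎ (2im z ≡ 0ℤ × 0ℤ ℤ.< 2re z)

private
  sector? : ∀ d z → Dec (Sector d z)
  sector? (+ n) z = 0ℤ ℤ.<? 2im z ⊎-dec (2im z ℤ.≟ 0ℤ ×-dec 0ℤ ℤ.<? 2re z)
  sector? -[1+ 0 ] z = 0ℤ ℤ.≤? 2im z ×-dec 0ℤ ℤ.<? 2re z
  sector? -[1+ 1 ] z = 0ℤ ℤ.<? 2im z ⊎-dec (2im z ℤ.≟ 0ℤ ×-dec 0ℤ ℤ.<? 2re z)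
  sector? -[1+ 2 ] z = 0ℤ ℤ.≤? 2im z ×-dec 2im z ℤ.<? 2re z
  sector? -[1+ suc (suc (suc n)) ] z = 0ℤ ℤ.<? 2im z ⊎-dec (2im z ℤ.≟ 0ℤ ×-dec 0ℤ ℤ.<? 2re z)

module _ {d : ℤ} where
  A : 𝒪 d → Set
  A z = z ≢ 0𝒪 × Sector d z

  -- The witness y is z/x.
  infix 4 _◊_
  _◊_ : 𝒪 d → 𝒪 d → Set
  x ◊ z = A x × ∃ λ y → x * y ≡ z × Coprime x y

private
  norm-real : ∀ t a b → a ℤ.* (ℤ.- b) ℤ.+ b ℤ.* (a ℤ.+ t ℤ.* b) ℤ.+ t ℤ.* (b ℤ.* (ℤ.- b)) ≡ 0ℤ
  norm-real = ℤR.solve-∀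
  norm-mult : ∀ t n a b c e →
    (a ℤ.* c ℤ.- n ℤ.* (b ℤ.* e)) ℤ.* ((a ℤ.* c ℤ.- n ℤ.* (b ℤ.* e)) ℤ.+ t ℤ.* (a ℤ.* e ℤ.+ b ℤ.* c ℤ.+ t ℤ.* (b ℤ.* e)))
    ℤ.- n ℤ.* ((a ℤ.* e ℤ.+ b ℤ.* c ℤ.+ t ℤ.* (b ℤ.* e)) ℤ.* (ℤ.- (a ℤ.* e ℤ.+ b ℤ.* c ℤ.+ t ℤ.* (b ℤ.* e))))
    ≡ (a ℤ.* (a ℤ.+ t ℤ.* b) ℤ.- n ℤ.* (b ℤ.* (ℤ.- b))) ℤ.* (c ℤ.* (c ℤ.+ t ℤ.* e) ℤ.- n ℤ.* (e ℤ.* (ℤ.- e)))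
  norm-mult = ℤR.solve-∀
  square₁ : ∀ t n a b → + 4 ℤ.* n ℤ.* (a ℤ.* (a ℤ.+ t ℤ.* b) ℤ.- n ℤ.* (b ℤ.* (ℤ.- b)))
    ≡ (+ 2 ℤ.* n ℤ.* b ℤ.+ t ℤ.* a) ℤ.* (+ 2 ℤ.* n ℤ.* b ℤ.+ t ℤ.* a) ℤ.+ (+ 4 ℤ.* n ℤ.- t ℤ.* t) ℤ.* (a ℤ.* a)
  square₁ = ℤR.solve-∀
  square₂ : ∀ t n a b → + 4 ℤ.* (a ℤ.* (a ℤ.+ t ℤ.* b) ℤ.- n ℤ.* (b ℤ.* (ℤ.- b)))
    ≡ (+ 2 ℤ.* a ℤ.+ t ℤ.* b) ℤ.* (+ 2 ℤ.* a ℤ.+ t ℤ.* b) ℤ.+ (+ 4 ℤ.* n ℤ.- t ℤ.* t) ℤ.* (b ℤ.* b)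
  square₂ = ℤR.solve-∀

  -- |disc ℚ(√d)| = 4·nm d − (tr d)² ≥ 1, i.e. the norm form is positive definite
  definite : All (λ d → 1ℤ ℤ.≤ nm d × 1ℤ ℤ.≤ + 4 ℤ.* nm d ℤ.- tr d ℤ.* tr d) heegner
  definite = from-yes (All.all? (λ d → 1ℤ ℤ.≤? nm d ×-dec 1ℤ ℤ.≤? + 4 ℤ.* nm d ℤ.- tr d ℤ.* tr d) heegner)

  0≤i*i : ∀ i → 0ℤ ℤ.≤ i ℤ.* i
  0≤i*i (+ zero) = ℤ.≤-refl
  0≤i*i +[1+ n ] = ℤ.+≤+ ℕ.z≤n
  0≤i*i -[1+ n ] = ℤ.+≤+ ℕ.z≤n

  *-mono-1≤ : ∀ {i j} → 1ℤ ℤ.≤ i → 0ℤ ℤ.≤ j → j ℤ.≤ i ℤ.* j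
  *-mono-1≤ {i} {j} 1≤i 0≤j = subst (ℤ._≤ i ℤ.* j) (ℤ.*-identityˡ j)
    (ℤ.*-monoʳ-≤-nonNeg j ⦃ ℤ.nonNegative 0≤j ⦄ 1≤i)

  i*i≡∣i∣ : ∀ i → i ℤ.* i ≡ + (ℤ.∣ i ∣ ℕ.* ℤ.∣ i ∣)
  i*i≡∣i∣ (+ n) = sym (ℤ.pos-* n n)
  i*i≡∣i∣ -[1+ n ] = refl

  ∣∣-bound : ∀ i {n} → i ℤ.* i ℤ.≤ + n → ℤ.∣ i ∣ ℕ.≤ n
  ∣∣-bound i {n} le = ℕ.≤-trans (m≤m*m ℤ.∣ i ∣) (ℤ.drop‿+≤+ (subst (ℤ._≤ + n) (i*i≡∣i∣ i) le))
    where
    m≤m*m : ∀ m → m ℕ.≤ m ℕ.* m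
    m≤m*m zero = ℕ.z≤n
    m≤m*m m@(suc _) = ℕ.m≤m*n m m

  range : ℕ → List ℤ
  range n = map +_ (upTo (suc n)) ++ map -[1+_] (upTo n)

  ∈-range : ∀ {n} i → ℤ.∣ i ∣ ℕ.≤ n → i ∈ range n
  ∈-range (+ m) m≤n = ∈-++⁺ˡ (∈-map⁺ +_ (∈-upTo⁺ (ℕ.s≤s m≤n)))
  ∈-range {n} -[1+ m ] m<n = ∈-++⁺ʳ (map +_ (upTo (suc n))) (∈-map⁺ -[1+_] (∈-upTo⁺ m<n))

  range-unique : ∀ n → Unique (range n)
  range-unique n = Unique.++⁺ (Unique.map⁺ ℤ.+-injective (Unique.upTo⁺ (suc n)))
    (Unique.map⁺ ℤ.-[1+-injective (Unique.upTo⁺ n))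
    λ (p , q) → disjoint (∈-map⁻ +_ p) (∈-map⁻ -[1+_] q)
    where
    disjoint : ∀ {i : ℤ} → (∃ λ m → m ∈ upTo (suc n) × i ≡ + m) → ¬ (∃ λ m → m ∈ upTo n × i ≡ -[1+ m ])
    disjoint (_ , _ , refl) (_ , _ , ())

module _ {d : ℤ} (d∈ : d ∈ heegner) where

  open CommutativeRing (𝒪-commutativeRing {d}) using (zeroˡ; zeroʳ; *-comm)

  1≤n : 1ℤ ℤ.≤ nm d
  1≤n = proj₁ (All.lookup definite d∈)

  1≤D : 1ℤ ℤ.≤ + 4 ℤ.* nm d ℤ.- tr d ℤ.* tr d
  1≤D = proj₂ (All.lookup definite d∈)

  ≤-sq+ : ∀ {i j} k → 1ℤ ℤ.≤ i → j ≡ k ℤ.* k → ∀ l → l ℤ.* l ℤ.≤ j ℤ.+ i ℤ.* (l ℤ.* l)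
  ≤-sq+ {i} k 1≤i refl l = ℤ.≤-trans (*-mono-1≤ 1≤i (0≤i*i l))
    (subst (ℤ._≤ k ℤ.* k ℤ.+ i ℤ.* (l ℤ.* l)) (ℤ.+-identityˡ (i ℤ.* (l ℤ.* l)))
      (ℤ.+-monoˡ-≤ (i ℤ.* (l ℤ.* l)) (0≤i*i k)))

  coeff₁-bound : (z : 𝒪 d) → coeff₁ z ℤ.* coeff₁ z ℤ.≤ + 4 ℤ.* nm d ℤ.* normℤ z
  coeff₁-bound ⟨ a , b ⟩ = subst (a ℤ.* a ℤ.≤_) (sym (square₁ (tr d) (nm d) a b))
    (≤-sq+ (+ 2 ℤ.* nm d ℤ.* b ℤ.+ tr d ℤ.* a) 1≤D refl a)

  coeffω-bound′ : (z : 𝒪 d) → coeffω z ℤ.* coeffω z ℤ.≤ + 4 ℤ.* normℤ z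
  coeffω-bound′ ⟨ a , b ⟩ = subst (b ℤ.* b ℤ.≤_) (sym (square₂ (tr d) (nm d) a b))
    (≤-sq+ (+ 2 ℤ.* a ℤ.+ tr d ℤ.* b) 1≤D refl b)

  0≤N : (z : 𝒪 d) → 0ℤ ℤ.≤ normℤ z
  0≤N z = ℤ.*-cancelˡ-≤-pos 0ℤ (normℤ z) (+ 4) (ℤ.≤-trans (0≤i*i (coeffω z)) (coeffω-bound′ z))

  coeffω-bound : (z : 𝒪 d) → coeffω z ℤ.* coeffω z ℤ.≤ + 4 ℤ.* nm d ℤ.* normℤ z
  coeffω-bound z = ℤ.≤-trans (coeffω-bound′ z) (subst (+ 4 ℤ.* normℤ z ℤ.≤_)
    (trans (sym (ℤ.*-assoc (nm d) (+ 4) (normℤ z))) (cong (ℤ._* normℤ z) (ℤ.*-comm (nm d) (+ 4))))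
    (*-mono-1≤ 1≤n (ℤ.*-monoˡ-≤-nonNeg (+ 4) (0≤N z))))

  i*i≤0⇒i≡0 : ∀ i → i ℤ.* i ℤ.≤ 0ℤ → i ≡ 0ℤ
  i*i≤0⇒i≡0 i le = ℤ.∣i∣≡0⇒i≡0 (ℕ.n≤0⇒n≡0 (∣∣-bound i le))

  4n : ℤ
  4n = + 4 ℤ.* nm d

  0≤4n : 0ℤ ℤ.≤ 4n
  0≤4n = ℤ.*-monoˡ-≤-nonNeg (+ 4) (ℤ.≤-trans (ℤ.+≤+ ℕ.z≤n) 1≤n)

  1≤N : ∀ {z : 𝒪 d} → z ≢ 0𝒪 → 1ℤ ℤ.≤ normℤ z
  1≤N {z@(⟨ a , b ⟩)} z≢0 = ℤ.i<j⇒suc[i]≤j (ℤ.≰⇒> λ N≤0 → z≢0 (cong₂ ⟨_,_⟩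
      (i*i≤0⇒i≡0 a (ℤ.≤-trans (coeff₁-bound z) (vanish N≤0)))
      (i*i≤0⇒i≡0 b (ℤ.≤-trans (coeffω-bound z) (vanish N≤0)))))
    where
    vanish : normℤ z ℤ.≤ 0ℤ → 4n ℤ.* normℤ z ℤ.≤ 0ℤ
    vanish N≤0 = subst (4n ℤ.* normℤ z ℤ.≤_) (ℤ.*-zeroʳ 4n)
      (ℤ.*-monoˡ-≤-nonNeg 4n ⦃ ℤ.nonNegative 0≤4n ⦄ N≤0)

  N-* : (x y : 𝒪 d) → normℤ (x * y) ≡ normℤ x ℤ.* normℤ y
  N-* ⟨ a , b ⟩ ⟨ c , e ⟩ = norm-mult (tr d) (nm d) a b c e

  N≡norm : (z : 𝒪 d) → normℤ z ≡ + norm z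
  N≡norm z = sym (ℤ.0≤i⇒+∣i∣≡i (0≤N z))

  bound : 𝒪 d → ℕ
  bound z = ℤ.∣ + 4 ℤ.* nm d ℤ.* normℤ z ∣

  -- Contains every divisor of z when z ≢ 0𝒪.
  box : 𝒪 d → List (𝒪 d)
  box z = cartesianProductWith ⟨_,_⟩ (range (bound z)) (range (bound z))

  box-unique : (z : 𝒪 d) → Unique (box z)
  box-unique z = Unique.cartesianProductWith⁺ ⟨_,_⟩ (λ { refl → refl , refl })
    (range-unique (bound z)) (range-unique (bound z))

  factorˡ≢0 : ∀ {x y z : 𝒪 d} → z ≢ 0𝒪 → x * y ≡ z → x ≢ 0𝒪
  factorˡ≢0 {y = y} z≢0 eq refl = z≢0 (trans (sym eq) (zeroˡ y))

  factorʳ≢0 : ∀ {x y z : 𝒪 d} → z ≢ 0𝒪 → x * y ≡ z → y ≢ 0𝒪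
  factorʳ≢0 {x} z≢0 eq refl = z≢0 (trans (sym eq) (zeroʳ x))

  factor∈box : ∀ {x y z : 𝒪 d} → z ≢ 0𝒪 → x * y ≡ z → y ∈ box z
  factor∈box {x} {y@(⟨ a , b ⟩)} {z} z≢0 eq = ∈-cartesianProductWith⁺ ⟨_,_⟩
    (∈-range a (coeff-bound a (coeff₁-bound y)))
    (∈-range b (coeff-bound b (coeffω-bound y)))
    where
    Ny≤Nz : normℤ y ℤ.≤ normℤ z
    Ny≤Nz = subst (normℤ y ℤ.≤_) (trans (sym (N-* x y)) (cong normℤ eq))
      (*-mono-1≤ (1≤N (factorˡ≢0 z≢0 eq)) (0≤N y))
    scaled : 4n ℤ.* normℤ y ℤ.≤ 4n ℤ.* normℤ z
    scaled = ℤ.*-monoˡ-≤-nonNeg 4n ⦃ ℤ.nonNegative 0≤4n ⦄ Ny≤Nz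
    coeff-bound : ∀ i → i ℤ.* i ℤ.≤ 4n ℤ.* normℤ y → ℤ.∣ i ∣ ℕ.≤ bound z
    coeff-bound i le = ∣∣-bound i (subst (i ℤ.* i ℤ.≤_)
      (sym (ℤ.0≤i⇒+∣i∣≡i (ℤ.≤-trans (0≤i*i i) (ℤ.≤-trans le scaled))))
      (ℤ.≤-trans le scaled))

  divides? : (x : 𝒪 d) {z : 𝒪 d} → z ≢ 0𝒪 → Dec (x ∣ z)
  divides? x {z} z≢0 = map′
    (λ p → let (y , _ , eq) = find p in y RawMagma., eq)
    (λ { (y RawMagma., eq) → lose (factor∈box z≢0 (trans (*-comm x y) eq)) eq })
    (any? (λ y → y * x ≟𝒪 z) (box z))

  coprime? : ∀ {x y : 𝒪 d} → x ≢ 0𝒪 → y ≢ 0𝒪 → Dec (Coprime x y)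
  coprime? {x} {y} x≢0 y≢0 = map′ from to
    (All.all? (λ w → divides? w x≢0 →-dec (divides? w y≢0 →-dec divides? w 1≢0)) (box x))
    where
    1≢0 : 1𝒪 ≢ 0𝒪
    1≢0 ()
    divisor∈box : ∀ {w} → w ∣ x → w ∈ box x
    divisor∈box (y RawMagma., eq) = factor∈box x≢0 eq
    Common : 𝒪 d → Set
    Common w = w ∣ x → w ∣ y → w ∣ 1𝒪
    from : All Common (box x) → Coprime x y
    from all w∣x w∣y = All.lookup all (divisor∈box w∣x) w∣x w∣y
    to : Coprime x y → All Common (box x)
    to cop = All.tabulate λ _ w∣x w∣y → cop w∣x w∣y

  ◊? : ∀ {z : 𝒪 d} → z ≢ 0𝒪 → ∀ x → Dec (x ◊ z)
  ◊? {z} z≢0 x = (¬? (x ≟𝒪 0𝒪) ×-dec sector? d x) ×-dec map′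
    (λ p → let (y , _ , q) = find p in y , q)
    (λ (y , q) → lose (factor∈box z≢0 (proj₁ q)) q)
    (any? cofactor? (box z))
    where
    cofactor? : ∀ y → Dec (x * y ≡ z × Coprime x y)
    cofactor? y with x * y ≟𝒪 z
    ... | no  neq = no λ (eq , _) → neq eq
    ... | yes eq  = map′ (λ cop → eq , λ {w} → cop {w}) (λ (_ , cop) {w} → cop {w})
                       (coprime? (factorˡ≢0 z≢0 eq) (factorʳ≢0 z≢0 eq))

  z*conj-z : (z : 𝒪 d) → z * conj z ≡ ⟨ + norm z , 0ℤ ⟩
  z*conj-z z@(⟨ a , b ⟩) = cong₂ ⟨_,_⟩ (N≡norm z) (norm-real (tr d) a b)

  unitaryDivisors : (z : 𝒪 d) → z ≢ 0𝒪 → List (∃ λ x → x ◊ z)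
  unitaryDivisors z z≢0 = All.toList (all-filter (◊? z≢0) (box z))

  proj₁-toList : ∀ {P : 𝒪 d → Set} {xs} (pxs : All P xs) → map proj₁ (All.toList pxs) ≡ xs
  proj₁-toList []       = refl
  proj₁-toList (_ ∷ ps) = cong (_ ∷_) (proj₁-toList ps)

  unitaryDivisors-complete : (z : 𝒪 d) (z≢0 : z ≢ 0𝒪) {x : 𝒪 d} → x ◊ z → x ∈ map proj₁ (unitaryDivisors z z≢0)
  unitaryDivisors-complete z z≢0 {x} x◊z@(_ , y , eq , _) =
    subst (x ∈_) (sym (proj₁-toList (all-filter (◊? z≢0) (box z))))
      (∈-filter⁺ (◊? z≢0) (factor∈box z≢0 (trans (*-comm y x) eq)) x◊z)

  unitaryDivisors-unique : (z : 𝒪 d) (z≢0 : z ≢ 0𝒪) → Unique (map proj₁ (unitaryDivisors z z≢0))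
  unitaryDivisors-unique z z≢0 =
    subst Unique (sym (proj₁-toList (all-filter (◊? z≢0) (box z))))
      (Unique.filter⁺ (◊? z≢0) (box-unique z))

  ∣∣-pos : ∀ {z : 𝒪 d} → z ≢ 0𝒪 → 0ᴿ <ᴿ ∣ z ∣
  ∣∣-pos {z} z≢0 = √-pos (norm z) (ℤ.drop‿+≤+ (subst (1ℤ ℤ.≤_) (N≡norm z) (1≤N z≢0)))

  δ* : ℤ → (z : 𝒪 d) → z ≢ 0𝒪 → ℝ
  δ* m z z≢0 = foldr _+ᴿ_ 0ᴿ (map (λ (x , (x≢0 , _) , _) → zpow ∣ x ∣ (∣∣-pos x≢0) m) (unitaryDivisors z z≢0))

  I* : ℤ → (z : 𝒪 d) → z ≢ 0𝒪 → ℝ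
  I* m z z≢0 = δ* m z z≢0 *ᴿ inv (zpow ∣ z ∣ (∣∣-pos z≢0) m) (zpow-pos ∣ z ∣ (∣∣-pos z≢0) m)

-- Write y = z / x for the cofactor of x ◊ z, so that Iₙ*(z) = ∑ |y|⁻ⁿ. If cofactors
-- of x and x′ differ by a unit, then x and x′ are associates in the sector A(d),
-- hence equal. So the products u y with units u are pairwise distinct nonzero
-- lattice points, and w ∑ |y|⁻ⁿ, where w is the number of units, is bounded by a
-- sum over the whole lattice; prime factorizations play no role.
--
-- For n ≥ 4 every term is at most |y|⁻⁴, and ∑ |v|⁻⁴ over the lattice is less than
-- 2w: this is a finite computation in a box together with an estimate of the tail
-- from 4 |a + bω|² ≥ 3 max(|a|, |b|)².
--
-- If I₃*(z) is rational, then, after scaling, a sum a₁ + … + aₖ of positive square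
-- roots of integers is an integer r. The polynomial p = ∏ (X ± a₂ ± … ± aₖ) has
-- integer coefficients, so p(r ± a₁) = u ± a₁ v with integers u and v. Since
-- p(r − a₁) = 0 < p(r + a₁), the root a₁ = u / v is rational. Hence every |y| is an
-- integer, and ∑ |v|⁻³ over the lattice points with integral |v| is less than 2w.
module Submission where

-- Rationality is needed at exponent 3 because the bound by the whole lattice fails there: for d =
-- -1, ∑ |v|⁻³ is about 9.03, above 2w = 8. Discarding the points of irrational absolute value
-- leaves ample room. At exponent 4 the bound holds with little to spare: for d = -7 the sum is
-- about 3.79 against 2w = 4, so the tail beyond the box, at most 1/`radius` = 0.05, has to fit into
-- the remaining gap. The numerical comparison takes place in ℕ, with every term rounded up to a
-- multiple of 1/`scale`; over the 1680 points of the box this costs less than 0.002.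
--
-- In the irrationality argument, p(r + a₁) > 0 is what excludes u = v = 0: the vanishing of p(r -
-- a₁) alone gives only u = a₁ v. Positivity is available without conjugates, since every factor of
-- p at r + a₁ is a nonempty sum of positive roots.
--
-- Order on Cauchy sequences cannot be decided, so equalities between roots come from identities and
-- from division by quantities known to be positive.

-- Equality, order and square roots of Cauchy reals

module RealArithmetic where

  open import Data.Nat as ℕ using (ℕ; zero; suc)
  import Data.Nat.Properties as ℕ
  open import Data.Integer as ℤ using (ℤ; +_)
  import Data.Integer.Properties as ℤ
  open import Data.List using (List; []; _∷_; map; foldr)
  open import Data.List.Membership.Propositional using (_∈_)
  open import Data.List.Relation.Unary.Any using (here; there)
  open import Data.Product using (∃; _,_; proj₂)
  open import Data.Rational
  open import Data.Rational.Properties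
  import Data.Rational.Unnormalised as ℚᵘ
  import Data.Rational.Unnormalised.Properties as ℚᵘ
  open import Data.Rational.Solver using (module +-*-Solver)
  open +-*-Solver
  open import Level using (0ℓ)
  open import Relation.Binary.Bundles using (Setoid)
  open import Relation.Binary.PropositionalEquality
  open import Relation.Nullary using (¬_; yes; no; contradiction)
  open import Defs using (module Reals)
  open Reals

  -- _≈ᴿ_ unfolds to a Π-type with a hidden argument; the record keeps the two
  -- sides inferable.
  infix 4 _≋_ _≤ᴿ_
  record _≋_ (x y : ℝ) : Set where
    constructor wrap
    field unwrap : x ≈ᴿ y

  record _≤ᴿ_ (x y : ℝ) : Set where
    constructor wrap≤
    field unwrap≤ : ∀ {ε} → 0ℚ < ε → ∃ λ N → ∀ {n} → N ℕ.≤ n → seq x n ≤ seq y n + ε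

  private
    ½-pos : ∀ {ε} → 0ℚ < ε → 0ℚ < ½ * ε
    ½-pos {ε} = *-pos {½} {ε} (positive⁻¹ ½)

    ⊔ˡ : ∀ {M N n} → M ℕ.⊔ N ℕ.≤ n → M ℕ.≤ n
    ⊔ˡ {M} {N} = ℕ.m⊔n≤o⇒m≤o M N

    ⊔ʳ : ∀ {M N n} → M ℕ.⊔ N ℕ.≤ n → N ℕ.≤ n
    ⊔ʳ {M} {N} = ℕ.m⊔n≤o⇒n≤o M N

    ∣-∣-<-sum : ∀ {a b ε} c → c ≡ a + b → ∣ a ∣ < ½ * ε → ∣ b ∣ < ½ * ε → ∣ c ∣ < ε
    ∣-∣-<-sum {a} {b} {ε} c refl p q = ≤-<-trans (∣p+q∣≤∣p∣+∣q∣ a b)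
      (subst (∣ a ∣ + ∣ b ∣ <_) (half-sum ε) (+-mono-< p q))

  pointwise : ∀ {x y} → (∀ n → seq x n ≡ seq y n) → x ≋ y
  pointwise {x} {y} eq = wrap λ {ε} 0<ε → 0 , λ {n} _ →
    subst (λ p → ∣ p ∣ < ε)
      (sym (trans (cong (_- seq y n) (eq n)) (+-inverseʳ (seq y n)))) 0<ε

  ≋-refl : ∀ {x} → x ≋ x
  ≋-refl = pointwise λ _ → refl

  ≋-sym : ∀ {x y} → x ≋ y → y ≋ x
  ≋-sym {x} {y} (wrap p) = wrap λ {ε} 0<ε → let (N , f) = p 0<ε in
    N , λ {n} h → subst (_< ε) (∣-∣-sym (seq x n) (seq y n)) (f h)

  ≋-trans : ∀ {x y z} → x ≋ y → y ≋ z → x ≋ z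
  ≋-trans {x} {y} {z} (wrap p) (wrap q) = wrap λ {ε} 0<ε →
    let (M , f) = p (½-pos 0<ε) ; (N , g) = q (½-pos 0<ε)
    in M ℕ.⊔ N , λ {n} h → ∣-∣-<-sum (seq x n - seq z n)
         (solve 3 (λ a b c → a :- c := (a :- b) :+ (b :- c)) refl (seq x n) (seq y n) (seq z n))
         (f (⊔ˡ h)) (g (⊔ʳ {M} h))

  infixl 6 _⊕_
  infixl 7 _⊗_
  infix 8 ⊖_
  infixr 8 _↑_

  -- _+ᴿ_ and _*ᴿ_ unfold to records containing their Cauchy proofs; the opaque
  -- copies keep unification from comparing those proofs.
  opaque
    _⊕_ _⊗_ : ℝ → ℝ → ℝ
    _⊕_ = _+ᴿ_
    _⊗_ = _*ᴿ_

    ⊖_ : ℝ → ℝ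
    ⊖ x = record
      { seq    = λ n → - seq x n
      ; cauchy = λ {ε} 0<ε → let (N , f) = cauchy x 0<ε in
          N , λ {m} {n} hm hn → subst (λ p → p < ε)
            (trans (sym (∣-p∣≡∣p∣ (seq x m - seq x n)))
              (cong ∣_∣ (solve 2 (λ a b → :- (a :- b) := (:- a) :- (:- b)) refl (seq x m) (seq x n))))
            (f hm hn)
      }

    ⊕-cong : ∀ {x x′ y y′} → x ≋ x′ → y ≋ y′ → x ⊕ y ≋ x′ ⊕ y′
    ⊕-cong {x} {x′} {y} {y′} (wrap p) (wrap q) = wrap λ {ε} 0<ε →
      let (M , f) = p (½-pos 0<ε) ; (N , g) = q (½-pos 0<ε)
      in M ℕ.⊔ N , λ {n} h → ∣-∣-<-sum ((seq x n + seq y n) - (seq x′ n + seq y′ n))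
           (solve 4 (λ a b c d → (a :+ b) :- (c :+ d) := (a :- c) :+ (b :- d)) refl
             (seq x n) (seq y n) (seq x′ n) (seq y′ n))
           (f (⊔ˡ h)) (g (⊔ʳ {M} h))

    ⊗-comm : ∀ x y → x ⊗ y ≋ y ⊗ x
    ⊗-comm x y = pointwise λ n → *-comm (seq x n) (seq y n)

    ⊗-congˡ : ∀ {x y z} → y ≋ z → x ⊗ y ≋ x ⊗ z
    ⊗-congˡ {x} {y} {z} (wrap p) = wrap λ {ε} 0<ε →
      let (B , 0<B , M , b) = bounded x
          (N , f) = p (*-pos {ε} 0<ε (recip-pos B 0<B))
      in M ℕ.⊔ N , λ {n} h → begin-strict
        ∣ seq x n * seq y n - seq x n * seq z n ∣
          ≡⟨ cong ∣_∣ (solve 3 (λ a b c → a :* b :- a :* c := a :* (b :- c)) refl (seq x n) (seq y n) (seq z n)) ⟩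
        ∣ seq x n * (seq y n - seq z n) ∣
          ≡⟨ ∣p*q∣≡∣p∣*∣q∣ (seq x n) (seq y n - seq z n) ⟩
        ∣ seq x n ∣ * ∣ seq y n - seq z n ∣
          <⟨ scale-< (seq x n) ∣ seq y n - seq z n ∣ (b (⊔ˡ h)) 0<B (0≤∣p∣ (seq y n - seq z n)) (f (⊔ʳ {M} h)) ⟩
        B * (ε * recip B 0<B)
          ≡⟨ cancel B ε 0<B ⟩
        ε ∎
      where
      open ≤-Reasoning
      cancel : ∀ B ε 0<B → B * (ε * recip B 0<B) ≡ ε
      cancel B ε 0<B = trans (solve 3 (λ B e r → B :* (e :* r) := e :* (B :* r)) refl B ε (recip B 0<B))
        (trans (cong (ε *_) (recip-inverse B 0<B)) (*-identityʳ ε))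


  ⊗-cong : ∀ {x x′ y y′} → x ≋ x′ → y ≋ y′ → x ⊗ y ≋ x′ ⊗ y′
  ⊗-cong {x} {x′} {y} {y′} p q = ≋-trans (⊗-congˡ q)
    (≋-trans (⊗-comm x y′) (≋-trans (⊗-congˡ p) (⊗-comm y′ x′)))

  ⊗-congʳ : ∀ {x y z} → y ≋ z → y ⊗ x ≋ z ⊗ x
  ⊗-congʳ p = ⊗-cong p ≋-refl

  ≋-setoid : Setoid 0ℓ 0ℓ
  ≋-setoid = record
    { Carrier = ℝ ; _≈_ = _≋_
    ; isEquivalence = record { refl = ≋-refl ; sym = ≋-sym ; trans = ≋-trans }
    }

  fromℤ : ℤ → ℝ
  fromℤ i = fromℚ (i / 1)

  fromℕ : ℕ → ℝ
  fromℕ n = fromℤ (+ n)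

  /1-+ : ∀ i j → (i ℤ.+ j) / 1 ≡ i / 1 + j / 1
  /1-+ i j = sym (/-+ i j 0)

  /1-* : ∀ i j → (i ℤ.* j) / 1 ≡ (i / 1) * (j / 1)
  /1-* i j = toℚᵘ-injective (ℚᵘ.≃-trans (toℚᵘ-fromℚᵘ (ℚᵘ.mkℚᵘ (i ℤ.* j) 0))
    (ℚᵘ.≃-sym (ℚᵘ.≃-trans (toℚᵘ-homo-* (i / 1) (j / 1))
      (ℚᵘ.*-cong (toℚᵘ-fromℚᵘ (ℚᵘ.mkℚᵘ i 0)) (toℚᵘ-fromℚᵘ (ℚᵘ.mkℚᵘ j 0))))))

  opaque
    unfolding _⊕_

    fromℤ-+ : ∀ i j → fromℤ (i ℤ.+ j) ≋ fromℤ i ⊕ fromℤ j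
    fromℤ-+ i j = pointwise λ _ → /1-+ i j

    fromℤ-* : ∀ i j → fromℤ (i ℤ.* j) ≋ fromℤ i ⊗ fromℤ j
    fromℤ-* i j = pointwise λ _ → /1-* i j

    ⊕-identityʳ : ∀ x → x ⊕ 0ᴿ ≋ x
    ⊕-identityʳ x = pointwise λ n → +-identityʳ (seq x n)

    ⊕-assoc : ∀ x y z → (x ⊕ y) ⊕ z ≋ x ⊕ (y ⊕ z)
    ⊕-assoc x y z = pointwise λ n → +-assoc (seq x n) (seq y n) (seq z n)

    ⊕-comm : ∀ x y → x ⊕ y ≋ y ⊕ x
    ⊕-comm x y = pointwise λ n → +-comm (seq x n) (seq y n)

    ⊗-zeroˡ : ∀ x → 0ᴿ ⊗ x ≋ 0ᴿ
    ⊗-zeroˡ x = pointwise λ n → *-zeroˡ (seq x n)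

    ⊗-identityʳ : ∀ x → x ⊗ 1ᴿ ≋ x
    ⊗-identityʳ x = pointwise λ n → *-identityʳ (seq x n)

    ⊗-assoc : ∀ x y z → (x ⊗ y) ⊗ z ≋ x ⊗ (y ⊗ z)
    ⊗-assoc x y z = pointwise λ n → *-assoc (seq x n) (seq y n) (seq z n)

    ⊗-distribʳ-⊕ : ∀ x y z → (y ⊕ z) ⊗ x ≋ y ⊗ x ⊕ z ⊗ x
    ⊗-distribʳ-⊕ x y z = pointwise λ n → *-distribʳ-+ (seq x n) (seq y n) (seq z n)

    ⊗-interchange : ∀ x y z w → (x ⊗ y) ⊗ (z ⊗ w) ≋ (x ⊗ z) ⊗ (y ⊗ w)
    ⊗-interchange x y z w = pointwise λ n → solve 4
      (λ x y z w → (x :* y) :* (z :* w) := (x :* z) :* (y :* w)) refl (seq x n) (seq y n) (seq z n) (seq w n)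

    inv-inverseʳ : ∀ x (0<x : 0ᴿ <ᴿ x) → x ⊗ inv x 0<x ≋ 1ᴿ
    inv-inverseʳ x 0<x = wrap (inv-inverse x 0<x)

    √-squared : ∀ n → √ n ⊗ √ n ≋ fromℕ n
    √-squared n = wrap (√-square n)

  fromℕ-* : ∀ m n → fromℕ (m ℕ.* n) ≋ fromℕ m ⊗ fromℕ n
  fromℕ-* m n = ≋-trans (pointwise λ _ → cong (_/ 1) (ℤ.pos-* m n)) (fromℤ-* (+ m) (+ n))

  /1-injective : ∀ {i j} → i / 1 ≡ j / 1 → i ≡ j
  /1-injective {i} {j} eq with ℚᵘ.≃-trans (ℚᵘ.≃-sym (toℚᵘ-fromℚᵘ (ℚᵘ.mkℚᵘ i 0)))
      (ℚᵘ.≃-trans (toℚᵘ-cong eq) (toℚᵘ-fromℚᵘ (ℚᵘ.mkℚᵘ j 0)))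
  ... | ℚᵘ.*≡* e = trans (sym (ℤ.*-identityʳ i)) (trans e (ℤ.*-identityʳ j))

  fromℚ-injective : ∀ {p q} → fromℚ p ≋ fromℚ q → p ≡ q
  fromℚ-injective {p} {q} (wrap eq) with p ≟ q
  ... | yes e = e
  ... | no ne = contradiction (proj₂ (eq gap) ℕ.≤-refl) (<-irrefl refl)
    where
    gap : 0ℚ < ∣ p - q ∣
    gap = ≤∧≢⇒< (0≤∣p∣ (p - q)) λ e → ne (trans (solve 2 (λ p q → p := (p :- q) :+ q) refl p q)
      (trans (cong (_+ q) (∣p∣≡0⇒p≡0 (p - q) (sym e))) (+-identityˡ q)))
      where
      ≤∧≢⇒< : ∀ {a b} → a ≤ b → a ≢ b → a < b
      ≤∧≢⇒< a≤b a≢b = ≰⇒> λ b≤a → a≢b (≤-antisym a≤b b≤a)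

  fromℤ-injective : ∀ {i j} → fromℤ i ≋ fromℤ j → i ≡ j
  fromℤ-injective eq = /1-injective (fromℚ-injective eq)

  infix 4 _isPos
  _isPos : ℝ → Set
  x isPos = 0ᴿ <ᴿ x

  isPos-resp : ∀ {x y} → x ≋ y → x isPos → y isPos
  isPos-resp {x} {y} (wrap p) (δ , 0<δ , M , f) =
    let (N , g) = p (½-pos 0<δ) in
    ½ * δ , ½-pos 0<δ , M ℕ.⊔ N , λ {n} h → begin
      0ℚ + ½ * δ                      ≡⟨ solve 1 (λ d → con 0ℚ :+ con ½ :* d := (con 0ℚ :+ d) :- con ½ :* d) refl δ ⟩
      (0ℚ + δ) - ½ * δ                ≤⟨ +-mono-≤ (f (⊔ˡ h)) (<⇒≤ (neg-antimono-< (≤-<-trans (p≤∣p∣ (seq x n - seq y n)) (g (⊔ʳ {M} h))))) ⟩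
      seq x n - (seq x n - seq y n)   ≡⟨ solve 2 (λ a b → a :- (a :- b) := b) refl (seq x n) (seq y n) ⟩
      seq y n                         ∎
    where open ≤-Reasoning

  opaque
    unfolding _⊕_

    isPos-+ : ∀ {x y} → x isPos → y isPos → x ⊕ y isPos
    isPos-+ {x} {y} (δ , 0<δ , M , f) (ε , 0<ε , N , g) =
      δ + ε , +-mono-< 0<δ 0<ε , M ℕ.⊔ N , λ {n} h →
        subst (_≤ seq x n + seq y n) (solve 2 (λ d e → (con 0ℚ :+ d) :+ (con 0ℚ :+ e) := con 0ℚ :+ (d :+ e)) refl δ ε)
          (+-mono-≤ (f (⊔ˡ h)) (g (⊔ʳ {M} h)))

  opaque
    unfolding _⊕_

    isPos-⊗ : ∀ {x y} → x isPos → y isPos → x ⊗ y isPos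
    isPos-⊗ {x} {y} = *ᴿ-pos x y

  0-notPos : ¬ (0ᴿ isPos)
  0-notPos (δ , 0<δ , N , f) = <-irrefl refl (<-≤-trans 0<δ (subst (_≤ 0ℚ) (+-identityˡ δ) (f (ℕ.≤-refl {N}))))

  fromℚ-pos : ∀ {q} → 0ℚ < q → fromℚ q isPos
  fromℚ-pos {q} 0<q = q , 0<q , 0 , λ _ → ≤-reflexive (+-identityˡ q)

  0</1 : ∀ {n} → 0 ℕ.< n → 0ℚ < + n / 1
  0</1 {n} 0<n = /-mono-< (+ 0) (+ n) 0 0 (subst (+ 0 ℤ.<_) (sym (ℤ.*-identityʳ (+ n))) (ℤ.+<+ 0<n))

  fromℕ-pos : ∀ {n} → 0 ℕ.< n → fromℕ n isPos
  fromℕ-pos 0<n = fromℚ-pos (0</1 0<n)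

  private
    ≤+⇐∣-∣< : ∀ {a b ε} → ∣ a - b ∣ < ε → a ≤ b + ε
    ≤+⇐∣-∣< {a} {b} {ε} lt = subst (_≤ b + ε) (solve 2 (λ a b → b :+ (a :- b) := a) refl a b)
      (+-monoʳ-≤ b (<⇒≤ (≤-<-trans (p≤∣p∣ (a - b)) lt)))

  ≋⇒≤ᴿ : ∀ {x y} → x ≋ y → x ≤ᴿ y
  ≋⇒≤ᴿ {x} {y} (wrap p) = wrap≤ λ 0<ε → let (N , f) = p 0<ε in N , λ h → ≤+⇐∣-∣< (f h)

  pointwise-≤ᴿ : ∀ {x y} → (∀ n → seq x n ≤ seq y n) → x ≤ᴿ y
  pointwise-≤ᴿ {x} {y} le = wrap≤ λ {ε} 0<ε → 0 , λ {n} _ →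
    ≤-trans (le n) (subst (_≤ seq y n + ε) (+-identityʳ (seq y n)) (+-monoʳ-≤ (seq y n) (<⇒≤ 0<ε)))

  private
    half-sum′ : ∀ a b ε → (a + ½ * ε) + (b + ½ * ε) ≡ (a + b) + ε
    half-sum′ a b ε = trans
      (solve 3 (λ a b e → (a :+ e) :+ (b :+ e) := (a :+ b) :+ (e :+ e)) refl a b (½ * ε))
      (cong (_+_ (a + b)) (half-sum ε))

  ≤ᴿ-trans : ∀ {x y z} → x ≤ᴿ y → y ≤ᴿ z → x ≤ᴿ z
  ≤ᴿ-trans {x} {y} {z} (wrap≤ p) (wrap≤ q) = wrap≤ λ {ε} 0<ε →
    let (M , f) = p (½-pos 0<ε) ; (N , g) = q (½-pos 0<ε)
    in M ℕ.⊔ N , λ {n} h → ≤-trans (f (⊔ˡ h))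
         (subst (seq y n + ½ * ε ≤_)
           (trans (+-assoc (seq z n) (½ * ε) (½ * ε)) (cong (_+_ (seq z n)) (half-sum ε)))
           (+-monoˡ-≤ (½ * ε) (g (⊔ʳ {M} h))))

  opaque
    unfolding _⊕_

    ⊕-mono-≤ᴿ : ∀ {x x′ y y′} → x ≤ᴿ x′ → y ≤ᴿ y′ → x ⊕ y ≤ᴿ x′ ⊕ y′
    ⊕-mono-≤ᴿ {x} {x′} {y} {y′} (wrap≤ p) (wrap≤ q) = wrap≤ λ {ε} 0<ε →
      let (M , f) = p (½-pos 0<ε) ; (N , g) = q (½-pos 0<ε)
      in M ℕ.⊔ N , λ {n} h → subst (seq x n + seq y n ≤_)
           (half-sum′ (seq x′ n) (seq y′ n) ε)
           (+-mono-≤ (f (⊔ˡ h)) (g (⊔ʳ {M} h)))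

  opaque
    unfolding _⊕_

    ⊗-monoˡ-≤ᴿ : ∀ {x y} z → z isPos → x ≤ᴿ y → x ⊗ z ≤ᴿ y ⊗ z
    ⊗-monoˡ-≤ᴿ {x} {y} z (δ , 0<δ , K , k) (wrap≤ p) = wrap≤ λ {ε} 0<ε →
      let (B , 0<B , M , b) = bounded z
          r = recip B 0<B
          0<εr = *-pos {ε} 0<ε (recip-pos B 0<B)
          (N , f) = p 0<εr
      in (K ℕ.⊔ M) ℕ.⊔ N , λ {n} h →
        let 0≤z = ≤-trans (<⇒≤ 0<δ) (subst (_≤ seq z n) (+-identityˡ δ) (k (⊔ˡ (⊔ˡ h))))
            z≤B = ≤-trans (p≤∣p∣ (seq z n)) (b (⊔ʳ {K} (⊔ˡ h)))
        in begin
        seq x n * seq z n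
          ≤⟨ *-monoʳ-≤-nonNeg (seq z n) ⦃ nonNegative 0≤z ⦄ (f (⊔ʳ {K ℕ.⊔ M} h)) ⟩
        (seq y n + ε * r) * seq z n
          ≡⟨ solve 3 (λ y e z → (y :+ e) :* z := y :* z :+ e :* z) refl (seq y n) (ε * r) (seq z n) ⟩
        seq y n * seq z n + ε * r * seq z n
          ≤⟨ +-monoʳ-≤ (seq y n * seq z n) (*-monoˡ-≤-nonNeg (ε * r) ⦃ nonNegative (<⇒≤ 0<εr) ⦄ z≤B) ⟩
        seq y n * seq z n + ε * r * B
          ≡⟨ cong (_+_ (seq y n * seq z n)) (trans (solve 3 (λ e r B → e :* r :* B := e :* (B :* r)) refl ε r B)
               (trans (cong (ε *_) (recip-inverse B 0<B)) (*-identityʳ ε))) ⟩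
        seq y n * seq z n + ε ∎
      where open ≤-Reasoning

  ⊗-monoʳ-≤ᴿ : ∀ {x y} z → z isPos → x ≤ᴿ y → z ⊗ x ≤ᴿ z ⊗ y
  ⊗-monoʳ-≤ᴿ {x} {y} z 0<z le = ≤ᴿ-trans (≋⇒≤ᴿ (⊗-comm z x))
    (≤ᴿ-trans (⊗-monoˡ-≤ᴿ z 0<z le) (≋⇒≤ᴿ (⊗-comm y z)))

  -- Half of the gap q - p absorbs the tolerance in `_≤ᴿ_`, and the other half is the witness for
  -- `_<ᴿ_`. All earlier estimates can therefore be non-strict; strictness is decided between two
  -- rationals.
  ≤ᴿ-<-fromℚ : ∀ {x p q} → x ≤ᴿ fromℚ p → p < q → x <ᴿ fromℚ q
  ≤ᴿ-<-fromℚ {x} {p} {q} (wrap≤ le) p<q = let (N , f) = le 0<δ in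
    δ , 0<δ , N , λ {n} h → subst (seq x n + δ ≤_)
      (trans (+-assoc p δ δ) (trans (cong (_+_ p) (half-sum (q - p)))
        (solve 2 (λ p q → p :+ (q :- p) := q) refl p q)))
      (+-monoˡ-≤ δ (f h))
    where
    δ = ½ * (q - p)
    0<δ : 0ℚ < δ
    0<δ = ½-pos (subst (_< q - p) (+-inverseʳ p) (+-monoˡ-< (- p) p<q))

  opaque
    unfolding _⊕_

    *ᴿ≋⊗ : ∀ x y → x *ᴿ y ≋ x ⊗ y
    *ᴿ≋⊗ x y = pointwise λ _ → refl

  _↑_ : ℝ → ℕ → ℝ
  x ↑ zero  = 1ᴿ
  x ↑ suc n = x ⊗ x ↑ n

  ^ᴿ≋↑ : ∀ x n → x ^ᴿ n ≋ x ↑ n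
  ^ᴿ≋↑ x zero    = ≋-refl
  ^ᴿ≋↑ x (suc n) = ≋-trans (*ᴿ≋⊗ x (x ^ᴿ n)) (⊗-congˡ (^ᴿ≋↑ x n))

  ↑-pos : ∀ {x} → x isPos → ∀ n → x ↑ n isPos
  ↑-pos {x} 0<x zero    = fromℚ-pos (positive⁻¹ 1ℚ)
  ↑-pos {x} 0<x (suc n) = isPos-⊗ {x} {x ↑ n} 0<x (↑-pos {x} 0<x n)

  ↑-mono-≤ᴿ : ∀ {x y} → x isPos → y isPos → x ≤ᴿ y → ∀ n → x ↑ n ≤ᴿ y ↑ n
  ↑-mono-≤ᴿ 0<x 0<y le zero = ≋⇒≤ᴿ ≋-refl
  ↑-mono-≤ᴿ {x} {y} 0<x 0<y le (suc n) = ≤ᴿ-trans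
    (⊗-monoˡ-≤ᴿ (x ↑ n) (↑-pos {x} 0<x n) le) (⊗-monoʳ-≤ᴿ y 0<y (↑-mono-≤ᴿ 0<x 0<y le n))

  opaque
    unfolding _⊕_

    private
      expand-square-difference : ∀ x y t → y ⊕ (x ⊕ ⊖ y) ⊗ ((x ⊕ y) ⊗ t) ≋ y ⊕ (x ⊗ x ⊕ ⊖ (y ⊗ y)) ⊗ t
      expand-square-difference x y t = pointwise λ n → solve 3
        (λ x y t → y :+ (x :- y) :* ((x :+ y) :* t) := y :+ (x :* x :- y :* y) :* t) refl (seq x n) (seq y n) (seq t n)

      add-difference : ∀ x y → x ≋ y ⊕ (x ⊕ ⊖ y) ⊗ 1ᴿ
      add-difference x y = pointwise λ n → solve 2 (λ x y → x := y :+ (x :- y) :* con 1ℚ) refl (seq x n) (seq y n)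

      vanishing-difference : ∀ y z t → y ⊕ (z ⊕ ⊖ z) ⊗ t ≋ y
      vanishing-difference y z t = pointwise λ n → solve 3 (λ y z t → y :+ (z :- z) :* t := y) refl (seq y n) (seq z n) (seq t n)

  -- x = y + (x² - y²) / (x + y), and x + y is invertible because it is positive. This avoids a case
  -- distinction on the order of x and y.
  pos-square-injective : ∀ {x y} → x isPos → y isPos → x ⊗ x ≋ y ⊗ y → x ≋ y
  pos-square-injective {x} {y} 0<x 0<y eq = begin
    x                                ≈⟨ add-difference x y ⟩
    y ⊕ (x ⊕ ⊖ y) ⊗ 1ᴿ               ≈⟨ ⊕-cong ≋-refl (⊗-congˡ (≋-sym (inv-inverseʳ s 0<s))) ⟩
    y ⊕ (x ⊕ ⊖ y) ⊗ (s ⊗ t)          ≈⟨ expand-square-difference x y t ⟩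
    y ⊕ (x ⊗ x ⊕ ⊖ (y ⊗ y)) ⊗ t      ≈⟨ ⊕-cong ≋-refl (⊗-congʳ (⊕-cong eq ≋-refl)) ⟩
    y ⊕ (y ⊗ y ⊕ ⊖ (y ⊗ y)) ⊗ t      ≈⟨ vanishing-difference y (y ⊗ y) t ⟩
    y                                ∎
    where
    open import Relation.Binary.Reasoning.Setoid ≋-setoid
    s = x ⊕ y
    0<s : s isPos
    0<s = isPos-+ {x} {y} 0<x 0<y
    t = inv s 0<s

  -- The approximants at the same index share the denominator K, so the inequality holds term by
  -- term: with a = ⌊K√m⌋ and b = ⌊K√n⌋, a² ≤ mK² ≤ nK² < (b + 1)².
  √-mono : ∀ {m n} → m ℕ.≤ n → √ m ≤ᴿ √ n
  √-mono {m} {n} m≤n = pointwise-≤ᴿ λ k → /-mono-≤ (+ a k) (+ b k) k k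
    (ℤ.*-monoʳ-≤-nonNeg (+ suc k) (ℤ.+≤+ (ℕ.s≤s⁻¹ (sq-cancel {a k} {suc (b k)} (ℕ.≤-<-trans (⌊√⌋-lower (m ℕ.* (suc k ℕ.* suc k)))
      (ℕ.≤-<-trans (ℕ.*-monoˡ-≤ (suc k ℕ.* suc k) m≤n) (⌊√⌋-upper (n ℕ.* (suc k ℕ.* suc k)))))))))
    where
    a b : ℕ → ℕ
    a k = ⌊√ m ℕ.* (suc k ℕ.* suc k) ⌋
    b k = ⌊√ n ℕ.* (suc k ℕ.* suc k) ⌋

  opaque
    unfolding _⊕_

    fromℚ-* : ∀ p q → fromℚ (p * q) ≋ fromℚ p ⊗ fromℚ q
    fromℚ-* p q = pointwise λ _ → refl

    ↑-3 : ∀ x → x ↑ 3 ≋ (x ⊗ x) ⊗ x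
    ↑-3 x = pointwise λ n → solve 1 (λ x → x :* (x :* (x :* con 1ℚ)) := (x :* x) :* x) refl (seq x n)

    ↑-4+ : ∀ x k → x ↑ suc (suc (suc (suc k))) ≋ ((x ⊗ x) ⊗ (x ⊗ x)) ⊗ x ↑ k
    ↑-4+ x k = pointwise λ n → solve 2
      (λ x p → x :* (x :* (x :* (x :* p))) := ((x :* x) :* (x :* x)) :* p) refl (seq x n) (seq (x ↑ k) n)

  √-↑-3 : ∀ m → (√ m) ↑ 3 ≋ fromℕ m ⊗ √ m
  √-↑-3 m = ≋-trans (↑-3 (√ m)) (⊗-congʳ (√-squared m))

  √-↑-4+ : ∀ m k → (√ m) ↑ suc (suc (suc (suc k))) ≋ fromℕ (m ℕ.* m) ⊗ (√ m) ↑ k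
  √-↑-4+ m k = ≋-trans (↑-4+ (√ m) k)
    (⊗-congʳ (≋-trans (⊗-cong (√-squared m) (√-squared m)) (≋-sym (fromℕ-* m m))))

  -- Because of the floors, the approximants of the two sides need not agree, so the squares are
  -- compared instead.
  √-square-* : ∀ s m → 0 ℕ.< s → 0 ℕ.< m → ∀ {n} → n ≡ s ℕ.* s ℕ.* m → √ n ≋ fromℕ s ⊗ √ m
  √-square-* s m 0<s 0<m {n} n≡ = pos-square-injective
    (√-pos n (subst (0 ℕ.<_) (sym n≡) (ℕ.*-mono-< (ℕ.*-mono-< 0<s 0<s) 0<m)))
    (isPos-⊗ {fromℕ s} {√ m} (fromℕ-pos 0<s) (√-pos m 0<m))
    (begin
      √ n ⊗ √ n                              ≈⟨ √-squared n ⟩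
      fromℕ n                                ≡⟨ cong fromℕ n≡ ⟩
      fromℕ (s ℕ.* s ℕ.* m)                  ≈⟨ fromℕ-* (s ℕ.* s) m ⟩
      fromℕ (s ℕ.* s) ⊗ fromℕ m              ≈⟨ ⊗-cong (fromℕ-* s s) (≋-sym (√-squared m)) ⟩
      (fromℕ s ⊗ fromℕ s) ⊗ (√ m ⊗ √ m)      ≈⟨ ⊗-interchange (fromℕ s) (fromℕ s) (√ m) (√ m) ⟩
      (fromℕ s ⊗ √ m) ⊗ (fromℕ s ⊗ √ m)      ∎)
    where open import Relation.Binary.Reasoning.Setoid ≋-setoid

  -- Separates a power of a root into a rational part and a radical part: the rational parts are
  -- compared exactly through c, and only the radicals A and B are estimated.
  scaled-≤ᴿ : ∀ {P Q A B p q} c → P ≋ fromℚ p ⊗ A → Q ≋ fromℚ q ⊗ B → 0ℚ < p → p ≡ c * q →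
    A ≤ᴿ B → P ≤ᴿ fromℚ c ⊗ Q
  scaled-≤ᴿ {P} {Q} {A} {B} {p} {q} c P≋ Q≋ 0<p refl A≤B = ≤ᴿ-trans (≋⇒≤ᴿ P≋)
    (≤ᴿ-trans (⊗-monoʳ-≤ᴿ (fromℚ p) (fromℚ-pos 0<p) A≤B) (≋⇒≤ᴿ (begin
      fromℚ (c * q) ⊗ B         ≈⟨ ⊗-congʳ (fromℚ-* c q) ⟩
      (fromℚ c ⊗ fromℚ q) ⊗ B   ≈⟨ ⊗-assoc (fromℚ c) (fromℚ q) B ⟩
      fromℚ c ⊗ (fromℚ q ⊗ B)   ≈⟨ ⊗-congˡ Q≋ ⟨
      fromℚ c ⊗ Q               ∎)))
    where open import Relation.Binary.Reasoning.Setoid ≋-setoid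

  sumᴿ : {T : Set} → (T → ℝ) → List T → ℝ
  sumᴿ f ts = foldr _⊕_ 0ᴿ (map f ts)

  sumℚ : {T : Set} → (T → ℚ) → List T → ℚ
  sumℚ f ts = foldr _+_ 0ℚ (map f ts)

  opaque
    unfolding _⊕_

    +ᴿ≡⊕ : ∀ x y → x +ᴿ y ≡ x ⊕ y
    +ᴿ≡⊕ x y = refl

  foldr≡sumᴿ : {T : Set} (f : T → ℝ) (ts : List T) → foldr _+ᴿ_ 0ᴿ (map f ts) ≡ sumᴿ f ts
  foldr≡sumᴿ f []       = refl
  foldr≡sumᴿ f (t ∷ ts) = trans (+ᴿ≡⊕ (f t) (foldr _+ᴿ_ 0ᴿ (map f ts))) (cong (f t ⊕_) (foldr≡sumᴿ f ts))

  private
    opaque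
      unfolding _⊕_

      fromℚ-+-⊗ : ∀ p q z → fromℚ p ⊗ z ⊕ fromℚ q ⊗ z ≋ fromℚ (p + q) ⊗ z
      fromℚ-+-⊗ p q z = pointwise λ n → sym (*-distribʳ-+ (seq z n) p q)

  sumᴿ-≤ᴿ : {T : Set} (f : T → ℝ) (g : T → ℚ) (Z : ℝ) (ts : List T) →
    (∀ {t} → t ∈ ts → f t ≤ᴿ fromℚ (g t) ⊗ Z) → sumᴿ f ts ≤ᴿ fromℚ (sumℚ g ts) ⊗ Z
  sumᴿ-≤ᴿ f g Z [] le = ≋⇒≤ᴿ (≋-sym (⊗-zeroˡ Z))
  sumᴿ-≤ᴿ f g Z (t ∷ ts) le = ≤ᴿ-trans (⊕-mono-≤ᴿ (le (here refl)) (sumᴿ-≤ᴿ f g Z ts λ t∈ → le (there t∈)))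
    (≋⇒≤ᴿ (fromℚ-+-⊗ (g t) (sumℚ g ts) Z))

  sumᴿ-cong : {T : Set} {f g : T → ℝ} (ts : List T) → (∀ t → f t ≋ g t) → sumᴿ f ts ≋ sumᴿ g ts
  sumᴿ-cong []       eq = ≋-refl
  sumᴿ-cong (t ∷ ts) eq = ⊕-cong (eq t) (sumᴿ-cong ts eq)

  quotient-≤ : ∀ {S Z p} (0<Z : Z isPos) → S ≤ᴿ fromℚ p ⊗ Z → S ⊗ inv Z 0<Z ≤ᴿ fromℚ p
  quotient-≤ {S} {Z} {p} 0<Z le = ≤ᴿ-trans (⊗-monoˡ-≤ᴿ Z⁻¹ (inv-pos Z 0<Z) le)
    (≋⇒≤ᴿ (≋-trans (⊗-assoc (fromℚ p) Z Z⁻¹)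
      (≋-trans (⊗-congˡ (inv-inverseʳ Z 0<Z)) (⊗-identityʳ (fromℚ p)))))
    where
    Z⁻¹ = inv Z 0<Z

  quotient⇒product : ∀ {S Z q} (0<Z : Z isPos) → S ⊗ inv Z 0<Z ≋ fromℚ q → S ≋ fromℚ q ⊗ Z
  quotient⇒product {S} {Z} {q} 0<Z eq = begin
    S                ≈⟨ ⊗-identityʳ S ⟨
    S ⊗ 1ᴿ           ≈⟨ ⊗-congˡ (inv-inverseʳ Z 0<Z) ⟨
    S ⊗ (Z ⊗ Z⁻¹)    ≈⟨ ⊗-congˡ (⊗-comm Z Z⁻¹) ⟩
    S ⊗ (Z⁻¹ ⊗ Z)    ≈⟨ ⊗-assoc S Z⁻¹ Z ⟨
    (S ⊗ Z⁻¹) ⊗ Z    ≈⟨ ⊗-congʳ eq ⟩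
    fromℚ q ⊗ Z      ∎
    where
    open import Relation.Binary.Reasoning.Setoid ≋-setoid
    Z⁻¹ = inv Z 0<Z

  fromℚ-numerator : ∀ q → fromℚ q ⊗ fromℕ (↧ₙ q) ≋ fromℤ (↥ q)
  fromℚ-numerator q = ≋-trans (≋-sym (fromℚ-* q (+ ↧ₙ q / 1))) (pointwise λ _ → numerator q)
    where
    numerator : ∀ q → q * (+ ↧ₙ q / 1) ≡ ↥ q / 1
    numerator q@(mkℚ n d _) = toℚᵘ-injective (ℚᵘ.≃-trans (toℚᵘ-homo-* q (+ suc d / 1))
      (ℚᵘ.≃-trans (ℚᵘ.*-cong {ℚᵘ.mkℚᵘ n d} ℚᵘ.≃-refl (toℚᵘ-fromℚᵘ (ℚᵘ.mkℚᵘ (+ suc d) 0)))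
        (ℚᵘ.≃-trans (ℚᵘ.*≡* (ℤ.*-assoc n (+ suc d) (+ 1))) (ℚᵘ.≃-sym (toℚᵘ-fromℚᵘ (ℚᵘ.mkℚᵘ n 0))))))

-- Sums of square roots with an integral value

module RadicalSums where

  open import Data.Integer as ℤ using (ℤ; +_; -[1+_]; 0ℤ; 1ℤ)
  import Data.Integer.Properties as ℤ
  open import Data.List using (List; []; _∷_; _++_)
  open import Data.List.Relation.Unary.All using (All; []; _∷_)
  open import Data.Nat as ℕ using (ℕ; zero)
  import Data.Nat.Properties as ℕ
  open import Data.Nat.Coprimality using (Coprime; coprime-divisor; coprime-/gcd)
  open import Data.Nat.Divisibility using (divides; ∣-refl)
  open import Data.Nat.DivMod using (_/_; m/n*n≡m)
  open import Data.Nat.GCD using (gcd; gcd[m,n]≢0; gcd[m,n]∣m; gcd[m,n]∣n)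
  import Data.Nat.Tactic.RingSolver as ℕR
  open import Data.Product using (∃; _×_; _,_; proj₁; proj₂)
  open import Data.Sum using (inj₁)
  open import Data.Rational.Solver using (module +-*-Solver)
  open +-*-Solver using (solve; _:+_; _:*_; :-_; _:-_; _:=_; con)
  import Data.Rational as ℚ
  open import Relation.Binary.PropositionalEquality using (_≡_; _≢_; refl; sym; trans; cong; subst)
  open import Defs using (module Reals)
  open Reals using (ℝ; seq; 0ᴿ)
  open RealArithmetic
  open import Relation.Binary.Reasoning.Setoid ≋-setoid

  -- Polynomials are kept as expressions: evaluation in ℝ and in ℤ and the substitution of x + a all
  -- go by structural recursion, with no coefficients to normalise.
  data Poly : Set where
    X       : Poly
    const   : ℤ → Poly
    _⊞_ _⊠_ : Poly → Poly → Poly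

  infixl 6 _⊞_
  infixl 7 _⊠_

  evalᴿ : Poly → ℝ → ℝ
  evalᴿ X         x = x
  evalᴿ (const c) x = fromℤ c
  evalᴿ (p ⊞ q)   x = evalᴿ p x ⊕ evalᴿ q x
  evalᴿ (p ⊠ q)   x = evalᴿ p x ⊗ evalᴿ q x

  evalℤ : Poly → ℤ → ℤ
  evalℤ X         x = x
  evalℤ (const c) x = c
  evalℤ (p ⊞ q)   x = evalℤ p x ℤ.+ evalℤ q x
  evalℤ (p ⊠ q)   x = evalℤ p x ℤ.* evalℤ q x

  evalᴿ-cong : ∀ p {x y} → x ≋ y → evalᴿ p x ≋ evalᴿ p y
  evalᴿ-cong X         eq = eq
  evalᴿ-cong (const c) eq = ≋-refl
  evalᴿ-cong (p ⊞ q)   eq = ⊕-cong (evalᴿ-cong p eq) (evalᴿ-cong q eq)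
  evalᴿ-cong (p ⊠ q)   eq = ⊗-cong (evalᴿ-cong p eq) (evalᴿ-cong q eq)

  evalᴿ-fromℤ : ∀ p i → evalᴿ p (fromℤ i) ≋ fromℤ (evalℤ p i)
  evalᴿ-fromℤ X         i = ≋-refl
  evalᴿ-fromℤ (const c) i = ≋-refl
  evalᴿ-fromℤ (p ⊞ q)   i = ≋-trans (⊕-cong (evalᴿ-fromℤ p i) (evalᴿ-fromℤ q i))
    (≋-sym (fromℤ-+ (evalℤ p i) (evalℤ q i)))
  evalᴿ-fromℤ (p ⊠ q)   i = ≋-trans (⊗-cong (evalᴿ-fromℤ p i) (evalᴿ-fromℤ q i))
    (≋-sym (fromℤ-* (evalℤ p i) (evalℤ q i)))

  -- p (x + a) = u x + a · v x whenever a² = A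
  split : ℤ → Poly → Poly × Poly
  split A X         = X , const 1ℤ
  split A (const c) = const c , const 0ℤ
  split A (p ⊞ q)   = let (u , v) = split A p ; (u′ , v′) = split A q in u ⊞ u′ , v ⊞ v′
  split A (p ⊠ q)   = let (u , v) = split A p ; (u′ , v′) = split A q in
    u ⊠ u′ ⊞ const A ⊠ (v ⊠ v′) , u ⊠ v′ ⊞ v ⊠ u′

  private
    opaque
      unfolding _⊕_

      split-X : ∀ x a → x ⊕ a ≋ x ⊕ a ⊗ fromℤ 1ℤ
      split-X x a = pointwise λ n → solve 2 (λ x a → x :+ a := x :+ a :* con ℚ.1ℚ) refl (seq x n) (seq a n)

      split-const : ∀ c a → c ≋ c ⊕ a ⊗ fromℤ 0ℤ
      split-const c a = pointwise λ n → solve 2 (λ c a → c := c :+ a :* con ℚ.0ℚ) refl (seq c n) (seq a n)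

      split-⊞ : ∀ a u v u′ v′ → (u ⊕ a ⊗ v) ⊕ (u′ ⊕ a ⊗ v′) ≋ (u ⊕ u′) ⊕ a ⊗ (v ⊕ v′)
      split-⊞ a u v u′ v′ = pointwise λ n → solve 5
        (λ a u v u′ v′ → (u :+ a :* v) :+ (u′ :+ a :* v′) := (u :+ u′) :+ a :* (v :+ v′))
        refl (seq a n) (seq u n) (seq v n) (seq u′ n) (seq v′ n)

      split-⊠ : ∀ a u v u′ v′ → (u ⊕ a ⊗ v) ⊗ (u′ ⊕ a ⊗ v′) ≋ (u ⊗ u′ ⊕ (a ⊗ a) ⊗ (v ⊗ v′)) ⊕ a ⊗ (u ⊗ v′ ⊕ v ⊗ u′)
      split-⊠ a u v u′ v′ = pointwise λ n → solve 5
        (λ a u v u′ v′ → (u :+ a :* v) :* (u′ :+ a :* v′)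
                       := (u :* u′ :+ (a :* a) :* (v :* v′)) :+ a :* (u :* v′ :+ v :* u′))
        refl (seq a n) (seq u n) (seq v n) (seq u′ n) (seq v′ n)

      ⊖-square : ∀ a → ⊖ a ⊗ ⊖ a ≋ a ⊗ a
      ⊖-square a = pointwise λ n → solve 1 (λ a → (:- a) :* (:- a) := a :* a) refl (seq a n)

      difference-of-squares : ∀ a u v →
        (u ⊕ a ⊗ v) ⊗ (u ⊕ ⊖ a ⊗ v) ≋ u ⊗ u ⊕ fromℤ -[1+ 0 ] ⊗ ((a ⊗ a) ⊗ (v ⊗ v))
      difference-of-squares a u v = pointwise λ n → solve 3
        (λ a u v → (u :+ a :* v) :* (u :+ (:- a) :* v) := u :* u :+ con (ℚ.- ℚ.1ℚ) :* ((a :* a) :* (v :* v)))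
        refl (seq a n) (seq u n) (seq v n)

      cancel-first : ∀ a s → (a ⊕ s) ⊕ ⊖ a ≋ s
      cancel-first a s = pointwise λ n → solve 2 (λ a s → (a :+ s) :- a := s) refl (seq a n) (seq s n)

      cancel-first-excess : ∀ a s d → ((a ⊕ s) ⊕ d) ⊕ ⊖ a ≋ s ⊕ d
      cancel-first-excess a s d = pointwise λ n →
        solve 3 (λ a s d → ((a :+ s) :+ d) :- a := s :+ d) refl (seq a n) (seq s n) (seq d n)

      double-first-excess : ∀ a s d → ((a ⊕ s) ⊕ d) ⊕ a ≋ s ⊕ ((a ⊕ a) ⊕ d)
      double-first-excess a s d = pointwise λ n →
        solve 3 (λ a s d → ((a :+ s) :+ d) :+ a := s :+ ((a :+ a) :+ d)) refl (seq a n) (seq s n) (seq d n)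

      double-first : ∀ a s → (a ⊕ s) ⊕ a ≋ s ⊕ (a ⊕ a)
      double-first a s = pointwise λ n → solve 2 (λ a s → (a :+ s) :+ a := s :+ (a :+ a)) refl (seq a n) (seq s n)

      move-product : ∀ u a v → u ≋ (u ⊕ ⊖ a ⊗ v) ⊕ a ⊗ v
      move-product u a v = pointwise λ n →
        solve 3 (λ u a v → u := (u :+ (:- a) :* v) :+ a :* v) refl (seq u n) (seq a n) (seq v n)

      insert : ∀ p a s → p ⊕ (a ⊕ s) ≋ a ⊕ (p ⊕ s)
      insert p a s = pointwise λ n → solve 3 (λ p a s → p :+ (a :+ s) := a :+ (p :+ s)) refl (seq p n) (seq a n) (seq s n)

  evalᴿ-split : ∀ p {A a} x → a ⊗ a ≋ fromℤ A →
    let (u , v) = split A p in evalᴿ p (x ⊕ a) ≋ evalᴿ u x ⊕ a ⊗ evalᴿ v x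
  evalᴿ-split X {a = a} x eq = split-X x a
  evalᴿ-split (const c) {a = a} x eq = split-const (fromℤ c) a
  evalᴿ-split (p ⊞ q) {A} {a} x eq = ≋-trans (⊕-cong (evalᴿ-split p x eq) (evalᴿ-split q x eq))
    (split-⊞ a (evalᴿ (proj₁ (split A p)) x) (evalᴿ (proj₂ (split A p)) x)
               (evalᴿ (proj₁ (split A q)) x) (evalᴿ (proj₂ (split A q)) x))
  evalᴿ-split (p ⊠ q) {A} {a} x eq = ≋-trans (⊗-cong (evalᴿ-split p x eq) (evalᴿ-split q x eq))
    (≋-trans
      (split-⊠ a (evalᴿ (proj₁ (split A p)) x) (evalᴿ (proj₂ (split A p)) x)
                 (evalᴿ (proj₁ (split A q)) x) (evalᴿ (proj₂ (split A q)) x))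
      (⊕-cong (⊕-cong ≋-refl (⊗-congʳ eq)) ≋-refl))

  -- p (X + a) · p (X − a) whenever a² = A
  norm : ℤ → Poly → Poly
  norm A p = let (u , v) = split A p in u ⊠ u ⊞ const -[1+ 0 ] ⊠ (const A ⊠ (v ⊠ v))

  evalᴿ-norm : ∀ p {A a} x → a ⊗ a ≋ fromℤ A →
    evalᴿ (norm A p) x ≋ evalᴿ p (x ⊕ a) ⊗ evalᴿ p (x ⊕ ⊖ a)
  evalᴿ-norm p {A} {a} x eq = begin
    u ⊗ u ⊕ fromℤ -[1+ 0 ] ⊗ (fromℤ A ⊗ (v ⊗ v))  ≈⟨ ⊕-cong ≋-refl (⊗-congˡ (⊗-congʳ (≋-sym eq))) ⟩
    u ⊗ u ⊕ fromℤ -[1+ 0 ] ⊗ ((a ⊗ a) ⊗ (v ⊗ v))  ≈⟨ difference-of-squares a u v ⟨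
    (u ⊕ a ⊗ v) ⊗ (u ⊕ ⊖ a ⊗ v)
      ≈⟨ ⊗-cong (evalᴿ-split p x eq) (evalᴿ-split p x (≋-trans (⊖-square a) eq)) ⟨
    evalᴿ p (x ⊕ a) ⊗ evalᴿ p (x ⊕ ⊖ a)            ∎
    where
    u = evalᴿ (proj₁ (split A p)) x
    v = evalᴿ (proj₂ (split A p)) x

  -- The root is specified by its square and its sign instead of being `√ radicand`, because the
  -- radicals summed later have the form c √m √N.
  record Radical : Set where
    field
      root     : ℝ
      radicand : ℕ
      squared  : root ⊗ root ≋ fromℕ radicand
      positive : root isPos
  open Radical public

  -- ∏ (X ± a₁ ± … ± aₖ) over all choices of signs
  signProduct : List Radical → Poly
  signProduct []       = X
  signProduct (ρ ∷ ρs) = norm (+ radicand ρ) (signProduct ρs)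

  total : List Radical → ℝ
  total = sumᴿ root

  evalᴿ-signProduct : ∀ ρ ρs x → evalᴿ (signProduct (ρ ∷ ρs)) x
    ≋ evalᴿ (signProduct ρs) (x ⊕ root ρ) ⊗ evalᴿ (signProduct ρs) (x ⊕ ⊖ root ρ)
  evalᴿ-signProduct ρ ρs x = evalᴿ-norm (signProduct ρs) x (squared ρ)

  -- At the total, the factor with -a is the shorter product evaluated at the shorter total, which
  -- vanishes by induction.
  signProduct-root : ∀ ρs → evalᴿ (signProduct ρs) (total ρs) ≋ 0ᴿ
  signProduct-root []       = ≋-refl
  signProduct-root (ρ ∷ ρs) = begin
    evalᴿ (signProduct (ρ ∷ ρs)) t          ≈⟨ evalᴿ-signProduct ρ ρs t ⟩
    E (t ⊕ root ρ) ⊗ E (t ⊕ ⊖ root ρ)       ≈⟨ ⊗-congˡ (evalᴿ-cong (signProduct ρs) (cancel-first (root ρ) (total ρs))) ⟩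
    E (t ⊕ root ρ) ⊗ E (total ρs)           ≈⟨ ⊗-congˡ (signProduct-root ρs) ⟩
    E (t ⊕ root ρ) ⊗ 0ᴿ                     ≈⟨ ⊗-comm (E (t ⊕ root ρ)) 0ᴿ ⟩
    0ᴿ ⊗ E (t ⊕ root ρ)                     ≈⟨ ⊗-zeroˡ (E (t ⊕ root ρ)) ⟩
    0ᴿ                                      ∎
    where
    E = evalᴿ (signProduct ρs)
    t = total (ρ ∷ ρs)

  -- Allowing an arbitrary excess d makes the induction go through: the two factors are the shorter
  -- product at the shorter total with excess d and 2a + d.
  signProduct-pos : ∀ ρs {d} → d isPos → evalᴿ (signProduct ρs) (total ρs ⊕ d) isPos
  signProduct-pos [] {d} 0<d = isPos-resp {d} {0ᴿ ⊕ d} (≋-trans (≋-sym (⊕-identityʳ d)) (⊕-comm d 0ᴿ)) 0<d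
  signProduct-pos (ρ ∷ ρs) {d} 0<d = isPos-resp {y = evalᴿ (signProduct (ρ ∷ ρs)) (total (ρ ∷ ρs) ⊕ d)} (≋-sym (begin
    evalᴿ (signProduct (ρ ∷ ρs)) (total (ρ ∷ ρs) ⊕ d)
      ≈⟨ evalᴿ-signProduct ρ ρs (total (ρ ∷ ρs) ⊕ d) ⟩
    E ((total (ρ ∷ ρs) ⊕ d) ⊕ root ρ) ⊗ E ((total (ρ ∷ ρs) ⊕ d) ⊕ ⊖ root ρ)
      ≈⟨ ⊗-cong (evalᴿ-cong (signProduct ρs) (double-first-excess (root ρ) (total ρs) d))
                (evalᴿ-cong (signProduct ρs) (cancel-first-excess (root ρ) (total ρs) d)) ⟩
    E (total ρs ⊕ d′) ⊗ E (total ρs ⊕ d)    ∎))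
    (isPos-⊗ {E (total ρs ⊕ d′)} {E (total ρs ⊕ d)} (signProduct-pos ρs {d′} 0<d′) (signProduct-pos ρs {d} 0<d))
    where
    E = evalᴿ (signProduct ρs)
    d′ = (root ρ ⊕ root ρ) ⊕ d
    0<d′ : d′ isPos
    0<d′ = isPos-+ {root ρ ⊕ root ρ} {d} (isPos-+ {root ρ} {root ρ} (positive ρ) (positive ρ)) 0<d

  -- A = (u / v)² without division; u ≢ 0 forces v and A to be nonzero as well.
  RationalSquare : ℕ → Set
  RationalSquare A = ∃ λ u → ∃ λ v → u ≢ 0ℤ × u ℤ.* u ≡ + A ℤ.* (v ℤ.* v)

  -- Let S = sum of the other roots. The integer polynomial ∏ (X ± …) over the
  -- other radicals takes the values u − a v = 0 at r − a = S and u + a v > 0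
  -- at r + a = S + 2a.
  integral-total⇒square : ∀ ρ ρs r → total (ρ ∷ ρs) ≋ fromℤ r → RationalSquare (radicand ρ)
  integral-total⇒square ρ ρs r eq = u , v , u≢0 , fromℤ-injective (begin
    fromℤ (u ℤ.* u)                           ≈⟨ fromℤ-* u u ⟩
    U ⊗ U                                     ≈⟨ ⊗-cong U≋aV U≋aV ⟩
    (a ⊗ V) ⊗ (a ⊗ V)                         ≈⟨ ⊗-interchange a V a V ⟩
    (a ⊗ a) ⊗ (V ⊗ V)                         ≈⟨ ⊗-cong (squared ρ) (≋-sym (fromℤ-* v v)) ⟩
    fromℤ (+ A) ⊗ fromℤ (v ℤ.* v)             ≈⟨ fromℤ-* (+ A) (v ℤ.* v) ⟨
    fromℤ (+ A ℤ.* (v ℤ.* v))                 ∎)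
    where
    a = root ρ
    A = radicand ρ
    p = signProduct ρs
    u = evalℤ (proj₁ (split (+ A) p)) r
    v = evalℤ (proj₂ (split (+ A) p)) r
    U = fromℤ u
    V = fromℤ v
    split-at : ∀ b → b ⊗ b ≋ fromℕ A → evalᴿ p (fromℤ r ⊕ b) ≋ U ⊕ b ⊗ V
    split-at b b² = ≋-trans (evalᴿ-split p (fromℤ r) b²)
      (⊕-cong (evalᴿ-fromℤ (proj₁ (split (+ A) p)) r) (⊗-congˡ (evalᴿ-fromℤ (proj₂ (split (+ A) p)) r)))
    U-aV≋0 : U ⊕ ⊖ a ⊗ V ≋ 0ᴿ
    U-aV≋0 = begin
      U ⊕ ⊖ a ⊗ V                   ≈⟨ split-at (⊖ a) (≋-trans (⊖-square a) (squared ρ)) ⟨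
      evalᴿ p (fromℤ r ⊕ ⊖ a)       ≈⟨ evalᴿ-cong p (≋-trans (⊕-cong (≋-sym eq) ≋-refl) (cancel-first a (total ρs))) ⟩
      evalᴿ p (total ρs)            ≈⟨ signProduct-root ρs ⟩
      0ᴿ                            ∎
    U≋aV : U ≋ a ⊗ V
    U≋aV = begin
      U                             ≈⟨ move-product U a V ⟩
      (U ⊕ ⊖ a ⊗ V) ⊕ a ⊗ V         ≈⟨ ⊕-cong U-aV≋0 ≋-refl ⟩
      0ᴿ ⊕ a ⊗ V                    ≈⟨ ⊕-comm 0ᴿ (a ⊗ V) ⟩
      a ⊗ V ⊕ 0ᴿ                    ≈⟨ ⊕-identityʳ (a ⊗ V) ⟩
      a ⊗ V                         ∎
    U+U-pos : U ⊕ U isPos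
    U+U-pos = isPos-resp {evalᴿ p (total ρs ⊕ (a ⊕ a))} {U ⊕ U} (begin
      evalᴿ p (total ρs ⊕ (a ⊕ a))  ≈⟨ evalᴿ-cong p (≋-trans (≋-sym (double-first a (total ρs))) (⊕-cong eq ≋-refl)) ⟩
      evalᴿ p (fromℤ r ⊕ a)         ≈⟨ split-at a (squared ρ) ⟩
      U ⊕ a ⊗ V                     ≈⟨ ⊕-cong ≋-refl (≋-sym U≋aV) ⟩
      U ⊕ U                         ∎)
      (signProduct-pos ρs {a ⊕ a} (isPos-+ {a} {a} (positive ρ) (positive ρ)))
    u≢0 : u ≢ 0ℤ
    u≢0 u≡0 = 0-notPos (isPos-resp {U ⊕ U} {0ᴿ} (≋-trans
      (⊕-cong (pointwise λ _ → cong (ℚ._/ 1) u≡0) (pointwise λ _ → cong (ℚ._/ 1) u≡0)) (⊕-identityʳ 0ᴿ)) U+U-pos)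

  total-++ : ∀ ρs σs → total (ρs ++ σs) ≋ total ρs ⊕ total σs
  total-++ []       σs = ≋-trans (≋-sym (⊕-identityʳ (total σs))) (⊕-comm (total σs) 0ᴿ)
  total-++ (ρ ∷ ρs) σs = ≋-trans (⊕-cong ≋-refl (total-++ ρs σs)) (≋-sym (⊕-assoc (root ρ) (total ρs) (total σs)))

  -- The total does not depend on the order of the radicals, so each one can be moved to the front
  -- in turn; `before` collects those already treated.
  integral-total⇒squares : ∀ ρs r → total ρs ≋ fromℤ r → All (λ ρ → RationalSquare (radicand ρ)) ρs
  integral-total⇒squares ρs r eq = go [] ρs (≋-trans (⊕-comm 0ᴿ (total ρs)) (≋-trans (⊕-identityʳ (total ρs)) eq))
    where
    go : ∀ before after → total before ⊕ total after ≋ fromℤ r → All (λ ρ → RationalSquare (radicand ρ)) after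
    go before []          eq = []
    go before (ρ ∷ after) eq =
      integral-total⇒square ρ (before ++ after) r (≋-trans (⊕-cong ≋-refl (total-++ before after)) eq′)
      ∷ go (ρ ∷ before) after (≋-trans (⊕-assoc (root ρ) (total before) (total after)) eq′)
      where
      eq′ : root ρ ⊕ (total before ⊕ total after) ≋ fromℤ r
      eq′ = ≋-trans (≋-sym (insert (total before) (root ρ) (total after))) eq

  -- After division by the gcd, m′² n = k′² with m′ and k′ coprime. Then m′ divides k′ · k′, hence
  -- k′, hence m′ = 1.
  square-cofactor : ∀ m n k → m ≢ 0 → m ℕ.* m ℕ.* n ≡ k ℕ.* k → ∃ λ s → n ≡ s ℕ.* s
  square-cofactor m n k m≢0 eq = k′ , trans (sym (ℕ.+-identityʳ n)) (subst (λ a → a ℕ.* a ℕ.* n ≡ k′ ℕ.* k′) m′≡1 eq′)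
    where
    g = gcd m k
    instance
      g≢0 : ℕ.NonZero g
      g≢0 = ℕ.≢-nonZero (gcd[m,n]≢0 m k (inj₁ m≢0))
    m′ = m / g
    k′ = k / g
    regroup : ∀ a b c → a ℕ.* a ℕ.* b ℕ.* (c ℕ.* c) ≡ a ℕ.* c ℕ.* (a ℕ.* c) ℕ.* b
    regroup = ℕR.solve-∀
    regroup′ : ∀ a c → a ℕ.* a ℕ.* (c ℕ.* c) ≡ a ℕ.* c ℕ.* (a ℕ.* c)
    regroup′ = ℕR.solve-∀
    eq′ : m′ ℕ.* m′ ℕ.* n ≡ k′ ℕ.* k′
    eq′ = ℕ.*-cancelʳ-≡ (m′ ℕ.* m′ ℕ.* n) (k′ ℕ.* k′) (g ℕ.* g) ⦃ ℕ.m*n≢0 g g ⦄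
      (trans (regroup m′ n g)
        (trans (cong (λ a → a ℕ.* a ℕ.* n) (m/n*n≡m (gcd[m,n]∣m m k)))
          (trans eq (trans (sym (cong (λ a → a ℕ.* a) (m/n*n≡m (gcd[m,n]∣n m k)))) (sym (regroup′ k′ g))))))
    coprime : Coprime m′ k′
    coprime = coprime-/gcd m k
    m′≡1 : m′ ≡ 1
    m′≡1 = coprime (∣-refl , coprime-divisor {o = k′} coprime
      (divides (m′ ℕ.* n) (trans (sym eq′) (trans (ℕ.*-assoc m′ m′ n) (ℕ.*-comm m′ (m′ ℕ.* n))))))

  -- Clearing the denominator gives (m |v|)² n = |u|², and u ≢ 0 ensures that m |v| is nonzero, as
  -- `square-cofactor` requires.
  rationalSquare⇒square : ∀ m n → m ≢ 0 → RationalSquare (m ℕ.* m ℕ.* n) → ∃ λ s → n ≡ s ℕ.* s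
  rationalSquare⇒square m n m≢0 (u , v , u≢0 , eq) = square-cofactor (m ℕ.* w) n ℤ.∣ u ∣ mw≢0 eq′
    where
    w = ℤ.∣ v ∣
    regroup : ∀ m n w → m ℕ.* w ℕ.* (m ℕ.* w) ℕ.* n ≡ m ℕ.* m ℕ.* n ℕ.* (w ℕ.* w)
    regroup = ℕR.solve-∀
    eq′ : m ℕ.* w ℕ.* (m ℕ.* w) ℕ.* n ≡ ℤ.∣ u ∣ ℕ.* ℤ.∣ u ∣
    eq′ = trans (regroup m n w) (trans (cong (m ℕ.* m ℕ.* n ℕ.*_) (sym (ℤ.abs-* v v)))
      (trans (sym (ℤ.abs-* (+ (m ℕ.* m ℕ.* n)) (v ℤ.* v))) (trans (cong ℤ.∣_∣ (sym eq)) (ℤ.abs-* u u))))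
    square≡0 : ∀ a → 0 ≡ a ℕ.* a → a ≡ 0
    square≡0 zero _ = refl
    mw≢0 : m ℕ.* w ≢ 0
    mw≢0 e = u≢0 (ℤ.∣i∣≡0⇒i≡0 (square≡0 ℤ.∣ u ∣ (trans (sym (cong (λ a → a ℕ.* a ℕ.* n) e)) eq′)))

-- Weighted sums over integer points, shell by shell

module LatticeSums where

  open import Data.Integer as ℤ using (ℤ; +_; -[1+_]; 0ℤ)
  import Data.Integer.Properties as ℤ
  open import Data.List using (List; []; _∷_; _++_; map; length; upTo; cartesianProductWith)
  open import Data.List.Properties using (length-map; length-++; length-upTo)
  open import Data.List.Membership.Propositional using (_∈_; _∉_)
  open import Data.List.Membership.Propositional.Properties using (∈-map⁺; ∈-++⁺ˡ; ∈-++⁺ʳ; ∈-++⁻; ∈-upTo⁺; ∈-∃++; ∈-cartesianProductWith⁺; ∈-cartesianProductWith⁻)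
  open import Data.List.Relation.Unary.All as All using (All; []; _∷_)
  open import Data.List.Relation.Unary.AllPairs using ([]; _∷_)
  open import Data.List.Relation.Unary.Any using (here; there)
  open import Data.List.Relation.Unary.Unique.Propositional using (Unique)
  open import Data.Nat as ℕ using (ℕ; zero; suc)
  open import Data.Nat.DivMod using (m≡m%n+[m/n]*n; m%n<n)
  import Data.Nat.Properties as ℕ
  open import Data.Nat.ListAction using (sum)
  import Data.Nat.Tactic.RingSolver as ℕR
  open import Data.Product using (∃; _×_; _,_; proj₁; proj₂)
  open import Data.Rational
  open import Data.Rational.Properties
  import Data.Rational.Unnormalised as ℚᵘ
  import Data.Rational.Unnormalised.Properties as ℚᵘ
  open import Data.Rational.Solver using (module +-*-Solver)
  open +-*-Solver using (solve; _:+_; _:*_; _:=_; con)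
  open import Data.Sum using (_⊎_; inj₁; inj₂)
  open import Relation.Binary.PropositionalEquality
  open import Relation.Nullary using (yes; no; contradiction)
  open import Defs using (module Reals)
  open Reals using (/-mono-≤; ⌊√_⌋; ⌊√⌋-lower; ⌊√⌋-upper; sq-cancel; *-mono-≤-nonNeg)
  open RealArithmetic using (sumℚ; /1-+; /1-*)

  Point : Set
  Point = ℤ × ℤ

  range : ℕ → List ℤ
  range n = map +_ (upTo (suc n)) ++ map -[1+_] (upTo n)

  ∈-range : ∀ {n} i → ℤ.∣ i ∣ ℕ.≤ n → i ∈ range n
  ∈-range (+ m) m≤n = ∈-++⁺ˡ (∈-map⁺ +_ (∈-upTo⁺ (ℕ.s≤s m≤n)))
  ∈-range {n} -[1+ m ] m<n = ∈-++⁺ʳ (map +_ (upTo (suc n))) (∈-map⁺ -[1+_] (∈-upTo⁺ m<n))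

  length-range : ∀ n → length (range n) ≡ suc n ℕ.+ n
  length-range n = trans (length-++ (map +_ (upTo (suc n))))
    (cong₂ ℕ._+_ (trans (length-map +_ (upTo (suc n))) (length-upTo (suc n)))
                 (trans (length-map -[1+_] (upTo n)) (length-upTo n)))

  ±1+ : ℕ → List ℤ
  ±1+ k = + suc k ∷ -[1+ k ] ∷ []

  ∈-±1+ : ∀ {k} i → ℤ.∣ i ∣ ≡ suc k → i ∈ ±1+ k
  ∈-±1+ (+ _) refl = here refl
  ∈-±1+ -[1+ _ ] refl = there (here refl)

  ±1+-∣∣ : ∀ {k i} → i ∈ ±1+ k → ℤ.∣ i ∣ ≡ suc k
  ±1+-∣∣ (here refl) = refl
  ±1+-∣∣ (there (here refl)) = refl

  -- shell k consists of the points of maximum norm k + 1, each listed once.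
  shell box : ℕ → List Point
  shell k = cartesianProductWith _,_ (±1+ k) (range (suc k))
         ++ cartesianProductWith (λ b a → a , b) (±1+ k) (range k)
  box zero    = []
  box (suc k) = shell k ++ box k

  length-cartesianProductWith : {A B C : Set} (f : A → B → C) (xs : List A) (ys : List B) →
    length (cartesianProductWith f xs ys) ≡ length xs ℕ.* length ys
  length-cartesianProductWith f []       ys = refl
  length-cartesianProductWith f (x ∷ xs) ys = trans (length-++ (map (f x) ys))
    (cong₂ ℕ._+_ (length-map (f x) ys) (length-cartesianProductWith f xs ys))

  length-shell : ∀ k → length (shell k) ≡ 8 ℕ.* suc k
  length-shell k = trans (length-++ (cartesianProductWith _,_ (±1+ k) (range (suc k))))
    (trans (cong₂ ℕ._+_ (trans (length-cartesianProductWith _,_ (±1+ k) (range (suc k))) (cong (2 ℕ.*_) (length-range (suc k))))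
                        (trans (length-cartesianProductWith (λ b a → a , b) (±1+ k) (range k)) (cong (2 ℕ.*_) (length-range k))))
      (count k))
    where
    count : ∀ k → 2 ℕ.* (suc (suc k) ℕ.+ suc k) ℕ.+ 2 ℕ.* (suc k ℕ.+ k) ≡ 8 ℕ.* suc k
    count = ℕR.solve-∀

  shell-∣∣ : ∀ {k p} → p ∈ shell k → ℤ.∣ proj₁ p ∣ ≡ suc k ⊎ ℤ.∣ proj₂ p ∣ ≡ suc k
  shell-∣∣ {k} p∈ with ∈-++⁻ (cartesianProductWith _,_ (±1+ k) (range (suc k))) p∈
  ... | inj₁ q with ∈-cartesianProductWith⁻ _,_ (±1+ k) (range (suc k)) q
  ...   | _ , _ , a∈ , _ , refl = inj₁ (±1+-∣∣ a∈)
  shell-∣∣ {k} p∈ | inj₂ q with ∈-cartesianProductWith⁻ (λ b a → a , b) (±1+ k) (range k) q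
  ...   | _ , _ , b∈ , _ , refl = inj₂ (±1+-∣∣ b∈)

  ∈-box : ∀ R a b → ℤ.∣ a ∣ ℕ.≤ R → ℤ.∣ b ∣ ℕ.≤ R → (a , b) ≢ (0ℤ , 0ℤ) → (a , b) ∈ box R
  ∈-box zero a b a≤ b≤ ≢0 = contradiction
    (cong₂ _,_ (ℤ.∣i∣≡0⇒i≡0 (ℕ.n≤0⇒n≡0 a≤)) (ℤ.∣i∣≡0⇒i≡0 (ℕ.n≤0⇒n≡0 b≤))) ≢0
  ∈-box (suc R) a b a≤ b≤ ≢0 with ℕ.m≤n⇒m<n∨m≡n a≤ | ℕ.m≤n⇒m<n∨m≡n b≤
  ... | inj₁ a< | inj₁ b< = ∈-++⁺ʳ (shell R) (∈-box R a b (ℕ.s≤s⁻¹ a<) (ℕ.s≤s⁻¹ b<) ≢0)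
  ... | inj₂ a≡ | _ = ∈-++⁺ˡ (∈-++⁺ˡ (∈-cartesianProductWith⁺ _,_ (∈-±1+ a a≡) (∈-range b b≤)))
  ... | inj₁ a< | inj₂ b≡ = ∈-++⁺ˡ (∈-++⁺ʳ (cartesianProductWith _,_ (±1+ R) (range (suc R)))
        (∈-cartesianProductWith⁺ (λ b a → a , b) (∈-±1+ b b≡) (∈-range a (ℕ.s≤s⁻¹ a<))))

  module _ {T : Set} (f : T → ℚ) where

    sumℚ-++ : ∀ xs ys → sumℚ f (xs ++ ys) ≡ sumℚ f xs + sumℚ f ys
    sumℚ-++ []       ys = sym (+-identityˡ _)
    sumℚ-++ (x ∷ xs) ys = trans (cong (_+_ (f x)) (sumℚ-++ xs ys)) (sym (+-assoc (f x) _ _))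

    sumℚ-nonNeg : (∀ x → 0ℚ ≤ f x) → ∀ xs → 0ℚ ≤ sumℚ f xs
    sumℚ-nonNeg 0≤f []       = ≤-refl
    sumℚ-nonNeg 0≤f (x ∷ xs) = +-mono-≤ (0≤f x) (sumℚ-nonNeg 0≤f xs)

    -- Each entry of xs takes one occurrence out of ys; as xs has no repetitions, the later entries
    -- are still there.
    sumℚ-⊆ : (∀ x → 0ℚ ≤ f x) → ∀ {xs} ys → Unique xs → (∀ {x} → x ∈ xs → x ∈ ys) → sumℚ f xs ≤ sumℚ f ys
    sumℚ-⊆ 0≤f ys [] _ = sumℚ-nonNeg 0≤f ys
    sumℚ-⊆ 0≤f {x ∷ xs} ys (x∉ ∷ uniq) sub with ∈-∃++ (sub (here refl))
    ... | as , bs , refl = subst (f x + sumℚ f xs ≤_) (sym eq)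
            (+-monoʳ-≤ (f x) (sumℚ-⊆ 0≤f (as ++ bs) uniq sub′))
      where
      eq : sumℚ f (as ++ x ∷ bs) ≡ f x + sumℚ f (as ++ bs)
      eq = trans (sumℚ-++ as (x ∷ bs)) (trans
        (solve 3 (λ a x b → a :+ (x :+ b) := x :+ (a :+ b)) refl (sumℚ f as) (f x) (sumℚ f bs))
        (cong (_+_ (f x)) (sym (sumℚ-++ as bs))))
      sub′ : ∀ {y} → y ∈ xs → y ∈ as ++ bs
      sub′ y∈ with ∈-++⁻ as (sub (there y∈))
      ... | inj₁ y∈as = ∈-++⁺ˡ y∈as
      ... | inj₂ (there y∈bs) = ∈-++⁺ʳ as y∈bs
      ... | inj₂ (here refl) = contradiction refl (All.lookup x∉ y∈)

    sumℚ-≤-length : ∀ {c} xs → (∀ {x} → x ∈ xs → f x ≤ c) → sumℚ f xs ≤ + length xs / 1 * c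
    sumℚ-≤-length {c} []       le = ≤-reflexive (sym (*-zeroˡ c))
    sumℚ-≤-length {c} (x ∷ xs) le = subst (f x + sumℚ f xs ≤_)
      (trans (solve 2 (λ c l → c :+ l :* c := (con 1ℚ :+ l) :* c) refl c (+ length xs / 1))
        (cong (_* c) (sym (/1-+ (+ 1) (+ length xs)))))
      (+-mono-≤ (le (here refl)) (sumℚ-≤-length xs (λ x∈ → le (there x∈))))

    sumℚ-≤-scaled : ∀ (g : T → ℕ) {v} xs → (∀ {x} → x ∈ xs → f x ≤ + g x / 1 * v) → sumℚ f xs ≤ + sum (map g xs) / 1 * v
    sumℚ-≤-scaled g {v} []       le = ≤-reflexive (sym (*-zeroˡ v))
    sumℚ-≤-scaled g {v} (x ∷ xs) le = subst (f x + sumℚ f xs ≤_)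
      (trans (sym (*-distribʳ-+ v (+ g x / 1) (+ sum (map g xs) / 1)))
        (cong (_* v) (sym (/1-+ (+ g x) (+ sum (map g xs))))))
      (+-mono-≤ (le (here refl)) (sumℚ-≤-scaled g xs (λ x∈ → le (there x∈))))

  -- 1 / n, with 0 in place of 1 / 0
  unitFraction : ℕ → ℚ
  unitFraction zero    = 0ℚ
  unitFraction (suc n) = + 1 / suc n

  0≤unitFraction : ∀ n → 0ℚ ≤ unitFraction n
  0≤unitFraction zero    = ≤-refl
  0≤unitFraction (suc n) = /-mono-≤ (+ 0) (+ 1) 0 n (ℤ.+≤+ ℕ.z≤n)

  unitFraction-inverse : ∀ n → n ≢ 0 → unitFraction n * (+ n / 1) ≡ 1ℚ
  unitFraction-inverse zero    0≢0 = contradiction refl 0≢0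
  unitFraction-inverse (suc n) _   = toℚᵘ-injective
    (ℚᵘ.≃-trans (toℚᵘ-homo-* (+ 1 / suc n) (+ suc n / 1))
      (ℚᵘ.≃-trans (ℚᵘ.*-cong (toℚᵘ-fromℚᵘ (ℚᵘ.mkℚᵘ (+ 1) n)) (toℚᵘ-fromℚᵘ (ℚᵘ.mkℚᵘ (+ suc n) 0)))
        (ℚᵘ.*≡* (cong +_ (count n)))))
    where
    count : ∀ n → 1 ℕ.* suc n ℕ.* 1 ≡ 1 ℕ.* (suc n ℕ.* 1)
    count = ℕR.solve-∀

  0≤/1 : ∀ n → 0ℚ ≤ + n / 1
  0≤/1 n = /-mono-≤ (+ 0) (+ n) 0 0 (subst (+ 0 ℤ.≤_) (sym (ℤ.*-identityʳ (+ n))) (ℤ.+≤+ ℕ.z≤n))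

  /1-mono : ∀ {m n} → m ℕ.≤ n → + m / 1 ≤ + n / 1
  /1-mono {m} {n} m≤n = /-mono-≤ (+ m) (+ n) 0 0 (ℤ.*-monoʳ-≤-nonNeg (+ 1) (ℤ.+≤+ m≤n))

  /1-*ℕ : ∀ m n → + (m ℕ.* n) / 1 ≡ (+ m / 1) * (+ n / 1)
  /1-*ℕ m n = trans (cong (_/ 1) (ℤ.pos-* m n)) (/1-* (+ m) (+ n))

  unitFraction-cancel : ∀ d m → d ≢ 0 → unitFraction d * (+ (d ℕ.* m) / 1) ≡ + m / 1
  unitFraction-cancel d m d≢0 = begin
    unitFraction d * (+ (d ℕ.* m) / 1)       ≡⟨ cong (unitFraction d *_) (/1-*ℕ d m) ⟩
    unitFraction d * ((+ d / 1) * (+ m / 1)) ≡⟨ *-assoc (unitFraction d) (+ d / 1) (+ m / 1) ⟨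
    unitFraction d * (+ d / 1) * (+ m / 1)   ≡⟨ cong (_* (+ m / 1)) (unitFraction-inverse d d≢0) ⟩
    1ℚ * (+ m / 1)                           ≡⟨ *-identityˡ (+ m / 1) ⟩
    + m / 1                                  ∎
    where open ≡-Reasoning

  -- With 1 / 0 read as 0 the case u = 0 is trivial. The guard u ≢ 0 lets a weight that vanishes at
  -- some norms be estimated on its support alone.
  unitFraction-≤ : ∀ u c n → (u ≢ 0 → n ℕ.≤ c ℕ.* u) → n ≢ 0 → unitFraction u ≤ + c / 1 * unitFraction n
  unitFraction-≤ u c n le n≢0 with u ℕ.≟ 0
  ... | yes refl = subst (_≤ + c / 1 * unitFraction n) (*-zeroˡ 0ℚ) (*-mono-≤-nonNeg (0≤/1 c) ≤-refl (0≤/1 c) (0≤unitFraction n))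
  ... | no u≢0 = begin
    U                              ≡⟨ *-identityʳ U ⟨
    U * 1ℚ                         ≡⟨ cong (U *_) (trans (*-comm (+ n / 1) N⁻¹) (unitFraction-inverse n n≢0)) ⟨
    U * ((+ n / 1) * N⁻¹)          ≤⟨ *-monoˡ-≤-nonNeg U ⦃ nonNegative (0≤unitFraction u) ⦄
                                       (*-monoʳ-≤-nonNeg N⁻¹ ⦃ nonNegative (0≤unitFraction n) ⦄ (/1-mono (le u≢0))) ⟩
    U * ((+ (c ℕ.* u) / 1) * N⁻¹)  ≡⟨ cong (λ a → U * (a * N⁻¹)) (/1-*ℕ c u) ⟩
    U * ((C * (+ u / 1)) * N⁻¹)    ≡⟨ solve 4 (λ U c u N → U :* ((c :* u) :* N) := (U :* u) :* (c :* N)) refl U C (+ u / 1) N⁻¹ ⟩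
    (U * (+ u / 1)) * (C * N⁻¹)    ≡⟨ cong (_* (C * N⁻¹)) (unitFraction-inverse u u≢0) ⟩
    1ℚ * (C * N⁻¹)                 ≡⟨ *-identityˡ (C * N⁻¹) ⟩
    C * N⁻¹                        ∎
    where
    open ≤-Reasoning
    U = unitFraction u
    N⁻¹ = unitFraction n
    C = + c / 1

  unitFraction-* : ∀ m n → unitFraction (m ℕ.* n) ≡ unitFraction m * unitFraction n
  unitFraction-* m n with m ℕ.≟ 0 | n ℕ.≟ 0
  ... | yes refl | _ = sym (*-zeroˡ (unitFraction n))
  ... | no _ | yes refl = trans (cong unitFraction (ℕ.*-zeroʳ m)) (sym (*-zeroʳ (unitFraction m)))
  ... | no m≢0 | no n≢0 = begin
    I                              ≡⟨ *-identityʳ I ⟨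
    I * 1ℚ                         ≡⟨ cong (I *_) (trans (cong₂ _*_ (unitFraction-inverse m m≢0) (unitFraction-inverse n n≢0)) (*-identityˡ 1ℚ)) ⟨
    I * ((m⁻¹ * (+ m / 1)) * (n⁻¹ * (+ n / 1)))
      ≡⟨ solve 5 (λ i p m q n → i :* ((p :* m) :* (q :* n)) := (i :* (m :* n)) :* (p :* q)) refl I m⁻¹ (+ m / 1) n⁻¹ (+ n / 1) ⟩
    (I * ((+ m / 1) * (+ n / 1))) * (m⁻¹ * n⁻¹)
      ≡⟨ cong (λ a → (I * a) * (m⁻¹ * n⁻¹)) (/1-*ℕ m n) ⟨
    (I * (+ (m ℕ.* n) / 1)) * (m⁻¹ * n⁻¹)
      ≡⟨ cong (_* (m⁻¹ * n⁻¹)) (unitFraction-inverse (m ℕ.* n) mn≢0) ⟩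
    1ℚ * (m⁻¹ * n⁻¹)               ≡⟨ *-identityˡ (m⁻¹ * n⁻¹) ⟩
    m⁻¹ * n⁻¹                      ∎
    where
    open ≡-Reasoning
    I = unitFraction (m ℕ.* n)
    m⁻¹ = unitFraction m
    n⁻¹ = unitFraction n
    mn≢0 : m ℕ.* n ≢ 0
    mn≢0 e with ℕ.m*n≡0⇒m≡0∨n≡0 m e
    ... | inj₁ z = m≢0 z
    ... | inj₂ z = n≢0 z

  -- 1/(k+1)² ≤ 1/(k(k+1)) = 1/k − 1/(k+1)
  telescope : ∀ k → 0 ℕ.< k → unitFraction (suc k ℕ.* suc k) + unitFraction (suc k) ≤ unitFraction k
  telescope (suc k) _ = begin
    unitFraction (suc (suc k) ℕ.* suc (suc k)) + h  ≡⟨ cong (_+ h) (unitFraction-* (suc (suc k)) (suc (suc k))) ⟩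
    h * h + h                                       ≤⟨ +-monoˡ-≤ h (*-monoʳ-≤-nonNeg h ⦃ nonNegative (0≤unitFraction (suc (suc k))) ⦄ h≤h′) ⟩
    h′ * h + h                                      ≡⟨ cong (_+_ (h′ * h)) (*-identityˡ h) ⟨
    h′ * h + 1ℚ * h                                 ≡⟨ cong (λ a → h′ * h + a * h) (unitFraction-inverse (suc k) λ ()) ⟨
    h′ * h + (h′ * (+ suc k / 1)) * h
      ≡⟨ solve 3 (λ h′ h k → h′ :* h :+ (h′ :* k) :* h := h′ :* (h :* (con 1ℚ :+ k))) refl h′ h (+ suc k / 1) ⟩
    h′ * (h * (1ℚ + + suc k / 1))                   ≡⟨ cong (λ a → h′ * (h * a)) (/1-+ (+ 1) (+ suc k)) ⟨
    h′ * (h * (+ suc (suc k) / 1))                  ≡⟨ cong (h′ *_) (unitFraction-inverse (suc (suc k)) λ ()) ⟩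
    h′ * 1ℚ                                         ≡⟨ *-identityʳ h′ ⟩
    h′                                              ∎
    where
    open ≤-Reasoning
    h = unitFraction (suc (suc k))
    h′ = unitFraction (suc k)
    h≤h′ : h ≤ h′
    h≤h′ = /-mono-≤ (+ 1) (+ 1) (suc k) k (ℤ.+≤+ (ℕ.*-monoʳ-≤ 1 (ℕ.n≤1+n (suc k))))

  module _ (f : Point → ℚ) (c r : ℕ) (0<r : 0 ℕ.< r)
    (decay : ∀ k {p} → r ℕ.≤ k → p ∈ shell k → f p ≤ + c / 1 * unitFraction (8 ℕ.* suc k ℕ.* (suc k ℕ.* suc k))) where

    private
      C = + c / 1

    -- A shell has 8 (k + 1) points. This cancels the factor 8 (k + 1) in the assumed decay and
    -- leaves c / (k + 1)².
    shell-bound : ∀ k → r ℕ.≤ k → sumℚ f (shell k) ≤ C * unitFraction (suc k ℕ.* suc k)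
    shell-bound k r≤k = begin
      sumℚ f (shell k)                                ≤⟨ sumℚ-≤-length f (shell k) (decay k r≤k) ⟩
      + length (shell k) / 1 * (C * unitFraction (n ℕ.* m))
        ≡⟨ cong₂ (λ a b → + a / 1 * (C * b)) (length-shell k) (unitFraction-* n m) ⟩
      + n / 1 * (C * (unitFraction n * unitFraction m))
        ≡⟨ solve 4 (λ n c u v → n :* (c :* (u :* v)) := (u :* n) :* (c :* v)) refl (+ n / 1) C (unitFraction n) (unitFraction m) ⟩
      (unitFraction n * (+ n / 1)) * (C * unitFraction m)
        ≡⟨ cong (_* (C * unitFraction m)) (unitFraction-inverse n λ ()) ⟩
      1ℚ * (C * unitFraction m)                        ≡⟨ *-identityˡ (C * unitFraction m) ⟩
      C * unitFraction m                               ∎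
      where
      open ≤-Reasoning
      n = 8 ℕ.* suc k
      m = suc k ℕ.* suc k

    -- The box sum plus C / k does not increase with k: a new shell adds at most C / (k + 1)², which
    -- `telescope` charges to C / k - C / (k + 1). The tail is thus bounded without infinite sums.
    box-bound : ∀ j → sumℚ f (box (j ℕ.+ r)) + C * unitFraction (j ℕ.+ r)
                    ≤ sumℚ f (box (r)) + C * unitFraction (r)
    box-bound zero    = ≤-refl
    box-bound (suc j) = ≤-trans step (box-bound j)
      where
      open ≤-Reasoning
      k = j ℕ.+ r
      S = sumℚ f (box k)
      u = unitFraction (suc k ℕ.* suc k)
      v = unitFraction (suc k)
      telescope′ : u + v ≤ unitFraction k
      telescope′ = telescope k (ℕ.≤-trans 0<r (ℕ.m≤n+m r j))
      step : sumℚ f (box (suc k)) + C * v ≤ S + C * unitFraction k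
      step = begin
        sumℚ f (shell k ++ box k) + C * v  ≡⟨ cong (_+ C * v) (sumℚ-++ f (shell k) (box k)) ⟩
        sumℚ f (shell k) + S + C * v       ≤⟨ +-monoˡ-≤ (C * v) (+-monoˡ-≤ S (shell-bound k (ℕ.m≤n+m (r) j))) ⟩
        C * u + S + C * v                  ≡⟨ solve 4 (λ c u s v → c :* u :+ s :+ c :* v := s :+ c :* (u :+ v)) refl C u S v ⟩
        S + C * (u + v)                    ≤⟨ +-monoʳ-≤ S (*-monoˡ-≤-nonNeg C ⦃ nonNegative (0≤/1 c) ⦄ telescope′) ⟩
        S + C * unitFraction k             ∎

  ∣∣-bounded : (ps : List Point) → ∃ λ R → ∀ {a b} → (a , b) ∈ ps → ℤ.∣ a ∣ ℕ.≤ R × ℤ.∣ b ∣ ℕ.≤ R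
  ∣∣-bounded [] = 0 , λ ()
  ∣∣-bounded ((a , b) ∷ ps) with ∣∣-bounded ps
  ... | R , bound = ℤ.∣ a ∣ ℕ.+ ℤ.∣ b ∣ ℕ.+ R , λ where
    (here refl) → ℕ.≤-trans (ℕ.m≤m+n ℤ.∣ a ∣ ℤ.∣ b ∣) (ℕ.m≤m+n (ℤ.∣ a ∣ ℕ.+ ℤ.∣ b ∣) R)
                , ℕ.≤-trans (ℕ.m≤n+m ℤ.∣ b ∣ ℤ.∣ a ∣) (ℕ.m≤m+n (ℤ.∣ a ∣ ℕ.+ ℤ.∣ b ∣) R)
    (there p∈) → let (x , y) = bound p∈ ; R≤ = ℕ.m≤n+m R (ℤ.∣ a ∣ ℕ.+ ℤ.∣ b ∣) in ℕ.≤-trans x R≤ , ℕ.≤-trans y R≤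

  -- scaledTail = scale / radius. Opaque so that the general argument does not
  -- evaluate fractions with these numbers or the list box radius.
  opaque
    scale radius scaledTail : ℕ
    scale      = 1000000
    radius     = 20
    scaledTail = 50000

  opaque
    unfolding scale

    scale≢0 : scale ≢ 0
    scale≢0 ()

    radius≥20 : 20 ℕ.≤ radius
    radius≥20 = ℕ.≤-refl

    scale≤tail*radius : scale ℕ.≤ scaledTail ℕ.* radius
    scale≤tail*radius = ℕ.≤-refl

    scale≤38*30³ : scale ℕ.≤ 38 ℕ.* (30 ℕ.* (30 ℕ.* 30))
    scale≤38*30³ = ℕ.m≤m+n 1000000 26000

  -- A weight m ↦ 1 / D m on norms. It is at most g m / scale everywhere, and at
  -- most c / (8 n³) at the points of maximum norm n > radius.
  record Weight : Set where
    field
      D g   : ℕ → ℕ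
      c     : ℕ
      near  : ∀ m → D m ≢ 0 → scale ℕ.≤ g m ℕ.* D m
      decay : ∀ m n → radius ℕ.< n → 3 ℕ.* (n ℕ.* n) ℕ.≤ 4 ℕ.* m → D m ≢ 0 → 8 ℕ.* n ℕ.* (n ℕ.* n) ℕ.≤ c ℕ.* D m

    value : ℕ → ℚ
    value m = unitFraction (D m)

    -- `scale` times the bound for a lattice sum: the rounded weights in the box, and c / `radius`
    -- for everything outside.
    scaledBoxSum : (Point → ℕ) → List Point → ℕ
    scaledBoxSum N ps = sum (map (λ p → g (N p)) ps) ℕ.+ c ℕ.* scaledTail

  private
    collect : ∀ s c d v → + s / 1 * v + + c / 1 * (+ d / 1 * v) ≡ + (s ℕ.+ c ℕ.* d) / 1 * v
    collect s c d v = trans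
      (solve 4 (λ s c d v → s :* v :+ c :* (d :* v) := (s :+ c :* d) :* v) refl (+ s / 1) (+ c / 1) (+ d / 1) v)
      (cong (_* v) (trans (cong (_+_ (+ s / 1)) (sym (/1-*ℕ c d))) (sym (/1-+ (+ s) (+ (c ℕ.* d))))))

  module _ (W : Weight) (N : Point → ℕ)
    (coercive : ∀ p {n} → ℤ.∣ proj₁ p ∣ ≡ n ⊎ ℤ.∣ proj₂ p ∣ ≡ n → 3 ℕ.* (n ℕ.* n) ℕ.≤ 4 ℕ.* N p) where

    open Weight W

    private
      f : Point → ℚ
      f p = value (N p)

      v = unitFraction scale

    -- The finitely many points lie in a box of size R + `radius`. Adding the nonnegative term C /
    -- (R + `radius`) brings its sum into the form that `box-bound` shrinks back to `radius`.
    lattice-sum-≤ : ∀ {ps} → Unique ps → (0ℤ , 0ℤ) ∉ ps → sumℚ f ps ≤ + scaledBoxSum N (box radius) / 1 * v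
    lattice-sum-≤ {ps} uniq 0∉ with ∣∣-bounded ps
    ... | R , bound = begin
      sumℚ f ps                                     ≤⟨ sumℚ-⊆ f 0≤f (box (R ℕ.+ radius)) uniq sub ⟩
      sumℚ f (box (R ℕ.+ radius))                       ≡⟨ +-identityʳ (sumℚ f (box (R ℕ.+ radius))) ⟨
      sumℚ f (box (R ℕ.+ radius)) + 0ℚ                  ≤⟨ +-monoʳ-≤ (sumℚ f (box (R ℕ.+ radius)))
                                                        (subst (_≤ C * unitFraction (R ℕ.+ radius)) (*-zeroˡ 0ℚ)
                                                          (*-mono-≤-nonNeg (0≤/1 c) ≤-refl (0≤/1 c) (0≤unitFraction (R ℕ.+ radius)))) ⟩
      sumℚ f (box (R ℕ.+ radius)) + C * unitFraction (R ℕ.+ radius)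
                                                    ≤⟨ box-bound f c radius (ℕ.≤-trans (ℕ.s≤s ℕ.z≤n) radius≥20) far R ⟩
      sumℚ f (box radius) + C * unitFraction radius         ≤⟨ +-mono-≤ (sumℚ-≤-scaled f (λ p → g (N p)) (box radius) (λ {p} _ → near′ p))
                                                        (*-monoˡ-≤-nonNeg C ⦃ nonNegative (0≤/1 c) ⦄ v-multiple) ⟩
      + S / 1 * v + C * (T * v)                     ≡⟨ collect S c scaledTail v ⟩
      + scaledBoxSum N (box radius) / 1 * v             ∎
      where
      open ≤-Reasoning
      C = + c / 1
      S = sum (map (λ p → g (N p)) (box radius))
      T = + scaledTail / 1
      0≤f : ∀ p → 0ℚ ≤ f p
      0≤f p = 0≤unitFraction (D (N p))
      sub : ∀ {p} → p ∈ ps → p ∈ box (R ℕ.+ radius)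
      sub {a , b} p∈ = let (x , y) = bound p∈ in ∈-box (R ℕ.+ radius) a b
        (ℕ.≤-trans x (ℕ.m≤m+n R radius)) (ℕ.≤-trans y (ℕ.m≤m+n R radius)) λ { refl → 0∉ p∈ }
      far : ∀ k {p} → radius ℕ.≤ k → p ∈ shell k → f p ≤ C * unitFraction (8 ℕ.* suc k ℕ.* (suc k ℕ.* suc k))
      far k {p} k> p∈ = unitFraction-≤ (D (N p)) c (8 ℕ.* suc k ℕ.* (suc k ℕ.* suc k))
        (decay (N p) (suc k) (ℕ.s≤s k>) (coercive p (shell-∣∣ p∈))) λ ()
      near′ : ∀ p → f p ≤ + g (N p) / 1 * v
      near′ p = unitFraction-≤ (D (N p)) (g (N p)) scale (near (N p)) scale≢0
      v-multiple : unitFraction radius ≤ T * v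
      v-multiple = unitFraction-≤ radius scaledTail scale (λ _ → scale≤tail*radius) scale≢0

  -- An integer upper bound for `scale` / d, so that box sums are computed in ℕ without common
  -- denominators.
  scale/ : ℕ → ℕ
  scale/ zero    = 0
  scale/ (suc d) = suc (scale ℕ./ suc d)

  scale/-* : ∀ d → d ≢ 0 → scale ℕ.≤ scale/ d ℕ.* d
  scale/-* zero    0≢0 = contradiction refl 0≢0
  scale/-* (suc d) _   = subst (ℕ._≤ scale/ (suc d) ℕ.* suc d) (sym (m≡m%n+[m/n]*n scale (suc d)))
    (ℕ.+-monoˡ-≤ (scale ℕ./ suc d ℕ.* suc d) (ℕ.<⇒≤ (m%n<n scale (suc d))))

  quartic : Weight
  quartic = record
    { D = λ m → m ℕ.* m
    ; g = λ m → scale/ (m ℕ.* m)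
    ; c = 1
    ; near = λ m → scale/-* (m ℕ.* m)
    ; decay = λ m n r<n 3n²≤4m _ → ℕ.*-cancelˡ-≤ 16 (begin
        16 ℕ.* (8 ℕ.* n ℕ.* (n ℕ.* n))              ≡⟨ regroup₁ n ⟩
        -- Beyond the radius, 9 n ≥ 9 · 20 = 180 = 128 + 52; the spare factor n of 1 / n⁴ against 1
        -- / n³ is what permits c = 1.
        128 ℕ.* (n ℕ.* (n ℕ.* n))                   ≤⟨ ℕ.*-monoˡ-≤ (n ℕ.* (n ℕ.* n)) (ℕ.≤-trans (ℕ.m≤m+n 128 52) (ℕ.*-monoʳ-≤ 9 (ℕ.≤-trans radius≥20 (ℕ.<⇒≤ r<n)))) ⟩
        9 ℕ.* n ℕ.* (n ℕ.* (n ℕ.* n))               ≡⟨ regroup₂ n ⟩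
        3 ℕ.* (n ℕ.* n) ℕ.* (3 ℕ.* (n ℕ.* n))       ≤⟨ ℕ.*-mono-≤ 3n²≤4m 3n²≤4m ⟩
        4 ℕ.* m ℕ.* (4 ℕ.* m)                       ≡⟨ regroup₃ m ⟩
        16 ℕ.* (1 ℕ.* (m ℕ.* m))                    ∎)
    }
    where
    open ℕ.≤-Reasoning
    regroup₁ : ∀ n → 16 ℕ.* (8 ℕ.* n ℕ.* (n ℕ.* n)) ≡ 128 ℕ.* (n ℕ.* (n ℕ.* n))
    regroup₁ = ℕR.solve-∀
    regroup₂ : ∀ n → 9 ℕ.* n ℕ.* (n ℕ.* (n ℕ.* n)) ≡ 3 ℕ.* (n ℕ.* n) ℕ.* (3 ℕ.* (n ℕ.* n))
    regroup₂ = ℕR.solve-∀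
    regroup₃ : ∀ m → 4 ℕ.* m ℕ.* (4 ℕ.* m) ≡ 16 ℕ.* (1 ℕ.* (m ℕ.* m))
    regroup₃ = ℕR.solve-∀

  cube : ℕ → ℕ
  cube s = s ℕ.* (s ℕ.* s)

  -- The value |v|³ when |v| is an integer. The 0 elsewhere becomes weight 0 under `unitFraction`,
  -- which removes the points of irrational absolute value from the lattice sum.
  rootCube : ℕ → ℕ
  rootCube m with ⌊√ m ⌋ ℕ.* ⌊√ m ⌋ ℕ.≟ m
  ... | yes _ = cube ⌊√ m ⌋
  ... | no  _ = 0

  rootCube-support : ∀ m → rootCube m ≢ 0 → ∃ λ s → m ≡ s ℕ.* s × rootCube m ≡ cube s
  rootCube-support m ≢0 with ⌊√ m ⌋ ℕ.* ⌊√ m ⌋ ℕ.≟ m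
  ... | yes eq = ⌊√ m ⌋ , sym eq , refl
  ... | no  _  = contradiction refl ≢0

  ⌊√⌋-square : ∀ s → ⌊√ s ℕ.* s ⌋ ≡ s
  ⌊√⌋-square s = ℕ.≤-antisym
    (ℕ.s≤s⁻¹ (sq-cancel {⌊√ s ℕ.* s ⌋} {suc s} (ℕ.≤-<-trans (⌊√⌋-lower (s ℕ.* s)) (ℕ.*-mono-< (ℕ.n<1+n s) (ℕ.n<1+n s)))))
    (ℕ.s≤s⁻¹ (sq-cancel {s} {suc ⌊√ s ℕ.* s ⌋} (⌊√⌋-upper (s ℕ.* s))))

  rootCube-square : ∀ s → rootCube (s ℕ.* s) ≡ cube s
  rootCube-square s with ⌊√ s ℕ.* s ⌋ ℕ.* ⌊√ s ℕ.* s ⌋ ℕ.≟ s ℕ.* s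
  ... | yes _  = cong cube (⌊√⌋-square s)
  ... | no neq = contradiction (cong (λ r → r ℕ.* r) (⌊√⌋-square s)) neq

  -- Testing s² = m for small s keeps `⌊√_⌋`, which recurses through all smaller numbers, out of the
  -- bound that is evaluated over the box.
  squareTerm : ℕ → ℕ → ℕ
  squareTerm m s with s ℕ.* s ℕ.≟ m
  ... | yes _ = scale/ (cube s)
  ... | no  _ = 0

  squareTerm-square : ∀ s → squareTerm (s ℕ.* s) s ≡ scale/ (cube s)
  squareTerm-square s with s ℕ.* s ℕ.≟ s ℕ.* s
  ... | yes _  = refl
  ... | no neq = contradiction refl neq

  ∈⇒≤sum : {T : Set} (f : T → ℕ) {x : T} {xs : List T} → x ∈ xs → f x ℕ.≤ sum (map f xs)
  ∈⇒≤sum f {x} {.x ∷ xs} (here refl) = ℕ.m≤m+n (f x) (sum (map f xs))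
  ∈⇒≤sum f {x} {y ∷ xs} (there x∈)   = ℕ.≤-trans (∈⇒≤sum f x∈) (ℕ.m≤n+m (sum (map f xs)) (f y))

  -- The constant 38 > scale / 30³ takes care of the squares s² with s ≥ 30.
  cubicBound : ℕ → ℕ
  cubicBound m = 38 ℕ.+ sum (map (squareTerm m) (upTo 30))

  cubicBound-square : ∀ s → cube s ≢ 0 → scale ℕ.≤ cubicBound (s ℕ.* s) ℕ.* cube s
  cubicBound-square s s³≢0 with s ℕ.<? 30
  ... | yes s<30 = ℕ.≤-trans (scale/-* (cube s) s³≢0) (ℕ.*-monoˡ-≤ (cube s)
        (ℕ.≤-trans (subst (ℕ._≤ sum (map (squareTerm (s ℕ.* s)) (upTo 30))) (squareTerm-square s)
                     (∈⇒≤sum (squareTerm (s ℕ.* s)) (∈-upTo⁺ s<30)))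
          (ℕ.m≤n+m (sum (map (squareTerm (s ℕ.* s)) (upTo 30))) 38)))
  ... | no s≮30 = ℕ.≤-trans scale≤38*30³
        (ℕ.*-mono-≤ (ℕ.m≤m+n 38 (sum (map (squareTerm (s ℕ.* s)) (upTo 30))))
          (ℕ.*-mono-≤ (ℕ.≮⇒≥ s≮30) (ℕ.*-mono-≤ (ℕ.≮⇒≥ s≮30) (ℕ.≮⇒≥ s≮30))))

  -- 7³ · 8 ≤ 13 · 6³, and 3 n² ≤ 4 s² gives 6 n ≤ 7 s.
  cubic-decay : ∀ s n → 3 ℕ.* (n ℕ.* n) ℕ.≤ 4 ℕ.* (s ℕ.* s) → 8 ℕ.* n ℕ.* (n ℕ.* n) ℕ.≤ 13 ℕ.* cube s
  cubic-decay s n 3n²≤4s² = ℕ.*-cancelˡ-≤ 343 (begin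
    343 ℕ.* (8 ℕ.* n ℕ.* (n ℕ.* n))       ≡⟨ regroup₁ n ⟩
    2744 ℕ.* cube n                       ≤⟨ ℕ.*-monoˡ-≤ (cube n) (ℕ.m≤m+n 2744 64) ⟩
    2808 ℕ.* cube n                       ≡⟨ regroup₂ n ⟩
    13 ℕ.* cube (6 ℕ.* n)                 ≤⟨ ℕ.*-monoʳ-≤ 13 (ℕ.*-mono-≤ 6n≤7s (ℕ.*-mono-≤ 6n≤7s 6n≤7s)) ⟩
    13 ℕ.* cube (7 ℕ.* s)                 ≡⟨ regroup₃ s ⟩
    343 ℕ.* (13 ℕ.* cube s)               ∎)
    where
    open ℕ.≤-Reasoning
    regroup₁ : ∀ n → 343 ℕ.* (8 ℕ.* n ℕ.* (n ℕ.* n)) ≡ 2744 ℕ.* (n ℕ.* (n ℕ.* n))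
    regroup₁ = ℕR.solve-∀
    regroup₂ : ∀ n → 2808 ℕ.* (n ℕ.* (n ℕ.* n)) ≡ 13 ℕ.* (6 ℕ.* n ℕ.* (6 ℕ.* n ℕ.* (6 ℕ.* n)))
    regroup₂ = ℕR.solve-∀
    regroup₃ : ∀ s → 13 ℕ.* (7 ℕ.* s ℕ.* (7 ℕ.* s ℕ.* (7 ℕ.* s))) ≡ 343 ℕ.* (13 ℕ.* (s ℕ.* (s ℕ.* s)))
    regroup₃ = ℕR.solve-∀
    regroup₄ : ∀ n → 12 ℕ.* n ℕ.* (12 ℕ.* n) ℕ.+ 3 ℕ.* (n ℕ.* n) ≡ 49 ℕ.* (3 ℕ.* (n ℕ.* n))
    regroup₄ = ℕR.solve-∀
    regroup₅ : ∀ s → 49 ℕ.* (4 ℕ.* (s ℕ.* s)) ≡ 14 ℕ.* s ℕ.* (14 ℕ.* s)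
    regroup₅ = ℕR.solve-∀
    double : ∀ a b → 2 ℕ.* (a ℕ.* b) ≡ 2 ℕ.* a ℕ.* b
    double = ℕR.solve-∀
    -- Multiplying 3 n² ≤ 4 s² by 49 gives 147 n² ≤ (14 s)², and 147 exceeds 144 = 12².
    12n≤14s : 12 ℕ.* n ℕ.≤ 14 ℕ.* s
    12n≤14s = ℕ.≮⇒≥ λ lt → ℕ.<⇒≱ (ℕ.*-mono-< lt lt) (begin
      12 ℕ.* n ℕ.* (12 ℕ.* n)                        ≤⟨ ℕ.m≤m+n (12 ℕ.* n ℕ.* (12 ℕ.* n)) (3 ℕ.* (n ℕ.* n)) ⟩
      12 ℕ.* n ℕ.* (12 ℕ.* n) ℕ.+ 3 ℕ.* (n ℕ.* n)    ≡⟨ regroup₄ n ⟩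
      49 ℕ.* (3 ℕ.* (n ℕ.* n))                       ≤⟨ ℕ.*-monoʳ-≤ 49 3n²≤4s² ⟩
      49 ℕ.* (4 ℕ.* (s ℕ.* s))                       ≡⟨ regroup₅ s ⟩
      14 ℕ.* s ℕ.* (14 ℕ.* s)                        ∎)
    6n≤7s : 6 ℕ.* n ℕ.≤ 7 ℕ.* s
    6n≤7s = ℕ.*-cancelˡ-≤ 2 (subst₂ ℕ._≤_ (sym (double 6 n)) (sym (double 7 s)) 12n≤14s)

  cubic : Weight
  cubic = record
    { D = rootCube
    ; g = cubicBound
    ; c = 13
    ; near = near
    ; decay = decay
    }
    where
    near : ∀ m → rootCube m ≢ 0 → scale ℕ.≤ cubicBound m ℕ.* rootCube m
    near m ≢0 with rootCube-support m ≢0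
    ... | s , m≡ , eq = subst₂ (λ a b → scale ℕ.≤ cubicBound a ℕ.* b) (sym m≡) (sym eq)
            (cubicBound-square s λ z → ≢0 (trans eq z))
    decay : ∀ m n → radius ℕ.< n → 3 ℕ.* (n ℕ.* n) ℕ.≤ 4 ℕ.* m → rootCube m ≢ 0 → 8 ℕ.* n ℕ.* (n ℕ.* n) ℕ.≤ 13 ℕ.* rootCube m
    decay m n _ 3n²≤4m ≢0 with rootCube-support m ≢0
    ... | s , m≡ , eq = subst (λ a → 8 ℕ.* n ℕ.* (n ℕ.* n) ℕ.≤ 13 ℕ.* a) (sym eq)
            (cubic-decay s n (subst (λ a → 3 ℕ.* (n ℕ.* n) ℕ.≤ 4 ℕ.* a) m≡ 3n²≤4m))

-- Units, sectors and the numerical check for each d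

module Units where

  open import Defs hiding (box)
  open import Data.Integer as ℤ using (ℤ; +_; -[1+_]; +[1+_]; 0ℤ; 1ℤ)
  import Data.Integer.Properties as ℤ
  import Data.Integer.Tactic.RingSolver as ℤR
  open import Data.List using (List; []; _∷_; length; map)
  open import Data.List.Relation.Unary.All as All using (All; []; _∷_)
  open import Data.List.Relation.Unary.Any using (Any; any?)
  open import Data.List.Relation.Unary.Unique.Propositional using (Unique)
  open import Data.List.Relation.Unary.AllPairs as AllPairs using (allPairs?)
  open import Data.List.Membership.Propositional using (_∈_)
  open import Data.Nat as ℕ using (ℕ; zero; suc)
  import Data.Nat.Properties as ℕ
  open import Data.Product using (_×_; _,_; proj₁; proj₂)
  open import Data.Sum using (_⊎_; inj₁; inj₂)
  open import Relation.Binary.PropositionalEquality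
  open import Relation.Nullary using (¬_; ¬?; _×-dec_; contradiction)
  open import Relation.Nullary.Decidable using (from-yes)
  open LatticeSums using (Point; box; radius; scale; quartic; cubic; module Weight)

  -- For d = −1 these are the powers of ω = i, for d = −3 the powers of the
  -- sixth root of unity ω.
  units : ∀ d → List (𝒪 d)
  units -[1+ 0 ] = 1𝒪 ∷ ⟨ 0ℤ , 1ℤ ⟩ ∷ - 1𝒪 ∷ ⟨ 0ℤ , -[1+ 0 ] ⟩ ∷ []
  units -[1+ 2 ] = 1𝒪 ∷ ⟨ 0ℤ , 1ℤ ⟩ ∷ ⟨ -[1+ 0 ] , 1ℤ ⟩ ∷ - 1𝒪 ∷ ⟨ 0ℤ , -[1+ 0 ] ⟩ ∷ ⟨ 1ℤ , -[1+ 0 ] ⟩ ∷ []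
  units d        = 1𝒪 ∷ - 1𝒪 ∷ []

  private
    0<i⇒-i<0 : ∀ {i} → 0ℤ ℤ.< i → ¬ (0ℤ ℤ.≤ ℤ.- i)
    0<i⇒-i<0 {+[1+ n ]} _ ()
    0<i⇒-i<0 {+ 0} (ℤ.+<+ ()) _

    0≤i⇒-i≯0 : ∀ {i} → 0ℤ ℤ.≤ i → ¬ (0ℤ ℤ.< ℤ.- i)
    0≤i⇒-i≯0 {+[1+ n ]} _ ()
    0≤i⇒-i≯0 {+ 0} _ (ℤ.+<+ ())

    0<2i⇒0<i : ∀ {i} → 0ℤ ℤ.< + 2 ℤ.* i → 0ℤ ℤ.< i
    0<2i⇒0<i {i} lt = ℤ.*-cancelˡ-<-nonNeg (+ 2) lt

    0≤2i⇒0≤i : ∀ {i} → 0ℤ ℤ.≤ + 2 ℤ.* i → 0ℤ ℤ.≤ i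
    0≤2i⇒0≤i {i} le = ℤ.*-cancelˡ-≤-pos 0ℤ i (+ 2) le

    quadrant : (x : 𝒪 -[1+ 0 ]) → Sector -[1+ 0 ] x → 0ℤ ℤ.< 𝒪.coeff₁ x × 0ℤ ℤ.≤ 𝒪.coeffω x
    quadrant ⟨ a , b ⟩ (0≤2b , 0<2a) =
      0<2i⇒0<i (subst (0ℤ ℤ.<_) (ℤ.+-identityʳ (+ 2 ℤ.* a)) 0<2a) , 0≤2i⇒0≤i 0≤2b

    -- For d = -3, ω is the sixth root of unity bounding the sector, so in the basis 1, ω the
    -- sextant has the same coordinate description as the quadrant for d = -1.
    sextant : (x : 𝒪 -[1+ 2 ]) → Sector -[1+ 2 ] x → 0ℤ ℤ.< 𝒪.coeff₁ x × 0ℤ ℤ.≤ 𝒪.coeffω x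
    sextant ⟨ a , b ⟩ (0≤b , b<2a+b) =
      0<2i⇒0<i (subst₂ ℤ._<_ (im b) (re a b) (ℤ.+-monoˡ-< (ℤ.- b) b<2a+b)) , subst (0ℤ ℤ.≤_) (ℤ.*-identityˡ b) 0≤b
      where
      im : ∀ b → 1ℤ ℤ.* b ℤ.+ (ℤ.- b) ≡ 0ℤ
      im = ℤR.solve-∀
      re : ∀ a b → + 2 ℤ.* a ℤ.+ 1ℤ ℤ.* b ℤ.+ (ℤ.- b) ≡ + 2 ℤ.* a
      re = ℤR.solve-∀

  -- Half of the statement that the sector is a fundamental domain for the action of the units: no
  -- two of its points differ by a unit other than 1.
  Rotation : ∀ d → 𝒪 d → Set
  Rotation d v = ∀ x → Sector d x → Sector d (v * x) → v ≡ 1𝒪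

  half-plane : ∀ {i j} → 0ℤ ℤ.< i ⊎ (i ≡ 0ℤ × 0ℤ ℤ.< j) → ¬ (0ℤ ℤ.< ℤ.- i ⊎ (ℤ.- i ≡ 0ℤ × 0ℤ ℤ.< ℤ.- j))
  half-plane (inj₁ 0<i) (inj₁ 0<-i) = 0<i⇒-i<0 0<i (ℤ.<⇒≤ 0<-i)
  half-plane (inj₁ 0<i) (inj₂ (-i≡0 , _)) = 0<i⇒-i<0 0<i (ℤ.≤-reflexive (sym -i≡0))
  half-plane (inj₂ (refl , _)) (inj₁ (ℤ.+<+ ()))
  half-plane (inj₂ (_ , 0<j)) (inj₂ (_ , 0<-j)) = 0<i⇒-i<0 0<j (ℤ.<⇒≤ 0<-j)

  HalfPlane : ∀ {d} → 𝒪 d → Set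
  HalfPlane z = 0ℤ ℤ.< 2im z ⊎ (2im z ≡ 0ℤ × 0ℤ ℤ.< 2re z)

  negation-leaves-half-plane : ∀ {d} (x : 𝒪 d) → HalfPlane x → ¬ HalfPlane (- 1𝒪 * x)
  negation-leaves-half-plane {d} ⟨ a , b ⟩ p q = half-plane p
    (subst₂ (λ i j → 0ℤ ℤ.< i ⊎ (i ≡ 0ℤ × 0ℤ ℤ.< j)) (im (tr d) a b) (re (tr d) (nm d) a b) q)
    where
    im : ∀ t a b → (+ 2 ℤ.- t) ℤ.* (-[1+ 0 ] ℤ.* b ℤ.+ 0ℤ ℤ.* a ℤ.+ t ℤ.* (0ℤ ℤ.* b)) ≡ ℤ.- ((+ 2 ℤ.- t) ℤ.* b)
    im = ℤR.solve-∀
    re : ∀ t n a b → + 2 ℤ.* (-[1+ 0 ] ℤ.* a ℤ.- n ℤ.* (0ℤ ℤ.* b)) ℤ.+ t ℤ.* (-[1+ 0 ] ℤ.* b ℤ.+ 0ℤ ℤ.* a ℤ.+ t ℤ.* (0ℤ ℤ.* b))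
      ≡ ℤ.- (+ 2 ℤ.* a ℤ.+ t ℤ.* b)
    re = ℤR.solve-∀

  -- Stated with `HalfPlane`, because `Sector d` reduces to it only once d has been split into
  -- cases.
  sign-rotations : ∀ {d} → All (λ v → ∀ x → HalfPlane x → HalfPlane (v * x) → v ≡ 1𝒪) (1𝒪 {d} ∷ - 1𝒪 ∷ [])
  sign-rotations = (λ _ _ _ → refl) ∷ (λ x p q → contradiction q (negation-leaves-half-plane x p)) ∷ []

  -- For d = -1 and d = -3, each unit other than 1 turns one of the coordinates a, b into -a, -b or
  -- -(a + b), against a > 0 and b ≥ 0.
  rotations : ∀ d → All (Rotation d) (units d)
  rotations (+ n) = sign-rotations
  rotations -[1+ 0 ] = (λ _ _ _ → refl) ∷ i ∷ -1′ ∷ -i ∷ []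
    where
    i : Rotation -[1+ 0 ] ⟨ 0ℤ , 1ℤ ⟩
    i ⟨ a , b ⟩ p q = contradiction (subst (0ℤ ℤ.<_) (eq a b) (proj₁ (quadrant (⟨ 0ℤ , 1ℤ ⟩ * ⟨ a , b ⟩) q))) (0≤i⇒-i≯0 (proj₂ (quadrant ⟨ a , b ⟩ p)))
      where
      eq : ∀ a b → 0ℤ ℤ.* a ℤ.- 1ℤ ℤ.* (1ℤ ℤ.* b) ≡ ℤ.- b
      eq = ℤR.solve-∀
    -1′ : Rotation -[1+ 0 ] (- 1𝒪)
    -1′ ⟨ a , b ⟩ p q = contradiction (ℤ.<⇒≤ (subst (0ℤ ℤ.<_) (eq a b) (proj₁ (quadrant ((- 1𝒪) * ⟨ a , b ⟩) q)))) (0<i⇒-i<0 (proj₁ (quadrant ⟨ a , b ⟩ p)))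
      where
      eq : ∀ a b → -[1+ 0 ] ℤ.* a ℤ.- 1ℤ ℤ.* (0ℤ ℤ.* b) ≡ ℤ.- a
      eq = ℤR.solve-∀
    -i : Rotation -[1+ 0 ] ⟨ 0ℤ , -[1+ 0 ] ⟩
    -i ⟨ a , b ⟩ p q = contradiction (subst (0ℤ ℤ.≤_) (eq a b) (proj₂ (quadrant (⟨ 0ℤ , -[1+ 0 ] ⟩ * ⟨ a , b ⟩) q))) (0<i⇒-i<0 (proj₁ (quadrant ⟨ a , b ⟩ p)))
      where
      eq : ∀ a b → 0ℤ ℤ.* b ℤ.+ -[1+ 0 ] ℤ.* a ℤ.+ 0ℤ ℤ.* (-[1+ 0 ] ℤ.* b) ≡ ℤ.- a
      eq = ℤR.solve-∀
  rotations -[1+ 1 ] = sign-rotations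
  rotations -[1+ 2 ] = (λ _ _ _ → refl) ∷ ω ∷ ω² ∷ ω³ ∷ ω⁴ ∷ ω⁵ ∷ []
    where
    ω : Rotation -[1+ 2 ] ⟨ 0ℤ , 1ℤ ⟩
    ω ⟨ a , b ⟩ p q = contradiction (subst (0ℤ ℤ.<_) (eq a b) (proj₁ (sextant (⟨ 0ℤ , 1ℤ ⟩ * ⟨ a , b ⟩) q))) (0≤i⇒-i≯0 (proj₂ (sextant ⟨ a , b ⟩ p)))
      where
      eq : ∀ a b → 0ℤ ℤ.* a ℤ.- 1ℤ ℤ.* (1ℤ ℤ.* b) ≡ ℤ.- b
      eq = ℤR.solve-∀
    0<a+b : ∀ a b → Sector -[1+ 2 ] ⟨ a , b ⟩ → 0ℤ ℤ.< a ℤ.+ b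
    0<a+b a b p = ℤ.+-mono-<-≤ (proj₁ (sextant ⟨ a , b ⟩ p)) (proj₂ (sextant ⟨ a , b ⟩ p))
    ω² : Rotation -[1+ 2 ] ⟨ -[1+ 0 ] , 1ℤ ⟩
    ω² ⟨ a , b ⟩ p q = contradiction (ℤ.<⇒≤ (subst (0ℤ ℤ.<_) (eq a b) (proj₁ (sextant (⟨ -[1+ 0 ] , 1ℤ ⟩ * ⟨ a , b ⟩) q)))) (0<i⇒-i<0 (0<a+b a b p))
      where
      eq : ∀ a b → -[1+ 0 ] ℤ.* a ℤ.- 1ℤ ℤ.* (1ℤ ℤ.* b) ≡ ℤ.- (a ℤ.+ b)
      eq = ℤR.solve-∀
    ω³ : Rotation -[1+ 2 ] (- 1𝒪)
    ω³ ⟨ a , b ⟩ p q = contradiction (ℤ.<⇒≤ (subst (0ℤ ℤ.<_) (eq a b) (proj₁ (sextant ((- 1𝒪) * ⟨ a , b ⟩) q)))) (0<i⇒-i<0 (proj₁ (sextant ⟨ a , b ⟩ p)))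
      where
      eq : ∀ a b → -[1+ 0 ] ℤ.* a ℤ.- 1ℤ ℤ.* (0ℤ ℤ.* b) ≡ ℤ.- a
      eq = ℤR.solve-∀
    ω⁴ : Rotation -[1+ 2 ] ⟨ 0ℤ , -[1+ 0 ] ⟩
    ω⁴ ⟨ a , b ⟩ p q = contradiction (subst (0ℤ ℤ.≤_) (eq a b) (proj₂ (sextant (⟨ 0ℤ , -[1+ 0 ] ⟩ * ⟨ a , b ⟩) q))) (0<i⇒-i<0 (0<a+b a b p))
      where
      eq : ∀ a b → 0ℤ ℤ.* b ℤ.+ -[1+ 0 ] ℤ.* a ℤ.+ 1ℤ ℤ.* (-[1+ 0 ] ℤ.* b) ≡ ℤ.- (a ℤ.+ b)
      eq = ℤR.solve-∀
    ω⁵ : Rotation -[1+ 2 ] ⟨ 1ℤ , -[1+ 0 ] ⟩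
    ω⁵ ⟨ a , b ⟩ p q = contradiction (subst (0ℤ ℤ.≤_) (eq a b) (proj₂ (sextant (⟨ 1ℤ , -[1+ 0 ] ⟩ * ⟨ a , b ⟩) q))) (0<i⇒-i<0 (proj₁ (sextant ⟨ a , b ⟩ p)))
      where
      eq : ∀ a b → 1ℤ ℤ.* b ℤ.+ -[1+ 0 ] ℤ.* a ℤ.+ 1ℤ ℤ.* (-[1+ 0 ] ℤ.* b) ≡ ℤ.- a
      eq = ℤR.solve-∀
  rotations -[1+ suc (suc (suc n)) ] = sign-rotations

  opaque
    unit-norms : All (λ d → All (λ u → norm u ≡ 1) (units d)) heegner
    unit-norms = from-yes (All.all? (λ d → All.all? (λ u → norm u ℕ.≟ 1) (units d)) heegner)

    units-unique : All (λ d → Unique (units d)) heegner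
    units-unique = from-yes (All.all? (λ d → allPairs? (λ u v → ¬? (u ≟𝒪 v)) (units d)) heegner)

    -- Turns an equation u y = u′ y′ into a relation x′ = v x with v again in the list, where
    -- `rotations` applies.
    unit-quotients : All (λ d → All (λ u → All (λ u′ → Any (λ v → u * v ≡ u′) (units d)) (units d)) (units d)) heegner
    unit-quotients = from-yes (All.all? (λ d → All.all? (λ u → All.all? (λ u′ →
      any? (λ v → u * v ≟𝒪 u′) (units d)) (units d)) (units d)) heegner)

  fromPoint : ∀ {d} → Point → 𝒪 d
  fromPoint (a , b) = ⟨ a , b ⟩

  pointNorm : ℤ → Point → ℕ
  pointNorm d p = norm (fromPoint {d} p)

  opaque
    -- With D = 4n - t², completing squares in the norm form gives 4 |v|² = (2a + tb)² + D b² and 4n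
    -- |v|² = (2nb + ta)² + D a². The two bounds on D make each coordinate satisfy 3 i² ≤ 4 |v|².
    -- Both are equalities at d = -3.
    discriminant-bounds : All (λ d → + 3 ℤ.≤ + 4 ℤ.* nm d ℤ.- tr d ℤ.* tr d
                                   × + 3 ℤ.* nm d ℤ.≤ + 4 ℤ.* nm d ℤ.- tr d ℤ.* tr d) heegner
    discriminant-bounds = from-yes (All.all? (λ d → + 3 ℤ.≤? + 4 ℤ.* nm d ℤ.- tr d ℤ.* tr d
                                              ×-dec + 3 ℤ.* nm d ℤ.≤? + 4 ℤ.* nm d ℤ.- tr d ℤ.* tr d) heegner)

  module _ {d} (d∈ : d ∈ heegner) where

    private
      n t D : ℤ
      n = nm d
      t = tr d
      D = + 4 ℤ.* n ℤ.- t ℤ.* t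

      square-∣∣ : ∀ i → + (ℤ.∣ i ∣ ℕ.* ℤ.∣ i ∣) ≡ i ℤ.* i
      square-∣∣ (+ m) = ℤ.pos-* m m
      square-∣∣ -[1+ m ] = refl

      0≤square : ∀ i → 0ℤ ℤ.≤ i ℤ.* i
      0≤square i = subst (0ℤ ℤ.≤_) (square-∣∣ i) (ℤ.+≤+ ℕ.z≤n)

      ≤-square+ : ∀ k {i j} → i ℤ.≤ j → i ℤ.≤ k ℤ.* k ℤ.+ j
      ≤-square+ k {i} {j} i≤j = subst (ℤ._≤ k ℤ.* k ℤ.+ j) (ℤ.+-identityˡ i) (ℤ.+-mono-≤ (0≤square k) i≤j)

      D-mono : ∀ {c} i → c ℤ.≤ D → c ℤ.* (i ℤ.* i) ℤ.≤ D ℤ.* (i ℤ.* i)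
      D-mono i c≤D = ℤ.*-monoʳ-≤-nonNeg (i ℤ.* i) ⦃ ℤ.nonNegative (0≤square i) ⦄ c≤D

      square₁ : ∀ t n a b → (+ 2 ℤ.* n ℤ.* b ℤ.+ t ℤ.* a) ℤ.* (+ 2 ℤ.* n ℤ.* b ℤ.+ t ℤ.* a) ℤ.+ (+ 4 ℤ.* n ℤ.- t ℤ.* t) ℤ.* (a ℤ.* a)
        ≡ n ℤ.* (+ 4 ℤ.* (a ℤ.* (a ℤ.+ t ℤ.* b) ℤ.- n ℤ.* (b ℤ.* (ℤ.- b))))
      square₁ = ℤR.solve-∀

      square₂ : ∀ t n a b → (+ 2 ℤ.* a ℤ.+ t ℤ.* b) ℤ.* (+ 2 ℤ.* a ℤ.+ t ℤ.* b) ℤ.+ (+ 4 ℤ.* n ℤ.- t ℤ.* t) ℤ.* (b ℤ.* b)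
        ≡ + 4 ℤ.* (a ℤ.* (a ℤ.+ t ℤ.* b) ℤ.- n ℤ.* (b ℤ.* (ℤ.- b)))
      square₂ = ℤR.solve-∀

      regroup : ∀ n i → + 3 ℤ.* n ℤ.* i ≡ n ℤ.* (+ 3 ℤ.* i)
      regroup = ℤR.solve-∀

      coeff₁-bound′ : ∀ a b → + 3 ℤ.* (a ℤ.* a) ℤ.≤ + 4 ℤ.* normℤ {d} ⟨ a , b ⟩
      coeff₁-bound′ a b = ℤ.*-cancelˡ-≤-pos (+ 3 ℤ.* (a ℤ.* a)) (+ 4 ℤ.* normℤ {d} ⟨ a , b ⟩) n
        ⦃ ℤ.positive (ℤ.<-≤-trans (ℤ.+<+ (ℕ.s≤s ℕ.z≤n)) (1≤n d∈)) ⦄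
        (subst₂ ℤ._≤_ (regroup n (a ℤ.* a)) (square₁ t n a b)
          (≤-square+ (+ 2 ℤ.* n ℤ.* b ℤ.+ t ℤ.* a) (D-mono a (proj₂ (All.lookup discriminant-bounds d∈)))))

      coeffω-bound″ : ∀ a b → + 3 ℤ.* (b ℤ.* b) ℤ.≤ + 4 ℤ.* normℤ {d} ⟨ a , b ⟩
      coeffω-bound″ a b = subst (+ 3 ℤ.* (b ℤ.* b) ℤ.≤_) (square₂ t n a b)
        (≤-square+ (+ 2 ℤ.* a ℤ.+ t ℤ.* b) (D-mono b (proj₁ (All.lookup discriminant-bounds d∈))))

      toℕ : ∀ i z → + 3 ℤ.* (i ℤ.* i) ℤ.≤ + 4 ℤ.* normℤ {d} z → 3 ℕ.* (ℤ.∣ i ∣ ℕ.* ℤ.∣ i ∣) ℕ.≤ 4 ℕ.* norm z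
      toℕ i z le = ℤ.drop‿+≤+ (subst₂ ℤ._≤_
        (trans (cong (+ 3 ℤ.*_) (sym (square-∣∣ i))) (sym (ℤ.pos-* 3 (ℤ.∣ i ∣ ℕ.* ℤ.∣ i ∣))))
        (trans (cong (+ 4 ℤ.*_) (N≡norm d∈ z)) (sym (ℤ.pos-* 4 (norm z)))) le)

    pointNorm-coercive : ∀ p {m} → ℤ.∣ proj₁ p ∣ ≡ m ⊎ ℤ.∣ proj₂ p ∣ ≡ m → 3 ℕ.* (m ℕ.* m) ℕ.≤ 4 ℕ.* pointNorm d p
    pointNorm-coercive (a , b) (inj₁ refl) = toℕ a ⟨ a , b ⟩ (coeff₁-bound′ a b)
    pointNorm-coercive (a , b) (inj₂ refl) = toℕ b ⟨ a , b ⟩ (coeffω-bound″ a b)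

  -- Each cofactor y contributes one lattice point u y for every unit u, hence
  -- the factor length (units d).
  opaque
    unfolding scale

    box-sums-small : All (λ d →
        Weight.scaledBoxSum quartic (pointNorm d) (box radius) ℕ.< 2 ℕ.* length (units d) ℕ.* scale
      × Weight.scaledBoxSum cubic   (pointNorm d) (box radius) ℕ.< 2 ℕ.* length (units d) ℕ.* scale) heegner
    box-sums-small = from-yes (All.all? (λ d →
            Weight.scaledBoxSum quartic (pointNorm d) (box radius) ℕ.<? 2 ℕ.* length (units d) ℕ.* scale
      ×-dec Weight.scaledBoxSum cubic   (pointNorm d) (box radius) ℕ.<? 2 ℕ.* length (units d) ℕ.* scale) heegner)

-- Single terms: their size, and the radicals they produce

open import Defs
open import Algebra.Bundles using (CommutativeRing; CommutativeSemiring)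
open import Data.Integer as ℤ using (ℤ; +_; 0ℤ; 1ℤ; _≤_)
import Data.Integer.Properties as ℤ
import Data.Integer.Tactic.RingSolver as ℤR
open import Data.List using (List; []; _∷_; map; length; concatMap)
open import Data.List.Membership.Propositional using (_∈_; _∉_; find)
open import Data.List.Membership.Propositional.Properties using (∈-concatMap⁻; ∈-map⁻)
open import Data.List.Relation.Unary.All as All using (All; []; _∷_)
import Data.List.Relation.Unary.All.Properties as All
open import Data.List.Relation.Unary.AllPairs as AllPairs using (AllPairs)
import Data.List.Relation.Unary.AllPairs.Properties as AllPairs
open import Data.List.Relation.Unary.Any using (here; there)
open import Data.List.Relation.Unary.Unique.Propositional using (Unique)
open import Data.Nat as ℕ using (ℕ; zero; suc)
import Data.Nat.Properties as ℕ
import Data.Nat.Tactic.RingSolver as ℕR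
open import Data.Product using (∃; _×_; _,_; proj₁; proj₂)
open import Data.Rational as ℚ using (ℚ; _/_)
import Data.Rational.Properties as ℚ
open import Data.Sum using ([_,_]′)
open import Function using (id)
open import Relation.Binary.PropositionalEquality hiding (J)
open import Relation.Nullary using (yes; no; contradiction; _×-dec_)
open import Relation.Nullary.Decidable using (from-yes)

-- |x|, |y| and |z| enter only through the norms m, n and N of x, y and z = x y.
module FactorizationTerms {T : Set} (m n : T → ℕ) (N : ℕ)
  (0<m : ∀ t → 0 ℕ.< m t) (0<n : ∀ t → 0 ℕ.< n t) (N≡ : ∀ t → N ≡ m t ℕ.* n t) (0<N : 0 ℕ.< N) where

  open RealArithmetic
  open RadicalSums using (Radical; total; root; integral-total⇒squares; rationalSquare⇒square)
  open LatticeSums using (cube; unitFraction; unitFraction-cancel)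
  open import Relation.Binary.Reasoning.Setoid ≋-setoid

  √m : T → ℝ
  √m t = √ m t

  √N : ℝ
  √N = √ N

  -- Four of the factors are compared exactly, m² / N² = 1 / n²; for the remaining k factors m ≤ N
  -- suffices.
  quartic-term : ∀ k t → √m t ↑ suc (suc (suc (suc k))) ≤ᴿ fromℚ (unitFraction (n t ℕ.* n t)) ⊗ √N ↑ suc (suc (suc (suc k)))
  quartic-term k t = scaled-≤ᴿ {A = √m t ↑ k} {√N ↑ k} {+ (a ℕ.* a) / 1} {+ (N ℕ.* N) / 1} (unitFraction (b ℕ.* b))
    (√-↑-4+ a k) (√-↑-4+ N k)
    (0</1 {a ℕ.* a} (ℕ.*-mono-< {0} {a} {0} {a} (0<m t) (0<m t))) coefficient
    (↑-mono-≤ᴿ {√m t} {√N} (√-pos a (0<m t)) (√-pos N 0<N) (√-mono a≤N) k)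
    where
    a = m t
    b = n t
    a≤N : a ℕ.≤ N
    a≤N = subst (a ℕ.≤_) (sym (N≡ t)) (ℕ.m≤m*n a b ⦃ ℕ.>-nonZero (0<n t) ⦄)
    regroup : ∀ a b → a ℕ.* b ℕ.* (a ℕ.* b) ≡ b ℕ.* b ℕ.* (a ℕ.* a)
    regroup = ℕR.solve-∀
    coefficient : + (a ℕ.* a) / 1 ≡ unitFraction (b ℕ.* b) ℚ.* (+ (N ℕ.* N) / 1)
    coefficient = sym (trans
      (cong (λ c → unitFraction (b ℕ.* b) ℚ.* (+ c / 1)) (trans (cong (λ c → c ℕ.* c) (N≡ t)) (regroup a b)))
      (unitFraction-cancel (b ℕ.* b) (a ℕ.* a) (ℕ.m<n⇒n≢0 (ℕ.*-mono-< (0<n t) (0<n t)))))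

  -- When n = s², √N = s √m, so both sides are rational multiples of the same radical √m and no
  -- estimate is lost.
  cubic-term : ∀ s t → n t ≡ s ℕ.* s → √m t ↑ 3 ≤ᴿ fromℚ (unitFraction (cube s)) ⊗ √N ↑ 3
  cubic-term s t n≡s² = scaled-≤ᴿ {A = √m t} {√m t} {+ a / 1} {+ (cube s ℕ.* a) / 1} (unitFraction (cube s))
    (√-↑-3 a) √N³≋ (0</1 {a} (0<m t)) (sym (unitFraction-cancel (cube s) a cube≢0)) (≋⇒≤ᴿ ≋-refl)
    where
    a = m t
    0<s : 0 ℕ.< s
    0<s = ℕ.n≢0⇒n>0 λ s≡0 → ℕ.m<n⇒n≢0 (0<n t) (trans n≡s² (cong (λ c → c ℕ.* c) s≡0))
    cube≢0 : cube s ≢ 0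
    cube≢0 = ℕ.m<n⇒n≢0 (ℕ.*-mono-< 0<s (ℕ.*-mono-< 0<s 0<s))
    N≡s²a : N ≡ s ℕ.* s ℕ.* a
    N≡s²a = trans (N≡ t) (trans (ℕ.*-comm a (n t)) (cong (ℕ._* a) n≡s²))
    regroup : ∀ s a → s ℕ.* s ℕ.* a ℕ.* s ≡ s ℕ.* (s ℕ.* s) ℕ.* a
    regroup = ℕR.solve-∀
    √N³≋ : √N ↑ 3 ≋ fromℕ (cube s ℕ.* a) ⊗ √m t
    √N³≋ = begin
      √N ↑ 3                          ≈⟨ √-↑-3 N ⟩
      fromℕ N ⊗ √N                     ≈⟨ ⊗-congˡ (√-square-* s a 0<s (0<m t) N≡s²a) ⟩
      fromℕ N ⊗ (fromℕ s ⊗ √m t)       ≈⟨ ⊗-assoc (fromℕ N) (fromℕ s) (√m t) ⟨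
      (fromℕ N ⊗ fromℕ s) ⊗ √m t       ≈⟨ ⊗-congʳ (fromℕ-* N s) ⟨
      fromℕ (N ℕ.* s) ⊗ √m t           ≡⟨ cong (λ c → fromℕ c ⊗ √m t) (trans (cong (ℕ._* s) N≡s²a) (regroup s a)) ⟩
      fromℕ (cube s ℕ.* a) ⊗ √m t      ∎

  -- If ∑ √m³ = q √N³ with q = u / v, then the radicals v √m³ √N have the
  -- integral sum u N².
  module _ (q : ℚ) where

    private
      v : ℕ
      v = ℚ.↧ₙ q

    -- The factor √N also turns the radicand into (v m²)² n, as N = m n. Hence a rational square
    -- here means that n itself is a square.
    radical : T → Radical
    radical t = record
      { root     = c ⊗ (√m t ⊗ √N)
      ; radicand = v ℕ.* (a ℕ.* a) ℕ.* (v ℕ.* (a ℕ.* a)) ℕ.* n t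
      ; squared  = begin
          (c ⊗ (√m t ⊗ √N)) ⊗ (c ⊗ (√m t ⊗ √N))        ≈⟨ ⊗-interchange c (√m t ⊗ √N) c (√m t ⊗ √N) ⟩
          (c ⊗ c) ⊗ ((√m t ⊗ √N) ⊗ (√m t ⊗ √N))        ≈⟨ ⊗-congˡ (⊗-interchange (√m t) √N (√m t) √N) ⟩
          (c ⊗ c) ⊗ ((√m t ⊗ √m t) ⊗ (√N ⊗ √N))        ≈⟨ ⊗-congˡ (⊗-cong (√-squared a) (√-squared N)) ⟩
          (c ⊗ c) ⊗ (fromℕ a ⊗ fromℕ N)                ≈⟨ ⊗-cong (fromℕ-* (v ℕ.* a) (v ℕ.* a)) (fromℕ-* a N) ⟨
          fromℕ (v ℕ.* a ℕ.* (v ℕ.* a)) ⊗ fromℕ (a ℕ.* N)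
                                                       ≈⟨ fromℕ-* (v ℕ.* a ℕ.* (v ℕ.* a)) (a ℕ.* N) ⟨
          fromℕ (v ℕ.* a ℕ.* (v ℕ.* a) ℕ.* (a ℕ.* N))
            ≡⟨ cong fromℕ (trans (cong (λ c → v ℕ.* a ℕ.* (v ℕ.* a) ℕ.* (a ℕ.* c)) (N≡ t)) (regroup v a (n t))) ⟩
          fromℕ (v ℕ.* (a ℕ.* a) ℕ.* (v ℕ.* (a ℕ.* a)) ℕ.* n t) ∎
      ; positive = isPos-⊗ {c} {√m t ⊗ √N} (fromℕ-pos {v ℕ.* a} (ℕ.*-mono-< {0} {v} {0} {a} (ℕ.s≤s ℕ.z≤n) (0<m t)))
          (isPos-⊗ {√m t} {√N} (√-pos a (0<m t)) (√-pos N 0<N))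
      }
      where
      a = m t
      c = fromℕ (v ℕ.* a)
      regroup : ∀ v a b → v ℕ.* a ℕ.* (v ℕ.* a) ℕ.* (a ℕ.* (a ℕ.* b)) ≡ v ℕ.* (a ℕ.* a) ℕ.* (v ℕ.* (a ℕ.* a)) ℕ.* b
      regroup = ℕR.solve-∀

    total-radicals : ∀ ts → total (map radical ts) ≋ sumᴿ (λ t → √m t ↑ 3) ts ⊗ (fromℕ v ⊗ √N)
    total-radicals []       = ≋-sym (⊗-zeroˡ (fromℕ v ⊗ √N))
    total-radicals (t ∷ ts) = ≋-trans (⊕-cong first (total-radicals ts))
      (≋-sym (⊗-distribʳ-⊕ (fromℕ v ⊗ √N) (√m t ↑ 3) (sumᴿ (λ t → √m t ↑ 3) ts)))
      where
      first : root (radical t) ≋ √m t ↑ 3 ⊗ (fromℕ v ⊗ √N)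
      first = begin
        fromℕ (v ℕ.* m t) ⊗ (√m t ⊗ √N)          ≈⟨ ⊗-congʳ (≋-trans (fromℕ-* v (m t)) (⊗-comm (fromℕ v) (fromℕ (m t)))) ⟩
        (fromℕ (m t) ⊗ fromℕ v) ⊗ (√m t ⊗ √N)    ≈⟨ ⊗-interchange (fromℕ (m t)) (fromℕ v) (√m t) √N ⟩
        (fromℕ (m t) ⊗ √m t) ⊗ (fromℕ v ⊗ √N)    ≈⟨ ⊗-congʳ (√-↑-3 (m t)) ⟨
        √m t ↑ 3 ⊗ (fromℕ v ⊗ √N)               ∎

    rational-sum⇒squares : ∀ ts → sumᴿ (λ t → √m t ↑ 3) ts ≋ fromℚ q ⊗ √N ↑ 3 →
      ∀ {t} → t ∈ ts → ∃ λ s → n t ≡ s ℕ.* s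
    rational-sum⇒squares ts eq {t} t∈ = rationalSquare⇒square (v ℕ.* (m t ℕ.* m t)) (n t)
      (ℕ.m<n⇒n≢0 (ℕ.*-mono-< {0} {v} (ℕ.s≤s ℕ.z≤n) (ℕ.*-mono-< (0<m t) (0<m t))))
      (All.lookup (All.map⁻ (integral-total⇒squares (map radical ts) (ℚ.↥ q ℤ.* + (N ℕ.* N)) integral)) t∈)
      where
      integral : total (map radical ts) ≋ fromℤ (ℚ.↥ q ℤ.* + (N ℕ.* N))
      integral = begin
        total (map radical ts)                           ≈⟨ total-radicals ts ⟩
        sumᴿ (λ t → √m t ↑ 3) ts ⊗ (fromℕ v ⊗ √N)       ≈⟨ ⊗-congʳ eq ⟩
        (fromℚ q ⊗ √N ↑ 3) ⊗ (fromℕ v ⊗ √N)             ≈⟨ ⊗-interchange (fromℚ q) (√N ↑ 3) (fromℕ v) √N ⟩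
        (fromℚ q ⊗ fromℕ v) ⊗ (√N ↑ 3 ⊗ √N)             ≈⟨ ⊗-cong (fromℚ-numerator q) (⊗-congʳ (√-↑-3 N)) ⟩
        fromℤ (ℚ.↥ q) ⊗ ((fromℕ N ⊗ √N) ⊗ √N)            ≈⟨ ⊗-congˡ (⊗-assoc (fromℕ N) √N √N) ⟩
        fromℤ (ℚ.↥ q) ⊗ (fromℕ N ⊗ (√N ⊗ √N))            ≈⟨ ⊗-congˡ (⊗-congˡ (√-squared N)) ⟩
        fromℤ (ℚ.↥ q) ⊗ (fromℕ N ⊗ fromℕ N)              ≈⟨ ⊗-congˡ (fromℕ-* N N) ⟨
        fromℤ (ℚ.↥ q) ⊗ fromℕ (N ℕ.* N)                  ≈⟨ fromℤ-* (ℚ.↥ q) (+ (N ℕ.* N)) ⟨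
        fromℤ (ℚ.↥ q ℤ.* + (N ℕ.* N))                    ∎

-- Over an abstract semiring the products stay atomic for the solver, and no coordinates appear.
module Rearrangements {c ℓ} (R : CommutativeSemiring c ℓ) where

  open CommutativeSemiring R using () renaming (_*_ to _·_; _≈_ to _≃_; refl to ≃-refl)
  open import Algebra.Solver.Ring.NaturalCoefficients.Default R using (solve; _:*_; _:=_)

  regroup-left : ∀ v x u x′ y′ → ((v · x) · (u · (x′ · y′))) ≃ (((u · v) · y′) · (x · x′))
  regroup-left = solve 5 (λ v x u x′ y′ → v :* x :* (u :* (x′ :* y′)) := (u :* v) :* y′ :* (x :* x′)) ≃-refl

  regroup-right : ∀ u y x x′ → ((u · y) · (x · x′)) ≃ (x′ · (u · (x · y)))
  regroup-right = solve 4 (λ u y x x′ → u :* y :* (x :* x′) := x′ :* (u :* (x :* y))) ≃-refl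

-- From unitary divisors to distinct lattice points

module UnitaryDivisorSums {d} (d∈ : d ∈ heegner) (z : 𝒪 d) (z≢0 : z ≢ 0𝒪) where

  open RealArithmetic
  open LatticeSums using (Point; Weight; quartic; cubic; scale; scale≢0; radius; unitFraction; unitFraction-inverse;
    /1-*ℕ; lattice-sum-≤; sumℚ-++; 0≤/1; rootCube; rootCube-square)
  open Units

  Divisor : Set
  Divisor = ∃ λ x → x ◊ z

  divisors : List Divisor
  divisors = unitaryDivisors d∈ z z≢0

  x y : Divisor → 𝒪 d
  x (a , _) = a
  y (_ , _ , b , _) = b

  x*y≡z : ∀ t → x t * y t ≡ z
  x*y≡z (_ , _ , _ , eq , _) = eq

  x≢0 y≢0 : ∀ t → _ ≢ 0𝒪
  x≢0 t = factorˡ≢0 d∈ {x t} {y t} z≢0 (x*y≡z t)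
  y≢0 t = factorʳ≢0 d∈ {x t} {y t} z≢0 (x*y≡z t)

  x-sector : ∀ t → Sector d (x t)
  x-sector (_ , (_ , s) , _) = s

  norm-* : ∀ a b → norm (a * b) ≡ norm a ℕ.* norm b
  norm-* a b = trans (cong ℤ.∣_∣ (N-* d∈ a b)) (ℤ.abs-* (normℤ a) (normℤ b))

  norm-0 : norm {d} 0𝒪 ≡ 0
  norm-0 = cong ℤ.∣_∣ (vanish (tr d) (nm d))
    where
    vanish : ∀ t n → 0ℤ ℤ.* (0ℤ ℤ.+ t ℤ.* 0ℤ) ℤ.- n ℤ.* (0ℤ ℤ.* (ℤ.- 0ℤ)) ≡ 0ℤ
    vanish = ℤR.solve-∀

  norm≢0 : ∀ {a} → a ≢ 0𝒪 → norm a ≢ 0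
  norm≢0 {a} a≢0 e = ℕ.1+n≰n (subst (1 ℕ.≤_) e (ℤ.drop‿+≤+ (subst (1ℤ ℤ.≤_) (N≡norm d∈ a) (1≤N d∈ a≢0))))

  0<norm : ∀ {a} → a ≢ 0𝒪 → 0 ℕ.< norm a
  0<norm a≢0 = ℕ.n≢0⇒n>0 (norm≢0 a≢0)

  norm≡0⇒≡0 : ∀ a → norm a ≡ 0 → a ≡ 0𝒪
  norm≡0⇒≡0 a e with a ≟𝒪 0𝒪
  ... | yes a≡0 = a≡0
  ... | no  a≢0 = contradiction e (norm≢0 a≢0)

  -- The norm carries the question to ℕ: norm (a - b) · norm c = 0 with norm c ≢ 0, and only 0 has
  -- norm 0.
  *-cancelʳ : ∀ {a b} c → c ≢ 0𝒪 → a * c ≡ b * c → a ≡ b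
  *-cancelʳ {a} {b} c c≢0 eq = x∙y⁻¹≈ε⇒x≈y a b (norm≡0⇒≡0 (a + - b) n≡0)
    where
    open import Algebra.Properties.Ring (CommutativeRing.ring (𝒪-commutativeRing {d})) using ([y-z]x≈yx-zx)
    open import Algebra.Properties.Group (CommutativeRing.+-group (𝒪-commutativeRing {d})) using (x∙y⁻¹≈ε⇒x≈y; x≈y⇒x∙y⁻¹≈ε)
    n≡0 : norm (a + - b) ≡ 0
    n≡0 = [ id , (λ e → contradiction e (norm≢0 c≢0)) ]′
      (ℕ.m*n≡0⇒m≡0∨n≡0 (norm (a + - b)) (trans (sym (norm-* (a + - b) c))
        (trans (cong norm (trans ([y-z]x≈yx-zx c a b) (x≈y⇒x∙y⁻¹≈ε eq))) norm-0)))

  us : List (𝒪 d)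
  us = units d

  norm-unit : ∀ {u} → u ∈ us → norm u ≡ 1
  norm-unit = All.lookup (All.lookup unit-norms d∈)

  norm-unit-* : ∀ {u} → u ∈ us → ∀ a → norm (u * a) ≡ norm a
  norm-unit-* {u} u∈ a = trans (norm-* u a) (trans (cong (ℕ._* norm a) (norm-unit u∈)) (ℕ.+-identityʳ (norm a)))

  -- u y = u′ y′ makes x and x′ associates, and the sector contains only one
  -- associate of each element.
  associates⇒≡ : ∀ {u u′} → u ∈ us → u′ ∈ us → ∀ t t′ → u * y t ≡ u′ * y t′ → x t ≡ x t′
  associates⇒≡ {u} {u′} u∈ u′∈ t t′ eq = trans (sym (1* (x t))) (trans (cong (_* x t) (sym v≡1)) vx≡x′)
    where
    open Rearrangements (CommutativeRing.commutativeSemiring (𝒪-commutativeRing {d}))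
    quotient = find (All.lookup (All.lookup (All.lookup unit-quotients d∈) u∈) u′∈)
    v = proj₁ quotient
    v∈ : v ∈ us
    v∈ = proj₁ (proj₂ quotient)
    uv≡u′ : u * v ≡ u′
    uv≡u′ = proj₂ (proj₂ quotient)
    1* : ∀ a → 1𝒪 * a ≡ a
    1* = CommutativeRing.*-identityˡ (𝒪-commutativeRing {d})
    uz≢0 : u * z ≢ 0𝒪
    uz≢0 e = norm≢0 z≢0 (trans (sym (norm-unit-* u∈ z)) (trans (cong norm e) norm-0))
    -- u z x′ = u x y x′ = u′ y′ x x′ = u v z x
    vx≡x′ : v * x t ≡ x t′
    vx≡x′ = *-cancelʳ (u * z) uz≢0 (begin
      v * x t * (u * z)              ≡⟨ cong (λ a → v * x t * (u * a)) (x*y≡z t′) ⟨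
      v * x t * (u * (x t′ * y t′))  ≡⟨ regroup-left v (x t) u (x t′) (y t′) ⟩
      (u * v) * y t′ * (x t * x t′)  ≡⟨ cong (λ a → a * y t′ * (x t * x t′)) uv≡u′ ⟩
      u′ * y t′ * (x t * x t′)       ≡⟨ cong (_* (x t * x t′)) eq ⟨
      u * y t * (x t * x t′)         ≡⟨ regroup-right u (y t) (x t) (x t′) ⟩
      x t′ * (u * (x t * y t))       ≡⟨ cong (λ a → x t′ * (u * a)) (x*y≡z t) ⟩
      x t′ * (u * z)                 ∎)
      where open ≡-Reasoning
    v≡1 : v ≡ 1𝒪
    v≡1 = All.lookup (rotations d) v∈ (x t) (x-sector t) (subst (Sector d) (sym vx≡x′) (x-sector t′))

  toPoint : 𝒪 d → Point
  toPoint ⟨ a , b ⟩ = a , b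

  toPoint-injective : ∀ {a b} → toPoint a ≡ toPoint b → a ≡ b
  toPoint-injective {⟨ _ , _ ⟩} {⟨ _ , _ ⟩} refl = refl

  pointNorm-toPoint : ∀ a → pointNorm d (toPoint a) ≡ norm a
  pointNorm-toPoint ⟨ _ , _ ⟩ = refl

  cofactorPoints : Divisor → List Point
  cofactorPoints t = map (λ u → toPoint (u * y t)) us

  points : List Point
  points = concatMap cofactorPoints divisors

  -- For one divisor, equal points give equal units by cancelling y. For two divisors, equal points
  -- force x = x′, while the listed divisors have distinct first components.
  points-unique : Unique points
  points-unique = AllPairs.concat⁺
    (All.map⁺ (All.tabulate λ {t} _ → AllPairs.map⁺ (AllPairs.map
      (λ u≢u′ eq → u≢u′ (*-cancelʳ (y t) (y≢0 t) (toPoint-injective eq))) (All.lookup units-unique d∈))))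
    (AllPairs.map⁺ (AllPairs.map
      (λ {t} {t′} x≢x′ → All.map⁺ (All.tabulate λ u∈ → All.map⁺ (All.tabulate λ u′∈ eq →
        x≢x′ (associates⇒≡ u∈ u′∈ t t′ (toPoint-injective eq)))))
      (AllPairs.map⁻ (unitaryDivisors-unique d∈ z z≢0))))

  0∉points : (0ℤ , 0ℤ) ∉ points
  0∉points 0∈ =
    let (t , _ , 0∈t) = find (∈-concatMap⁻ cofactorPoints {xs = divisors} 0∈)
        (u , u∈ , eq) = ∈-map⁻ (λ u → toPoint (u * y t)) 0∈t
    in norm≢0 (y≢0 t) (trans (sym (norm-unit-* u∈ (y t))) (trans (cong norm (toPoint-injective {u * y t} {0𝒪} (sym eq))) norm-0))

  w : ℕ
  w = length us

  module _ (W : Weight) where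

    open Weight W

    φ : Divisor → ℚ
    φ t = value (norm (y t))

    -- Units preserve the norm, so all terms are equal; the list of units is generalised to vs for
    -- the induction.
    sum-cofactorPoints : ∀ t vs → (∀ {u} → u ∈ vs → u ∈ us) →
      sumℚ (λ p → value (pointNorm d p)) (map (λ u → toPoint (u * y t)) vs) ≡ + length vs / 1 ℚ.* φ t
    sum-cofactorPoints t [] _ = sym (ℚ.*-zeroˡ (φ t))
    sum-cofactorPoints t (u ∷ vs) sub = begin
      value (pointNorm d (toPoint (u * y t))) ℚ.+ rest  ≡⟨ cong (λ m → value m ℚ.+ rest) (pointNorm-toPoint (u * y t)) ⟩
      value (norm (u * y t)) ℚ.+ rest
        ≡⟨ cong₂ (λ m r → value m ℚ.+ r) (norm-unit-* (sub (here refl)) (y t)) (sum-cofactorPoints t vs (λ v∈ → sub (there v∈))) ⟩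
      φ t ℚ.+ + length vs / 1 ℚ.* φ t                   ≡⟨ cong (ℚ._+ (+ length vs / 1 ℚ.* φ t)) (ℚ.*-identityˡ (φ t)) ⟨
      + 1 / 1 ℚ.* φ t ℚ.+ + length vs / 1 ℚ.* φ t       ≡⟨ ℚ.*-distribʳ-+ (φ t) (+ 1 / 1) (+ length vs / 1) ⟨
      (+ 1 / 1 ℚ.+ + length vs / 1) ℚ.* φ t             ≡⟨ cong (ℚ._* φ t) (/1-+ (+ 1) (+ length vs)) ⟨
      + length (u ∷ vs) / 1 ℚ.* φ t                     ∎
      where
      open ≡-Reasoning
      rest = sumℚ (λ p → value (pointNorm d p)) (map (λ u → toPoint (u * y t)) vs)

    sum-points : ∀ ts → sumℚ (λ p → value (pointNorm d p)) (concatMap cofactorPoints ts) ≡ + w / 1 ℚ.* sumℚ φ ts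
    sum-points [] = sym (ℚ.*-zeroʳ (+ w / 1))
    sum-points (t ∷ ts) = trans (sumℚ-++ (λ p → value (pointNorm d p)) (cofactorPoints t) (concatMap cofactorPoints ts))
      (trans (cong₂ ℚ._+_ (sum-cofactorPoints t us id) (sum-points ts))
        (sym (ℚ.*-distribˡ-+ (+ w / 1) (φ t) (sumℚ φ ts))))

    -- Multiplying by `w` turns the sum over cofactors into a sum over lattice points, and
    -- multiplying by `scale` clears the denominator of the lattice bound. What remains is the
    -- comparison in ℕ that was checked for each d.
    sum-φ<2 : scaledBoxSum (pointNorm d) (LatticeSums.box radius) ℕ.< 2 ℕ.* w ℕ.* scale → sumℚ φ divisors ℚ.< + 2 / 1
    sum-φ<2 B< = ℚ.≰⇒> λ 2≤Σ → ℚ.<-irrefl refl (begin-strict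
      + (2 ℕ.* w ℕ.* scale) / 1                 ≡⟨ trans (/1-*ℕ (2 ℕ.* w) scale) (cong (ℚ._* scaleℚ) (trans (/1-*ℕ 2 w) (ℚ.*-comm (+ 2 / 1) (+ w / 1)))) ⟩
      + w / 1 ℚ.* (+ 2 / 1) ℚ.* scaleℚ          ≤⟨ *-mono (*-monoˡ 2≤Σ) ⟩
      + w / 1 ℚ.* Σ ℚ.* scaleℚ                  ≡⟨ cong (ℚ._* scaleℚ) (sum-points divisors) ⟨
      sumℚ (λ p → value (pointNorm d p)) points ℚ.* scaleℚ
                                                ≤⟨ *-mono (lattice-sum-≤ W (pointNorm d) (pointNorm-coercive d∈) points-unique 0∉points) ⟩
      + B / 1 ℚ.* unitFraction scale ℚ.* scaleℚ ≡⟨ ℚ.*-assoc (+ B / 1) (unitFraction scale) scaleℚ ⟩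
      + B / 1 ℚ.* (unitFraction scale ℚ.* scaleℚ) ≡⟨ cong (+ B / 1 ℚ.*_) (unitFraction-inverse scale scale≢0) ⟩
      + B / 1 ℚ.* ℚ.1ℚ                          ≡⟨ ℚ.*-identityʳ (+ B / 1) ⟩
      + B / 1                                   <⟨ /1-mono-< B< ⟩
      + (2 ℕ.* w ℕ.* scale) / 1                 ∎)
      where
      open ℚ.≤-Reasoning
      Σ = sumℚ φ divisors
      B = scaledBoxSum (pointNorm d) (LatticeSums.box radius)
      scaleℚ = + scale / 1
      *-mono : ∀ {p q} → p ℚ.≤ q → p ℚ.* scaleℚ ℚ.≤ q ℚ.* scaleℚ
      *-mono = ℚ.*-monoʳ-≤-nonNeg scaleℚ ⦃ ℚ.nonNegative (0≤/1 scale) ⦄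
      *-monoˡ : ∀ {p q} → p ℚ.≤ q → + w / 1 ℚ.* p ℚ.≤ + w / 1 ℚ.* q
      *-monoˡ = ℚ.*-monoˡ-≤-nonNeg (+ w / 1) ⦃ ℚ.nonNegative (0≤/1 w) ⦄
      /1-mono-< : ∀ {m n} → m ℕ.< n → + m / 1 ℚ.< + n / 1
      /1-mono-< {m} {n} m<n = /-mono-< (+ m) (+ n) 0 0 (ℤ.*-monoʳ-<-pos (+ 1) (ℤ.+<+ m<n))

  nx ny : Divisor → ℕ
  nx t = norm (x t)
  ny t = norm (y t)

  open FactorizationTerms nx ny (norm z) (λ t → 0<norm (x≢0 t)) (λ t → 0<norm (y≢0 t))
    (λ t → trans (cong norm (sym (x*y≡z t))) (norm-* (x t) (y t))) (0<norm z≢0)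

  power : ℤ → Divisor → ℝ
  power m t = zpow ∣ x t ∣ (∣∣-pos d∈ (proj₁ (proj₁ (proj₂ t)))) m

  Z : ℤ → ℝ
  Z = zpow ∣ z ∣ (∣∣-pos d∈ z≢0)

  power≋ : ∀ k t → power (+ k) t ≋ √m t ↑ k
  power≋ k t = ^ᴿ≋↑ (√m t) k

  Z≋ : ∀ k → Z (+ k) ≋ √N ↑ k
  Z≋ k = ^ᴿ≋↑ √N k

  private
    δ*-as-sum : ∀ m → δ* d∈ m z z≢0 ≡ sumᴿ (power m) divisors
    δ*-as-sum m = foldr≡sumᴿ (power m) divisors

    opaque
      unfolding _⊕_

      I*-as-quotient : ∀ m → I* d∈ m z z≢0 ≋ δ* d∈ m z z≢0 ⊗ inv (zpow ∣ z ∣ (∣∣-pos d∈ z≢0) m) (zpow-pos ∣ z ∣ (∣∣-pos d∈ z≢0) m)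
      I*-as-quotient m = pointwise λ _ → refl

  I*≤ : ∀ m p → sumᴿ (power m) divisors ≤ᴿ fromℚ p ⊗ Z m → I* d∈ m z z≢0 ≤ᴿ fromℚ p
  I*≤ m p le = ≤ᴿ-trans (≋⇒≤ᴿ (I*-as-quotient m))
    (quotient-≤ {δ* d∈ m z z≢0} {zpow ∣ z ∣ (∣∣-pos d∈ z≢0) m} {p} (zpow-pos ∣ z ∣ (∣∣-pos d∈ z≢0) m) (subst (_≤ᴿ fromℚ p ⊗ Z m) (sym (δ*-as-sum m)) le))

  I*≋⇒ : ∀ m q → I* d∈ m z z≢0 ≋ fromℚ q → sumᴿ (power m) divisors ≋ fromℚ q ⊗ Z m
  I*≋⇒ m q eq = subst (_≋ fromℚ q ⊗ Z m) (δ*-as-sum m)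
    (quotient⇒product {δ* d∈ m z z≢0} {zpow ∣ z ∣ (∣∣-pos d∈ z≢0) m} {q} (zpow-pos ∣ z ∣ (∣∣-pos d∈ z≢0) m) (≋-trans (≋-sym (I*-as-quotient m)) eq))

  I*<2 : ∀ W m → sumℚ (φ W) divisors ℚ.< + 2 / 1 →
    (∀ {t} → t ∈ divisors → power m t ≤ᴿ fromℚ (φ W t) ⊗ Z m) → I* d∈ m z z≢0 <ᴿ 2ᴿ
  I*<2 W m Σ<2 le = ≤ᴿ-<-fromℚ (I*≤ m (sumℚ (φ W) divisors) (sumᴿ-≤ᴿ (power m) (φ W) (Z m) divisors le)) Σ<2

  term-≤ : ∀ W k t {p} → p ≡ φ W t → √m t ↑ k ≤ᴿ fromℚ p ⊗ √N ↑ k → power (+ k) t ≤ᴿ fromℚ (φ W t) ⊗ Z (+ k)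
  term-≤ W k t refl le = ≤ᴿ-trans (≋⇒≤ᴿ (power≋ k t)) (≤ᴿ-trans le (≋⇒≤ᴿ (⊗-congˡ (≋-sym (Z≋ k)))))

  rational-sum : ∀ k q → I* d∈ (+ k) z z≢0 ≋ fromℚ q → sumᴿ (λ t → √m t ↑ k) divisors ≋ fromℚ q ⊗ √N ↑ k
  rational-sum k q eq = ≋-trans (≋-sym (sumᴿ-cong {f = power (+ k)} {λ t → √m t ↑ k} divisors (power≋ k)))
    (≋-trans (I*≋⇒ (+ k) q eq) (⊗-congˡ {fromℚ q} {Z (+ k)} {√N ↑ k} (Z≋ k)))

  n≥4 : ∀ n → + 4 ≤ n → I* d∈ n z z≢0 <ᴿ 2ᴿ
  n≥4 (+ suc (suc (suc (suc k)))) _ = I*<2 quartic (+ suc (suc (suc (suc k))))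
    (sum-φ<2 quartic (proj₁ (All.lookup box-sums-small d∈)))
    (λ {t} _ → term-≤ quartic (suc (suc (suc (suc k)))) t refl (quartic-term k t))
  n≥4 (+ 0) (ℤ.+≤+ ())
  n≥4 (+ 1) (ℤ.+≤+ (ℕ.s≤s ()))
  n≥4 (+ 2) (ℤ.+≤+ (ℕ.s≤s (ℕ.s≤s ())))
  n≥4 (+ 3) (ℤ.+≤+ (ℕ.s≤s (ℕ.s≤s (ℕ.s≤s ()))))

  n≡3 : IsRational (I* d∈ (+ 3) z z≢0) → I* d∈ (+ 3) z z≢0 <ᴿ 2ᴿ
  n≡3 (q , I≈q) = I*<2 cubic (+ 3) (sum-φ<2 cubic (proj₂ (All.lookup box-sums-small d∈))) λ {t} t∈ →
    let (s , ny≡s²) = rational-sum⇒squares q divisors (rational-sum 3 q (wrap I≈q)) t∈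
    -- As the norm of y is s², the weight of y is 1 / s³; the value 0 of `rootCube`, which would not
    -- bound the term, does not occur.
    in term-≤ cubic 3 t (cong unitFraction (sym (trans (cong rootCube ny≡s²) (rootCube-square s)))) (cubic-term s t ny≡s²)

theorem2p1 : (d : ℤ) (d∈ : d ∈ heegner) (z : 𝒪 d) (z≢0 : z ≢ 0𝒪) →
    ((n : ℤ) → + 4 ≤ n → I* d∈ n z z≢0 <ᴿ 2ᴿ) ×
    (IsRational (I* d∈ (+ 3) z z≢0) → I* d∈ (+ 3) z z≢0 <ᴿ 2ᴿ)
theorem2p1 d d∈ z z≢0 = UnitaryDivisorSums.n≥4 d∈ z z≢0 , UnitaryDivisorSums.n≡3 d∈ z z≢0
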